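{- Let $r\ge 2$, $W=S_r$, and let $\lambda$ be a partition with at most $r$ parts; let $\mathcal{B}=\mathcal{B}_\lambda$ and let $W_\lambda$ be the stabilizer of $\lambda$ in $W$. There exists a family of subsets $\mathcal{B}^\circ(w)\subseteq\mathcal{B}$, $w\in W$, such that $\mathcal{B}^\circ(w)=\mathcal{B}^\circ(w')$ if and only if $w,w'$ lie in the same coset of $W/W_\lambda$, and otherwise $\mathcal{B}^\circ(w)\cap\mathcal{B}^\circ(w')=\varnothing$, and such that $\mathcal{B}(w)=\bigcup_{y\le w}\mathcal{B}^\circ(y)$ for all $w\in W$. If $w$ is the shortest element of its coset $wW_\lambda$, then $$\mathcal{B}^\circ(w)=\{v\in\mathcal{B}\mid w_0\,\omega(v)=w\}.$$ If $w$ is not the shortest element of its coset, then the equation $w_0\omega(v)=w$ has no solutions $v\in\mathcal{B}$.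
   Context: $\mathcal{B}_\lambda$ is the Kashiwara–Nakashima crystal of semistandard Young tableaux of shape $\lambda$ with entries in $\{1,\dots,r\}$ (type $A_{r-1}$, Kashiwara operators $e_i,f_i$, $1\le i\le r-1$), with highest weight element $v_\lambda$. $\le$ is the Bruhat order on $W$, $s_i=(i,i+1)$, $w_0$ the longest element. Demazure crystals $\mathcal{B}(w)\subseteq\mathcal{B}$: $\mathcal{B}(1)=\{v_\lambda\}$, and if $s_iw>w$ then $\mathcal{B}(s_iw)=\{x\in\mathcal{B}\mid e_i^k x\in\mathcal{B}(w)\text{ for some }k\ge0\}$. Nondescending product: for simple reflections, $\Pi_{\mathrm{nd}}()=1$, $\Pi_{\mathrm{nd}}(s_{i_1})=s_{i_1}$, and $\Pi_{\mathrm{nd}}(s_{i_1},\dots,s_{i_k})=s_{i_1}\pi$ if $s_{i_1}\pi>\pi$ and $=\pi$ otherwise, where $\pi=\Pi_{\mathrm{nd}}(s_{i_2},\dots,s_{i_k})$. The map $\omega:\mathcal{B}\to W$: let $J$ be the reduced word for $w_0$ obtained by concatenating the blocks $(r-m,r-m+1,\dots,r-1)$ for $m=1,2,\dots,r-1$, so $J=(J_1,\dots,J_{M})$, $M=r(r-1)/2$. For $v\in\mathcal{B}$ let $b_1$ be maximal with $e_{J_1}^{b_1}v\neq0$, then $b_2$ maximal with $e_{J_2}^{b_2}e_{J_1}^{b_1}v\ne0$, and so on, giving $(b_1,\dots,b_M)$. For $1\le p\le m\le r-1$ put $\beta_{m,p}=b_{m(m-1)/2+p}$. Call $\beta_{m,p}$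 circled if either $p=m$ and $\beta_{m,m}=0$, or $p<m$ and $\beta_{m,p}=\beta_{m,p+1}$. Let $(s_{j_1},\dots,s_{j_k})$ be the sequence obtained by listing, for $m=1,2,\dots,r-1$ in turn and within each $m$ for $p=m,m-1,\dots,1$, the reflection $s_p$ whenever $\beta_{m,p}$ is circled. Then $\omega(v)=\Pi_{\mathrm{nd}}(s_{j_1},\dots,s_{j_k})$. -}

module Defs where

open import Data.Nat using (ℕ; zero; suc; _+_; _∸_; _≤_; _<_; _≡ᵇ_; _<ᵇ_; s≤s; z≤n)
open import Data.Nat.Properties using (_<?_; ≤-trans; n≤1+n)
open import Data.Bool using (Bool; true; false; if_then_else_; _∧_)
open import Data.Fin using (Fin; toℕ; fromℕ<)
open import Data.Fin.Permutation using (Permutation′; _⟨$⟩ʳ_; _∘ₚ_; _≈_; id; transpose; reverse)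
open import Data.Nat.ListAction using (sum)
open import Data.List using (List; []; _∷_; _++_; length; replicate; map; concat; concatMap; allFin)
import Data.List as L
open import Data.List.Relation.Unary.All using (All)
open import Data.Vec using (Vec; []; _∷_; lookup; tabulate)
open import Data.Maybe using (Maybe; just; nothing)
open import Data.Product using (Σ; _×_; _,_; ∃-syntax)
open import Data.Unit using (⊤)
open import Data.Empty using (⊥)
open import Relation.Nullary using (¬_; yes; no)
open import Relation.Binary.PropositionalEquality using (_≡_; _≢_)

-- The Weyl group W = S_r : permutations of Fin r (library notion).
-- Equality of group elements is pointwise equality _≈_ of the library.

Perm : ℕ → Set
Perm r = Permutation′ r

-- Group product in the usual (right-to-left) convention:
-- (u · v)(k) = u (v k).  (The library's _∘ₚ_ is diagrammatic.)
infixl 7 _·_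
_·_ : ∀ {r} → Perm r → Perm r → Perm r
u · v = v ∘ₚ u

w₀ : ∀ {r} → Perm r
w₀ = reverse

-- simple reflection s_p = (p, p+1) for 1 ≤ p ≤ r-1 (1-based labels);
-- out of range indices give the identity (never used out of range).
sref : ∀ {r} → ℕ → Perm r
sref {r} zero = id
sref {r} (suc q) with suc q <? r
... | yes q+1<r = transpose (fromℕ< (≤-trans (n≤1+n (suc q)) q+1<r)) (fromℕ< q+1<r)
... | no _ = id

len : ∀ {r} → Perm r → ℕ
len {r} π = sum (concatMap (λ i → map (λ j →
    if (toℕ i <ᵇ toℕ j) ∧ (toℕ (π ⟨$⟩ʳ j) <ᵇ toℕ (π ⟨$⟩ʳ i)) then 1 else 0)
      (allFin r)) (allFin r))

data _≤B_ {r : ℕ} : Perm r → Perm r → Set where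
  ≤B-refl : ∀ {u v} → u ≈ v → u ≤B v
  ≤B-step : ∀ {u v w} → u ≤B v → (a b : Fin r) → a ≢ b →
            len v < len (transpose a b · v) → w ≈ transpose a b · v → u ≤B w

-- Partitions with at most r parts: weakly decreasing vectors of length r
-- (padded with zeros).

IsPartition : ∀ {r} → Vec ℕ r → Set
IsPartition {r} lam = ∀ (i j : Fin r) → toℕ i ≤ toℕ j → lookup lam j ≤ lookup lam i

-- stabilizer W_λ of λ (action (u·λ)_{u(i)} = λ_i)
Stab : ∀ {r} → Vec ℕ r → Perm r → Set
Stab lam u = ∀ i → lookup lam (u ⟨$⟩ʳ i) ≡ lookup lam i

SameCoset : ∀ {r} → Vec ℕ r → Perm r → Perm r → Set
SameCoset {r} lam w w' = Σ (Perm r) (λ u → Stab lam u × (w' ≈ w · u))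

Shortest : ∀ {r} → Vec ℕ r → Perm r → Set
Shortest {r} lam w = ∀ (w' : Perm r) → SameCoset lam w w' → len w ≤ len w'

-- Tableaux: a tableau is given by its r rows (top to bottom), rows of
-- length 0 allowed; entries are the labels 1..r.

Tab : ℕ → Set
Tab r = Vec (List ℕ) r

RowWeak : List ℕ → Set
RowWeak [] = ⊤
RowWeak (x ∷ []) = ⊤
RowWeak (x ∷ y ∷ xs) = x ≤ y × RowWeak (y ∷ xs)

ColStrict : List ℕ → List ℕ → Set
ColStrict _ [] = ⊤
ColStrict [] (y ∷ ys) = ⊥
ColStrict (x ∷ xs) (y ∷ ys) = x < y × ColStrict xs ys

ColsOK : ∀ {n} → Vec (List ℕ) n → Set
ColsOK [] = ⊤
ColsOK (a ∷ []) = ⊤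
ColsOK (a ∷ b ∷ rest) = ColStrict a b × ColsOK (b ∷ rest)

InB : ∀ {r} → Vec ℕ r → Tab r → Set
InB {r} lam T =
    (∀ j → length (lookup T j) ≡ lookup lam j)
  × (∀ j → All (λ x → 1 ≤ x × x ≤ r) (lookup T j))
  × (∀ j → RowWeak (lookup T j))
  × ColsOK T

vhw : ∀ {r} → Vec ℕ r → Tab r
vhw lam = tabulate (λ j → replicate (lookup lam j) (suc (toℕ j)))

-- Kashiwara operator e_i via the signature rule on the row reading word
-- (rows read left to right, from the bottom row to the top row).
-- Letters i+1 followed (later) by i cancel; e_i changes the leftmost
-- uncancelled i+1 into i, and is 0 (nothing) if there is none.

readWord : ∀ {n} → Vec (List ℕ) n → List ℕ
readWord [] = []
readWord (row ∷ rows) = readWord rows ++ row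

-- scanning the reversed word with a counter of pending letters i;
-- marks the uncancelled letters i+1
marksRev : ℕ → List ℕ → ℕ → List Bool
marksRev i [] c = []
marksRev i (x ∷ xs) c =
  if x ≡ᵇ i then false ∷ marksRev i xs (suc c)
  else if x ≡ᵇ suc i then
    (if c ≡ᵇ 0 then true ∷ marksRev i xs 0 else false ∷ marksRev i xs (c ∸ 1))
  else false ∷ marksRev i xs c

firstMark : List Bool → List Bool
firstMark [] = []
firstMark (true ∷ bs) = true ∷ map (λ _ → false) bs
firstMark (false ∷ bs) = false ∷ firstMark bs

anyTrue : List Bool → Bool
anyTrue [] = false
anyTrue (b ∷ bs) = if b then true else anyTrue bs

repRow : List ℕ → List Bool → List ℕ × List Bool
repRow [] bs = [] , bs
repRow (x ∷ xs) [] = x ∷ xs , []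
repRow (x ∷ xs) (b ∷ bs) with repRow xs bs
... | xs' , bs' = (if b then x ∸ 1 else x) ∷ xs' , bs'

repRows : ∀ {n} → Vec (List ℕ) n → List Bool → Vec (List ℕ) n × List Bool
repRows [] bs = [] , bs
repRows (row ∷ rows) bs with repRows rows bs
... | rows' , bs' with repRow row bs'
...   | row' , bs'' = (row' ∷ rows') , bs''

eOp : ∀ {r} → ℕ → Tab r → Maybe (Tab r)
eOp i T with firstMark (L.reverse (marksRev i (L.reverse (readWord T)) 0))
... | ms = if anyTrue ms then just (Data.Product.proj₁ (repRows T ms)) else nothing

eIter : ∀ {r} → ℕ → ℕ → Tab r → Maybe (Tab r)
eIter i zero T = just T
eIter i (suc k) T with eOp i T
... | nothing = nothing
... | just T' = eIter i k T'

-- Demazure crystals B(w): the least family with B(1) = {v_λ} and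
-- B(s_i w) = {x ∈ B | e_i^k x ∈ B(w) for some k} whenever s_i w > w.
-- (s_i w > w  ⇔  ℓ(w) < ℓ(s_i w) for simple reflections.)

data Dem {r : ℕ} (lam : Vec ℕ r) : Perm r → Tab r → Set where
  dem-id   : ∀ {w} → w ≈ id → Dem lam w (vhw lam)
  dem-step : ∀ {w w' x y} (i : ℕ) → 1 ≤ i → i < r →
             len w < len (sref i · w) → w' ≈ sref i · w →
             InB lam x → (k : ℕ) → eIter i k x ≡ just y →
             Dem lam w y → Dem lam w' x

-- apply e_i as often as possible: (maximal b, e_i^b T).  The fuel
-- (length of the reading word + 1) bounds b, since each application
-- turns one letter i+1 into i.
maxEFuel : ∀ {r} → ℕ → ℕ → Tab r → ℕ × Tab r
maxEFuel i zero T = 0 , T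
maxEFuel i (suc f) T with eOp i T
... | nothing = 0 , T
... | just T' with maxEFuel i f T'
...   | b , T'' = suc b , T''

maxE : ∀ {r} → ℕ → Tab r → ℕ × Tab r
maxE i T = maxEFuel i (suc (length (readWord T))) T

procBlock : ∀ {r} → ℕ → ℕ → Tab r → List ℕ × Tab r
procBlock i zero T = [] , T
procBlock i (suc k) T with maxE i T
... | b , T₁ with procBlock (suc i) k T₁
...   | bs , T₂ = (b ∷ bs) , T₂

-- blocks m, m+1, ..., m+k-1 ; block m is (r-m, ..., r-1);
-- output: list of [β_{m,1}, ..., β_{m,m}]
blocksFrom : ∀ {r} → ℕ → ℕ → Tab r → List (List ℕ)
blocksFrom m zero T = []
blocksFrom {r} m (suc k) T with procBlock (r ∸ m) m T
... | bs , T₁ = bs ∷ blocksFrom (suc m) k T₁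

betas : ∀ {r} → Tab r → List (List ℕ)
betas {r} v = blocksFrom 1 (r ∸ 1) v

-- circled indices p of a block [β_{m,p}, ..., β_{m,m}], increasing p
circAux : ℕ → List ℕ → List ℕ
circAux p [] = []
circAux p (x ∷ []) = if x ≡ᵇ 0 then p ∷ [] else []
circAux p (x ∷ y ∷ rest) = (if x ≡ᵇ y then p ∷ [] else []) ++ circAux (suc p) (y ∷ rest)

-- the sequence (j_1, ..., j_k): m = 1,...,r-1, within m: p = m,...,1
circledSeq : ∀ {r} → Tab r → List ℕ
circledSeq v = concat (map (λ bs → L.reverse (circAux 1 bs)) (betas v))

Πnd : ∀ {r} → List ℕ → Perm r
Πnd [] = id
Πnd (i ∷ is) with Πnd is
... | π = if len π <ᵇ len (sref i · π) then sref i · π else π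

ω : ∀ {r} → Tab r → Perm r
ω v = Πnd (circledSeq v)

module Submission where

-- Let E_i apply e_i as often as possible and let s * w be the 0-Hecke product (the longer of w and sw).
-- The heart of the matter is that ω(E_i v) = s_{r-i} * ω(v) for every tableau v and every i.  Since e_i
-- only affects the strings a, b of two consecutive blocks, this follows from an explicit formula for
-- the strings after E_i, which the rank two transition map gives block by block, and from a 0-Hecke
-- identity for the circled reflections of the two blocks.
--
-- Hence κ(v) = w₀ ω(v) satisfies: κ(E_i v) is the smaller of κ(v) and s_i κ(v).  As multiplication by s_i
-- towards the larger (smaller) element is monotone for the Bruhat order, v ∈ B(w) iff κ(v) ≤ w; at the
-- bottom one needs that κ(v) = 1 only for the highest weight element, because the smallest entry can
-- travel through a block only if all its reflections are circled.  A coincidence λ_j = λ_{j+1} forces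
-- ω(v) * s_j = ω(v) by descending through the Gelfand–Tsetlin rows, so κ(v) is shortest in its coset and
-- Bruhat-minimal there.  Finally every coset occurs: for a tableau of weight wλ each E_i can only sort two
-- multiplicities (x ↦ max(x-c,0) is convex), and then the circled reflections sort λ into wλ.
--
-- So B°(w) is the set of v with κ(v) ∈ w W_λ.

open import Defs
open import Data.Nat
open import Data.Nat.Properties
open import Data.Nat.ListAction using (sum)
open import Data.Nat.ListAction.Properties using (sum-++)
open import Algebra.Properties.CommutativeMonoid.Sum +-0-commutativeMonoid using (sum-cong-≗; ∑-distrib-+; sum-permute; sum-remove; sum-replicate-zero) renaming (sum to ∑)
open import Data.Bool using (Bool; true; false; if_then_else_; _∧_)
open import Data.Bool.Properties using (T-≡)
open import Data.Fin using (Fin; toℕ; fromℕ<)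
import Data.Fin as F
import Data.Fin.Properties as FP
open import Data.Fin.Permutation using (_⟨$⟩ʳ_; _⟨$⟩ˡ_; _≈_; transpose)
import Data.Fin.Permutation as P
import Data.Fin.Permutation.Components as PC
open import Data.List using (List; []; _∷_; _++_; length; replicate; map; concat; concatMap; allFin)
import Data.List as L
import Data.List.Properties as LP
open import Data.List.Relation.Unary.All using (All; []; _∷_)
import Data.List.Relation.Unary.All as All
import Data.List.Relation.Unary.All.Properties as AP
open import Data.Vec using (Vec; []; _∷_; lookup; tabulate)
import Data.Vec as V
import Data.Vec.Properties as VP
open import Data.Maybe using (just; nothing)
open import Data.Product using (Σ; _×_; _,_; ∃-syntax; proj₁; proj₂)
open import Data.Sum using (_⊎_; inj₁; inj₂)
open import Data.Unit using (⊤; tt)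
open import Data.Empty using (⊥; ⊥-elim)
open import Function using (_⇔_; mk⇔; Equivalence; _∘_)
open import Relation.Binary.Definitions using (tri<; tri≈; tri>)
open import Relation.Binary.PropositionalEquality
open import Relation.Nullary using (¬_; yes; no; Dec; contradiction; does)
open import Relation.Nullary.Decidable using (_×-dec_)

-- Words and the rank two transition map

-- The exponent in the definition of B(w) can be forgotten, since a tableau and its images under
-- powers of e_i have the same image under `E`. A circle is an equality in the Gelfand-Tsetlin
-- pattern: a string of a block equals the next one exactly when the block leaves the multiplicity
-- of the letter between them unchanged. The obstacle in ω(E_i v) = s_{r-i} * ω(v) is that circles
-- appear and vanish at many places of both blocks at once. What survives is a single Hecke
-- generator that travels through the two words and at each place is either present or absent; a
-- Boolean comparison of strings decides which. At the end of the two blocks it is always present,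
-- which fixes its index, and w₀ s_{r-i} = s_i w₀ gives the statement for κ. The stabilizer enters
-- from the other side of ω(v): there a generator is pushed through whole blocks by braid relations
-- until some block absorbs it. Convexity replaces the theory of extremal weights: no `E` lowers any
-- sum of max(x-c,0) over the multiplicities, and for a weight in the orbit of λ these sums are
-- already as large as at the highest weight.

true≢false : ∀ {b} {A : Set} → b ≡ true → b ≡ false → A
true≢false refl ()

data Cls : Set where
  lo hi neither : Cls

cls : ℕ → ℕ → Cls
cls zero zero = lo
cls zero (suc zero) = hi
cls zero (suc (suc x)) = neither
cls (suc i) zero = neither
cls (suc i) (suc x) = cls i x

cls-lo : ∀ i → cls i i ≡ lo
cls-lo zero = refl
cls-lo (suc i) = cls-lo i

cls-hi : ∀ i → cls i (suc i) ≡ hi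
cls-hi zero = refl
cls-hi (suc i) = cls-hi i

cls-above : ∀ i → cls i (suc (suc i)) ≡ neither
cls-above zero = refl
cls-above (suc i) = cls-above i

cls-below : ∀ i → cls (suc i) i ≡ neither
cls-below zero = refl
cls-below (suc i) = cls-below i

lo⇒≡ : ∀ i x → cls i x ≡ lo → x ≡ i
lo⇒≡ zero zero _ = refl
lo⇒≡ zero (suc zero) ()
lo⇒≡ zero (suc (suc x)) ()
lo⇒≡ (suc i) (suc x) p = cong suc (lo⇒≡ i x p)

hi⇒≡ : ∀ i x → cls i x ≡ hi → x ≡ suc i
hi⇒≡ zero (suc zero) _ = refl
hi⇒≡ (suc i) (suc x) p = cong suc (hi⇒≡ i x p)

nextCount : Cls → ℕ → ℕ
nextCount lo c = suc c
nextCount hi c = pred c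
nextCount neither c = c

hits : Cls → ℕ → ℕ
hits lo c = 0
hits hi zero = 1
hits hi (suc c) = 0
hits neither c = 0

letter : Cls → ℕ → ℕ → ℕ → ℕ
letter lo i x c = x
letter hi i x zero = i
letter hi i x (suc c) = x
letter neither i x c = x

-- In φ, ε and E, c is the number of unmatched letters i standing to the right of the word;
-- E i is e_i applied as often as possible, i.e. it lowers every unmatched i+1.
φ : ℕ → ℕ → List ℕ → ℕ
φ i c [] = c
φ i c (x ∷ w) = nextCount (cls i x) (φ i c w)

ε : ℕ → ℕ → List ℕ → ℕ
ε i c [] = 0
ε i c (x ∷ w) = hits (cls i x) (φ i c w) + ε i c w

E : ℕ → ℕ → List ℕ → List ℕ
E i c [] = []
E i c (x ∷ w) = letter (cls i x) i x (φ i c w) ∷ E i c w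

φ₀ ε₀ : ℕ → List ℕ → ℕ
φ₀ i = φ i 0
ε₀ i = ε i 0

E₀ : ℕ → List ℕ → List ℕ
E₀ i = E i 0

neither⇒≢lo : ∀ {i x} → cls i x ≡ neither → x ≢ i
neither⇒≢lo {i} p refl with trans (sym p) (cls-lo i)
... | ()

neither⇒≢hi : ∀ {i x} → cls i x ≡ neither → x ≢ suc i
neither⇒≢hi {i} p refl with trans (sym p) (cls-hi i)
... | ()

data View (j : ℕ) : ℕ → Set where
  first  : View j j
  second : View j (suc j)
  third  : View j (suc (suc j))
  other  : ∀ {x} → cls j x ≡ neither → cls (suc j) x ≡ neither → View j x

view : ∀ j x → View j x
view zero zero = first
view zero (suc zero) = second
view zero (suc (suc zero)) = third
view zero (suc (suc (suc x))) = other refl refl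
view (suc j) zero = other refl refl
view (suc j) (suc x) with view j x
... | first = first
... | second = second
... | third = third
... | other p q = other p q

-- The string data (c₁,c₂,c₃) along (j+1,j,j+1) with the φ-values (X,Y,Z) at the three stages,
-- and the primed data along (j,j+1,j), related by the piecewise linear rank two transition map:
-- c₁' = max(c₃,c₂-c₁), c₂' = c₁+c₃, c₃' = min(c₁,c₂-c₃).  The two constructors are its linearity domains.
data Transition : (c₁ c₂ c₃ X Y Z c₁' c₂' c₃' X' Y' Z' : ℕ) → Set where
  wide : ∀ {c₁ c₂ c₃ X Y Z c₁' c₂' c₃' X' Y' Z'} (f e d x y : ℕ) →
    c₁ ≡ d + e → c₂ ≡ e + f → c₃ ≡ f → X ≡ x → Y ≡ y → Z ≡ x + d →
    c₁' ≡ f → c₂' ≡ d + (e + f) → c₃' ≡ e → X' ≡ y + d → Y' ≡ x → Z' ≡ y →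
    Transition c₁ c₂ c₃ X Y Z c₁' c₂' c₃' X' Y' Z'
  narrow : ∀ {c₁ c₂ c₃ X Y Z c₁' c₂' c₃' X' Y' Z'} (e f d z y : ℕ) →
    c₁ ≡ e → c₂ ≡ d + (e + f) → c₃ ≡ f → X ≡ z + d → Y ≡ y → Z ≡ z →
    c₁' ≡ d + f → c₂' ≡ e + f → c₃' ≡ e → X' ≡ y → Y' ≡ z → Z' ≡ y + d →
    Transition c₁ c₂ c₃ X Y Z c₁' c₂' c₃' X' Y' Z'

pattern wide! f e d x y = wide f e d x y refl refl refl refl refl refl refl refl refl refl refl refl
pattern narrow! e f d z y = narrow e f d z y refl refl refl refl refl refl refl refl refl refl refl refl

hit next out : ℕ → ℕ → ℕ → ℕ
hit i x c = hits (cls i x) c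
next i x c = nextCount (cls i x) c
out i x c = letter (cls i x) i x c

-- Prepending one letter. The strings alone do not tell whether the letter is a hit, so the φ-values
-- have to be part of the invariant. The constructor changes only when `d` is 0, where both describe
-- the same data.
transition-step : ∀ j x {c₁ c₂ c₃ X Y Z c₁' c₂' c₃' X' Y' Z'} → View j x →
  Transition c₁ c₂ c₃ X Y Z c₁' c₂' c₃' X' Y' Z' →
  let x₂ = out (suc j) x X ; x₃ = out j x₂ Y ; x₄ = out (suc j) x₃ Z
      y₂ = out j x X' ; y₃ = out (suc j) y₂ Y' ; y₄ = out j y₃ Z' in
  x₄ ≡ y₄ × Transition (hit (suc j) x X + c₁) (hit j x₂ Y + c₂) (hit (suc j) x₃ Z + c₃)
                       (next (suc j) x X) (next j x₂ Y) (next (suc j) x₃ Z)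
                       (hit j x X' + c₁') (hit (suc j) y₂ Y' + c₂') (hit j y₃ Z' + c₃')
                       (next j x X') (next (suc j) y₂ Y') (next j y₃ Z')
transition-step j x (other p q) t rewrite p | q | p | q = refl , t
transition-step j x first (wide! f e d a b)
  rewrite cls-below j | cls-lo j | cls-below j | cls-lo j =
  refl , wide! f e d a (suc b)
transition-step j x first (narrow! e f d a b)
  rewrite cls-below j | cls-lo j | cls-below j | cls-lo j =
  refl , narrow! e f d a (suc b)
transition-step j x second (wide! f e d a (suc b))
  rewrite cls-lo j | cls-hi j | cls-lo j | cls-hi j =
  refl , wide! f e d (suc a) b
transition-step j x second (wide! f e (suc d) a zero)
  rewrite cls-lo j | cls-hi j | cls-lo j | cls-below j | cls-hi j =
  refl , wide f (suc e) d (suc a) 0 (sym (+-suc d e)) refl refl refl refl (+-suc a d)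
              refl (sym (+-suc d (e + f))) refl refl refl refl
transition-step j x second (wide! f e zero a zero)
  rewrite cls-lo j | cls-hi j | cls-below j | cls-lo j =
  refl , narrow e f 1 a 0 refl refl refl (sym (+-comm a 1)) refl (+-identityʳ a)
              refl refl refl refl refl refl
transition-step j x second (narrow! e f d a (suc b))
  rewrite cls-lo j | cls-hi j | cls-lo j | cls-hi j =
  refl , narrow! e f d (suc a) b
transition-step j x second (narrow! e f d a zero)
  rewrite cls-lo j | cls-hi j | cls-below j | cls-lo j =
  refl , narrow e f (suc d) a 0 refl refl refl (sym (+-suc a d)) refl refl refl refl refl refl refl refl
transition-step j x third (wide! f e d (suc a) b)
  rewrite cls-hi j | cls-above j | cls-hi j | cls-above j =
  refl , wide! f e d a b
transition-step j x third (wide! f e d zero (suc b))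
  rewrite cls-hi j | cls-above j | cls-hi j | cls-hi j | cls-lo j =
  refl , wide f e (suc d) 0 b refl refl refl refl refl refl refl refl refl (sym (+-suc b d)) refl refl
transition-step j x third (wide! f e d zero zero)
  rewrite cls-hi j | cls-above j | cls-hi j | cls-hi j | cls-below j =
  refl , wide f (suc e) d 0 0 (sym (+-suc d e)) refl refl refl refl refl
              refl (sym (+-suc d (e + f))) refl refl refl refl
transition-step j x third (narrow! e f d (suc a) b)
  rewrite cls-hi j | cls-above j | cls-hi j | cls-above j =
  refl , narrow! e f d a b
transition-step j x third (narrow! e f (suc d) zero b)
  rewrite cls-hi j | cls-above j | cls-hi j | cls-hi j | +-suc b d =
  refl , narrow e (suc f) d 0 b refl (trans (sym (+-suc d (e + f))) (cong (d +_) (sym (+-suc e f)))) refl refl refl refl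
              (sym (+-suc d f)) (sym (+-suc e f)) refl refl refl refl
transition-step j x third (narrow! e f zero zero (suc b))
  rewrite cls-hi j | cls-above j | cls-hi j | cls-hi j | cls-lo j =
  refl , wide f e 1 0 b refl refl refl refl refl refl refl refl refl (sym (+-comm b 1)) refl (+-identityʳ b)
transition-step j x third (narrow! e f zero zero zero)
  rewrite cls-hi j | cls-above j | cls-hi j | cls-hi j | cls-below j =
  refl , narrow! (suc e) f 0 0 0

transition : ∀ j w →
  E₀ (suc j) (E₀ j (E₀ (suc j) w)) ≡ E₀ j (E₀ (suc j) (E₀ j w)) ×
  Transition (ε₀ (suc j) w) (ε₀ j (E₀ (suc j) w)) (ε₀ (suc j) (E₀ j (E₀ (suc j) w)))
             (φ₀ (suc j) w) (φ₀ j (E₀ (suc j) w)) (φ₀ (suc j) (E₀ j (E₀ (suc j) w)))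
             (ε₀ j w) (ε₀ (suc j) (E₀ j w)) (ε₀ j (E₀ (suc j) (E₀ j w)))
             (φ₀ j w) (φ₀ (suc j) (E₀ j w)) (φ₀ j (E₀ (suc j) (E₀ j w)))
transition j [] = refl , wide! 0 0 0 0 0
transition j (x ∷ w) with transition j w
... | p , t with transition-step j x (view j x) t
... | q , t' = cong₂ _∷_ q p , t'

-- Strings of two consecutive blocks

cls-≥ : ∀ i x → suc (suc i) ≤ x → cls i x ≡ neither
cls-≥ zero (suc (suc x)) _ = refl
cls-≥ zero (suc zero) (s≤s ())
cls-≥ (suc i) (suc x) (s≤s p) = cls-≥ i x p

cls-< : ∀ i x → x < i → cls i x ≡ neither
cls-< (suc i) zero _ = refl
cls-< (suc i) (suc x) (s≤s p) = cls-< i x p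

cls-letter-above : ∀ {i j} → 2 + i ≤ j → ∀ x c → cls i (letter (cls j x) j x c) ≡ cls i x
cls-letter-above {i} {j} p x c with cls j x in eq
... | lo = refl
... | neither = refl
cls-letter-above p x (suc c) | hi = refl
cls-letter-above {i} {j} p x zero | hi rewrite hi⇒≡ j x eq =
  trans (cls-≥ i j p) (sym (cls-≥ i (suc j) (m≤n⇒m≤1+n p)))

cls-letter-below : ∀ {i j} → 2 + i ≤ j → ∀ x c → cls j (letter (cls i x) i x c) ≡ cls j x
cls-letter-below {i} {j} p x c with cls i x in eq
... | lo = refl
... | neither = refl
cls-letter-below p x (suc c) | hi = refl
cls-letter-below {i} {j} p x zero | hi rewrite hi⇒≡ i x eq =
  trans (cls-< j i (<⇒≤ p)) (sym (cls-< j (suc i) p))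

φ-far-above : ∀ {i j} → 2 + i ≤ j → ∀ c d w → φ i c (E j d w) ≡ φ i c w
φ-far-above p c d [] = refl
φ-far-above {i} {j} p c d (x ∷ w)
  rewrite cls-letter-above {i} {j} p x (φ j d w) | φ-far-above {i} {j} p c d w = refl

φ-far-below : ∀ {i j} → 2 + i ≤ j → ∀ c d w → φ j c (E i d w) ≡ φ j c w
φ-far-below p c d [] = refl
φ-far-below {i} {j} p c d (x ∷ w)
  rewrite cls-letter-below {i} {j} p x (φ i d w) | φ-far-below {i} {j} p c d w = refl

ε-far-above : ∀ {i j} → 2 + i ≤ j → ∀ w → ε₀ i (E₀ j w) ≡ ε₀ i w
ε-far-above p [] = refl
ε-far-above {i} {j} p (x ∷ w)
  rewrite cls-letter-above {i} {j} p x (φ₀ j w) | φ-far-above {i} {j} p 0 0 w | ε-far-above {i} {j} p w = refl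

ε-far-below : ∀ {i j} → 2 + i ≤ j → ∀ w → ε₀ j (E₀ i w) ≡ ε₀ j w
ε-far-below p [] = refl
ε-far-below {i} {j} p (x ∷ w)
  rewrite cls-letter-below {i} {j} p x (φ₀ i w) | φ-far-below {i} {j} p 0 0 w | ε-far-below {i} {j} p w = refl

letter-comm : ∀ {i j} → 2 + i ≤ j → ∀ x c d →
  letter (cls i x) i (letter (cls j x) j x d) c ≡ letter (cls j x) j (letter (cls i x) i x c) d
letter-comm {i} {j} p x c d with cls i x in eq | cls j x in eq'
... | hi | lo with trans (sym (hi⇒≡ i x eq)) (lo⇒≡ j x eq')
...   | refl = ⊥-elim (1+n≰n p)
letter-comm {i} {j} p x c d | hi | hi with trans (sym (hi⇒≡ i x eq)) (hi⇒≡ j x eq')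
...   | refl = ⊥-elim (1+n≰n (<⇒≤ p))
letter-comm p x c d | lo | lo = refl
letter-comm p x c zero | lo | hi = refl
letter-comm p x c (suc d) | lo | hi = refl
letter-comm p x c d | lo | neither = refl
letter-comm p x zero d | hi | neither = refl
letter-comm p x (suc c) d | hi | neither = refl
letter-comm p x c d | neither | lo = refl
letter-comm p x c zero | neither | hi = refl
letter-comm p x c (suc d) | neither | hi = refl
letter-comm p x c d | neither | neither = refl

E-far : ∀ {i j} → 2 + i ≤ j → ∀ w → E₀ i (E₀ j w) ≡ E₀ j (E₀ i w)
E-far p [] = refl
E-far {i} {j} p (x ∷ w)
  rewrite cls-letter-above {i} {j} p x (φ₀ j w) | cls-letter-below {i} {j} p x (φ₀ i w)
        | φ-far-above {i} {j} p 0 0 w | φ-far-below {i} {j} p 0 0 w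
  = cong₂ _∷_ (letter-comm {i} {j} p x (φ₀ i w) (φ₀ j w)) (E-far {i} {j} p w)

φε-E : ∀ i c w → φ i c (E i c w) ≡ φ i c w + ε i c w × ε i c (E i c w) ≡ 0
φε-E i c [] = sym (+-identityʳ c) , refl
φε-E i c (x ∷ w) with φε-E i c w | cls i x in eq
... | p , q | lo rewrite eq = cong suc p , q
... | p , q | neither rewrite eq = p , q
... | p , q | hi with φ i c w
...   | zero rewrite cls-lo i = cong suc p , q
...   | suc f rewrite eq | p = refl , q

ε-E : ∀ i w → ε₀ i (E₀ i w) ≡ 0
ε-E i w = proj₂ (φε-E i 0 w)

ε≡0⇒E≡ : ∀ i c w → ε i c w ≡ 0 → E i c w ≡ w
ε≡0⇒E≡ i c [] _ = refl
ε≡0⇒E≡ i c (x ∷ w) p with cls i x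
... | lo = cong (x ∷_) (ε≡0⇒E≡ i c w p)
... | neither = cong (x ∷_) (ε≡0⇒E≡ i c w p)
... | hi with φ i c w
...   | suc _ = cong (x ∷_) (ε≡0⇒E≡ i c w p)

E-idem : ∀ i w → E₀ i (E₀ i w) ≡ E₀ i w
E-idem i w = ε≡0⇒E≡ i 0 (E₀ i w) (ε-E i w)

module _ (j : ℕ) (w : List ℕ) where
  private
    c₁ = ε₀ (suc j) w
    c₂ = ε₀ j (E₀ (suc j) w)
    c₃ = ε₀ (suc j) (E₀ j (E₀ (suc j) w))

  braid-E : E₀ (suc j) (E₀ j (E₀ (suc j) w)) ≡ E₀ j (E₀ (suc j) (E₀ j w))
  braid-E = proj₁ (transition j w)

  rank2-⊔ : ε₀ j w ≡ c₃ ⊔ (c₂ ∸ c₁)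
  rank2-⊔ with proj₂ (transition j w)
  ... | wide f e d x y p₁ p₂ p₃ _ _ _ q₁ _ _ _ _ _ rewrite p₁ | p₂ | p₃ | q₁ =
    sym (m≥n⇒m⊔n≡m (≤-trans (∸-monoʳ-≤ (e + f) (m≤n+m e d)) (≤-reflexive (m+n∸m≡n e f))))
  ... | narrow e f d z y p₁ p₂ p₃ _ _ _ q₁ _ _ _ _ _ rewrite p₁ | p₂ | p₃ | q₁ =
    sym (trans (cong (f ⊔_) eq) (m≤n⇒m⊔n≡n (m≤n+m f d)))
    where
    eq : d + (e + f) ∸ e ≡ d + f
    eq = trans (cong (_∸ e) (trans (sym (+-assoc d e f)) (trans (cong (_+ f) (+-comm d e)) (+-assoc e d f)))) (m+n∸m≡n e (d + f))

  rank2-+ : ε₀ (suc j) (E₀ j w) ≡ c₁ + c₃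
  rank2-+ with proj₂ (transition j w)
  ... | wide f e d x y p₁ p₂ p₃ _ _ _ _ q₂ _ _ _ _ rewrite p₁ | p₃ | q₂ = sym (+-assoc d e f)
  ... | narrow e f d z y p₁ p₂ p₃ _ _ _ _ q₂ _ _ _ _ rewrite p₁ | p₃ | q₂ = refl

  rank2-⊓ : ε₀ j (E₀ (suc j) (E₀ j w)) ≡ c₁ ⊓ (c₂ ∸ c₃)
  rank2-⊓ with proj₂ (transition j w)
  ... | wide f e d x y p₁ p₂ p₃ _ _ _ _ _ q₃ _ _ _ rewrite p₁ | p₂ | p₃ | q₃ | m+n∸n≡m e f =
    sym (m≥n⇒m⊓n≡n (m≤n+m e d))
  ... | narrow e f d z y p₁ p₂ p₃ _ _ _ _ _ q₃ _ _ _ rewrite p₁ | p₂ | p₃ | q₃ | sym (+-assoc d e f) | m+n∸n≡m (d + e) f =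
    sym (m≤n⇒m⊓n≡m (m≤n+m e d))

strings : ℕ → ℕ → List ℕ → List ℕ
strings i zero w = []
strings i (suc k) w = ε₀ i w ∷ strings (suc i) k (E₀ i w)

raise : ℕ → ℕ → List ℕ → List ℕ
raise i zero w = w
raise i (suc k) w = raise (suc i) k (E₀ i w)

raise-far : ∀ {i j} → 2 + i ≤ j → ∀ k w → raise j k (E₀ i w) ≡ E₀ i (raise j k w)
raise-far p zero w = refl
raise-far {i} {j} p (suc k) w =
  trans (cong (raise (suc j) k) (sym (E-far {i} {j} p w))) (raise-far (m≤n⇒m≤1+n p) k (E₀ j w))

strings-far : ∀ {i j} → 2 + i ≤ j → ∀ k w → strings j k (E₀ i w) ≡ strings j k w
strings-far p zero w = refl
strings-far {i} {j} p (suc k) w = cong₂ _∷_ (ε-far-below p w)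
  (trans (cong (strings (suc j) k) (sym (E-far {i} {j} p w))) (strings-far (m≤n⇒m≤1+n p) k (E₀ j w)))

ε-raise-far : ∀ {i j} → 2 + i ≤ j → ∀ k w → ε₀ i (raise j k w) ≡ ε₀ i w
ε-raise-far p zero w = refl
ε-raise-far {i} {j} p (suc k) w = trans (ε-raise-far (m≤n⇒m≤1+n p) k (E₀ j w)) (ε-far-above p w)

head₀ : List ℕ → ℕ
head₀ [] = 0
head₀ (a ∷ _) = a

tail₀ : List ℕ → List ℕ
tail₀ [] = []
tail₀ (_ ∷ as) = as

-- For the strings as and bs of two consecutive blocks, depth is ε_i, and lowerA, lowerB are the
-- strings after applying e_i as often as possible (i being the first letter of the second block).
depth : List ℕ → List ℕ → ℕ
depth as [] = 0
depth as (b ∷ bs) = depth (tail₀ as) bs ⊔ (b ∸ head₀ as)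

lowerA : List ℕ → List ℕ → List ℕ
lowerA [] _ = []
lowerA (a ∷ as) bs = (a + depth as (tail₀ bs)) ∷ lowerA as (tail₀ bs)

lowerB : List ℕ → List ℕ → List ℕ
lowerB as [] = []
lowerB as (b ∷ bs) = (head₀ as ⊓ (b ∸ depth (tail₀ as) bs)) ∷ lowerB (tail₀ as) bs

-- The letter i that opens the second block commutes with everything in the first block except i+1.
-- It can therefore be applied right after i+1, which leaves two blocks of the same kind one letter
-- higher.
two-blocks : ∀ k i w →
  strings i (2 + k) (raise (suc i) (suc k) w) ≡
    ε₀ i (E₀ (suc i) w) ∷ strings (suc i) (suc k) (raise (2 + i) k (E₀ i (E₀ (suc i) w))) ×
  raise i (2 + k) (raise (suc i) (suc k) w) ≡ raise (suc i) (suc k) (raise (2 + i) k (E₀ i (E₀ (suc i) w)))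
two-blocks k i w =
  cong₂ _∷_ (ε-raise-far ≤-refl k (E₀ (suc i) w))
    (cong (strings (suc i) (suc k)) (sym (raise-far ≤-refl k (E₀ (suc i) w)))) ,
  cong (raise (suc i) (suc k)) (sym (raise-far ≤-refl k (E₀ (suc i) w)))

record LowersBlocks (k i : ℕ) (w : List ℕ) : Set where
  field
    strings-A : strings (suc i) k (E₀ i w) ≡
                lowerA (strings (suc i) k w) (strings i (suc k) (raise (suc i) k w))
    strings-B : strings i (suc k) (raise (suc i) k (E₀ i w)) ≡
                lowerB (strings (suc i) k w) (strings i (suc k) (raise (suc i) k w))
    ε-depth   : ε₀ i w ≡ depth (strings (suc i) k w) (strings i (suc k) (raise (suc i) k w))
    raise-E   : raise i (suc k) (raise (suc i) k (E₀ i w)) ≡ raise i (suc k) (raise (suc i) k w)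

open LowersBlocks

-- The opening letters i+1 and i of the two blocks are peeled off. By `braid-E`, applying i, i+1, i
-- amounts to applying i+1, i, i+1, so the extra operator reappears as i+1 in front of the remaining
-- blocks, and the induction hypothesis applies to `y`. The three rank two formulas give the strings
-- of the peeled letters.
lowers-blocks : ∀ k i w → LowersBlocks k i w
lowers-blocks zero i w = record
  { strings-A = refl
  ; strings-B = cong (_∷ []) (ε-E i w)
  ; ε-depth = refl
  ; raise-E = E-idem i w }
lowers-blocks (suc k) i w = record
  { strings-A = cong₂ _∷_
      (trans (rank2-+ i w) (cong (ε₀ (suc i) w +_) (trans (ε-depth IH) (cong₂ depth (sym asEq) (sym (cong tail₀ bsEq))))))
      (trans (sym (strings-far ≤-refl k (E₀ (suc i) (E₀ i w))))
        (trans (cong (strings (2 + i) k) (sym (braid-E i w)))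
          (trans (strings-A IH) (cong₂ lowerA (sym asEq) (sym (cong tail₀ bsEq))))))
  ; strings-B = trans (proj₁ (two-blocks k i (E₀ i w))) (trans
      (cong₂ _∷_
        (trans (rank2-⊓ i w) (cong (λ z → ε₀ (suc i) w ⊓ (ε₀ i (E₀ (suc i) w) ∸ z))
          (trans (ε-depth IH) (cong (λ as → depth as bs') (sym asEq)))))
        (trans (cong (λ u → strings (suc i) (suc k) (raise (2 + i) k u)) (sym (braid-E i w)))
          (trans (strings-B IH) (cong (λ as → lowerB as bs') (sym asEq)))))
      (cong (lowerB (strings (suc i) (suc k) w)) (sym bsEq)))
  ; ε-depth = trans (rank2-⊔ i w) (trans
      (cong (_⊔ (ε₀ i (E₀ (suc i) w) ∸ ε₀ (suc i) w)) (trans (ε-depth IH) (cong (λ as → depth as bs') (sym asEq))))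
      (cong (depth (strings (suc i) (suc k) w)) (sym bsEq)))
  ; raise-E = trans (proj₂ (two-blocks k i (E₀ i w))) (trans
      (cong (λ u → raise (suc i) (suc k) (raise (2 + i) k u)) (sym (braid-E i w)))
      (trans (raise-E IH) (sym (proj₂ (two-blocks k i w))))) }
  where
  y = E₀ i (E₀ (suc i) w)
  IH = lowers-blocks k (suc i) y
  bs' = strings (suc i) (suc k) (raise (2 + i) k y)
  asEq : strings (2 + i) k (E₀ (suc i) w) ≡ strings (2 + i) k y
  asEq = sym (strings-far ≤-refl k (E₀ (suc i) w))
  bsEq : strings i (2 + k) (raise (suc i) (suc k) w) ≡ ε₀ i (E₀ (suc i) w) ∷ bs'
  bsEq = proj₁ (two-blocks k i w)

Highest : ℕ → ℕ → List ℕ → Set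
Highest lower upper w = ∀ j → lower ≤ j → j < upper → ε₀ j w ≡ 0

highest-E : ∀ {i u w} → Highest (suc i) u w → Highest (2 + i) u (E₀ i w)
highest-E {i} {u} {w} H j p q = trans (ε-far-below p w) (H j (<⇒≤ p) q)

-- For the letter i, `rank2-⊓` bounds the final string by ε of i+1 on `w`, which is 0; the letters
-- of the block from i+2 on do not touch it. Higher letters are left to the induction, which needs
-- `E₀ i w` to be highest only from i+2 on.
raise-highest : ∀ k i w → Highest (suc i) (suc i + k) w → Highest i (suc i + k) (raise i (suc k) w)
raise-highest zero i w H j p q with ≤-antisym p (≤-pred (≤-trans q (≤-reflexive (cong suc (+-identityʳ i)))))
... | refl = ε-E i w
raise-highest (suc k) i w H j p q with m≤n⇒m<n∨m≡n p
... | inj₁ i<j = raise-highest k (suc i) (E₀ i w)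
        (subst (λ u → Highest (2 + i) u (E₀ i w)) (+-suc (suc i) k) (highest-E {w = w} H))
        j i<j (≤-trans q (≤-reflexive (+-suc (suc i) k)))
... | inj₂ refl = trans (ε-raise-far ≤-refl k (E₀ (suc i) (E₀ i w)))
        (trans (rank2-⊓ i w) (cong (_⊓ (ε₀ i (E₀ (suc i) w) ∸ ε₀ (suc i) (E₀ i (E₀ (suc i) w)))) (H (suc i) ≤-refl (s≤s (m<m+n i z<s)))))

Decreasing : List ℕ → Set
Decreasing [] = ⊤
Decreasing (a ∷ as) = head₀ as ≤ a × Decreasing as

-- With c₁ = 0 the transition map reads c₁' = max(c₃, c₂) and c₂' = c₃, so the second string cannot
-- exceed the first.
strings-decreasing : ∀ k i w → Highest (suc i) (i + k) w → Decreasing (strings i k w)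
strings-decreasing zero i w H = tt
strings-decreasing (suc zero) i w H = z≤n , tt
strings-decreasing (suc (suc k)) i w H =
  ≤-trans (≤-reflexive (trans (rank2-+ i w) (cong (_+ ε₀ (suc i) (E₀ i (E₀ (suc i) w))) (H (suc i) ≤-refl (≤-trans (s≤s (s≤s (m≤m+n i k))) (≤-reflexive (sym (trans (+-suc i (suc k)) (cong suc (+-suc i k)))))))))) (≤-trans (m≤m⊔n _ _) (≤-reflexive (sym (rank2-⊔ i w)))) ,
  strings-decreasing (suc k) (suc i) (E₀ i w)
    (subst (λ u → Highest (2 + i) u (E₀ i w)) (+-suc i (suc k)) (highest-E {w = w} H))

-- The 0-Hecke action on sequences

select : Cls → ℕ → ℕ → ℕ → ℕ
select lo a b c = a ⊔ b
select hi a b c = a ⊓ b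
select neither a b c = c

-- The 0-Hecke generator s_{q+1}.  A permutation u is represented by the sequence of values of u⁻¹, on which
-- s_{q+1} * _ acts by sorting the entries q and q+1 decreasingly.
srt : ℕ → (ℕ → ℕ) → ℕ → ℕ
srt q g k = select (cls q k) (g q) (g (suc q)) (g k)

srt-lo : ∀ q g → srt q g q ≡ g q ⊔ g (suc q)
srt-lo q g rewrite cls-lo q = refl

srt-hi : ∀ q g → srt q g (suc q) ≡ g q ⊓ g (suc q)
srt-hi q g rewrite cls-hi q = refl

srt-neither : ∀ q g k → cls q k ≡ neither → srt q g k ≡ g k
srt-neither q g k p rewrite p = refl

srt-cong : ∀ q {g g'} → g ≗ g' → srt q g ≗ srt q g'
srt-cong q e k rewrite e q | e (suc q) | e k = refl

srt-idem : ∀ q g → srt q (srt q g) ≗ srt q g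
srt-idem q g k with cls q k in eq
... | neither = refl
... | lo rewrite cls-lo q | cls-hi q = m≥n⇒m⊔n≡m (≤-trans (m⊓n≤m (g q) (g (suc q))) (m≤m⊔n (g q) (g (suc q))))
... | hi rewrite cls-lo q | cls-hi q = m≥n⇒m⊓n≡n (≤-trans (m⊓n≤m (g q) (g (suc q))) (m≤m⊔n (g q) (g (suc q))))

srt-comm : ∀ {q q'} → 2 + q ≤ q' → ∀ g → srt q (srt q' g) ≗ srt q' (srt q g)
srt-comm {q} {q'} p g k with cls q k in eq | cls q' k in eq'
... | neither | neither = refl
... | neither | lo rewrite lo⇒≡ q' k eq' | cls-≥ q q' p | cls-≥ q (suc q') (m≤n⇒m≤1+n p) = refl
... | neither | hi rewrite hi⇒≡ q' k eq' | cls-≥ q q' p | cls-≥ q (suc q') (m≤n⇒m≤1+n p) = refl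
... | lo | neither rewrite lo⇒≡ q k eq | cls-< q' q (<⇒≤ p) | cls-< q' (suc q) p = refl
... | hi | neither rewrite hi⇒≡ q k eq | cls-< q' q (<⇒≤ p) | cls-< q' (suc q) p = refl
... | lo | lo with trans (sym eq') (cls-< q' k (≤-trans (s≤s (≤-reflexive (lo⇒≡ q k eq))) (<⇒≤ p)))
...   | ()
srt-comm {q} {q'} p g k | lo | hi with trans (sym eq') (cls-< q' k (≤-trans (s≤s (≤-reflexive (lo⇒≡ q k eq))) (<⇒≤ p)))
...   | ()
srt-comm {q} {q'} p g k | hi | lo with trans (sym eq') (cls-< q' k (≤-trans (s≤s (≤-reflexive (hi⇒≡ q k eq))) p))
...   | ()
srt-comm {q} {q'} p g k | hi | hi with trans (sym eq') (cls-< q' k (≤-trans (s≤s (≤-reflexive (hi⇒≡ q k eq))) p))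
...   | ()

private
  top-braid : ∀ a b c → (a ⊔ b) ⊔ ((a ⊓ b) ⊔ c) ≡ a ⊔ (b ⊔ c)
  top-braid a b c = trans (sym (⊔-assoc (a ⊔ b) (a ⊓ b) c))
    (trans (cong (_⊔ c) (m≥n⇒m⊔n≡m (≤-trans (m⊓n≤m a b) (m≤m⊔n a b)))) (⊔-assoc a b c))

  bottom-braid : ∀ a b c → (a ⊓ b) ⊓ c ≡ (a ⊓ (b ⊔ c)) ⊓ (b ⊓ c)
  bottom-braid a b c = sym (trans (⊓-assoc a (b ⊔ c) (b ⊓ c))
    (trans (cong (a ⊓_) (m≥n⇒m⊓n≡n (≤-trans (m⊓n≤m b c) (m≤m⊔n b c)))) (sym (⊓-assoc a b c))))

  middle-braid : ∀ a b c → (a ⊔ b) ⊓ ((a ⊓ b) ⊔ c) ≡ (a ⊓ (b ⊔ c)) ⊔ (b ⊓ c)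
  middle-braid a b c = begin
    (a ⊔ b) ⊓ ((a ⊓ b) ⊔ c)               ≡⟨ ⊓-distribˡ-⊔ (a ⊔ b) (a ⊓ b) c ⟩
    ((a ⊔ b) ⊓ (a ⊓ b)) ⊔ ((a ⊔ b) ⊓ c)   ≡⟨ cong₂ _⊔_ (m≥n⇒m⊓n≡n (≤-trans (m⊓n≤m a b) (m≤m⊔n a b))) (⊓-distribʳ-⊔ c a b) ⟩
    (a ⊓ b) ⊔ ((a ⊓ c) ⊔ (b ⊓ c))         ≡⟨ ⊔-assoc (a ⊓ b) (a ⊓ c) (b ⊓ c) ⟨
    ((a ⊓ b) ⊔ (a ⊓ c)) ⊔ (b ⊓ c)         ≡⟨ cong (_⊔ (b ⊓ c)) (⊓-distribˡ-⊔ a b c) ⟨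
    (a ⊓ (b ⊔ c)) ⊔ (b ⊓ c)               ∎
    where open ≡-Reasoning

srt-braid : ∀ q g → srt q (srt (suc q) (srt q g)) ≗ srt (suc q) (srt q (srt (suc q) g))
srt-braid q g k with view q k
... | other e e' rewrite e | e' = refl
... | first rewrite cls-lo q | cls-hi q | cls-above q | cls-below q =
  top-braid (g q) (g (suc q)) (g (2 + q))
... | second rewrite cls-hi q | cls-lo q | cls-above q | cls-below q =
  middle-braid (g q) (g (suc q)) (g (2 + q))
... | third rewrite cls-hi q | cls-lo q | cls-above q | cls-below q =
  bottom-braid (g q) (g (suc q)) (g (2 + q))

srtIf : Bool → ℕ → (ℕ → ℕ) → ℕ → ℕ
srtIf b q g = if b then srt q g else g

srtIf-cong : ∀ b q {g g'} → g ≗ g' → srtIf b q g ≗ srtIf b q g'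
srtIf-cong true q e = srt-cong q e
srtIf-cong false q e = e

srtIf-comm : ∀ b c {q q'} → 2 + q ≤ q' → ∀ g → srtIf b q (srtIf c q' g) ≗ srtIf c q' (srtIf b q g)
srtIf-comm true true p g = srt-comm p g
srtIf-comm true false p g k = refl
srtIf-comm false true p g k = refl
srtIf-comm false false p g k = refl

-- Since `head₀ []` is 0, one test covers both ways of being circled. Circled indices are listed
-- downwards and multiply from the left, so the first string of the block acts first.
block : ℕ → List ℕ → (ℕ → ℕ) → ℕ → ℕ
block q [] g = g
block q (b ∷ bs) g = block (suc q) bs (srtIf (b ≡ᵇ head₀ bs) q g)

block-cong : ∀ q bs {g g'} → g ≗ g' → block q bs g ≗ block q bs g'
block-cong q [] e = e
block-cong q (b ∷ bs) e = block-cong (suc q) bs (srtIf-cong (b ≡ᵇ head₀ bs) q e)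

block-comm : ∀ b {q q'} → 2 + q ≤ q' → ∀ bs g → srtIf b q (block q' bs g) ≗ block q' bs (srtIf b q g)
block-comm b p [] g k = refl
block-comm b {q} {q'} p (c ∷ bs) g k = trans
  (block-comm b (m≤n⇒m≤1+n p) bs (srtIf (c ≡ᵇ head₀ bs) q' g) k)
  (block-cong (suc q') bs (srtIf-comm b (c ≡ᵇ head₀ bs) p g) k)

block-comm-below : ∀ q bs g {p} → 1 + q + length bs ≤ p → srt p (block q bs g) ≗ block q bs (srt p g)
block-comm-below q [] g l k = refl
block-comm-below q (b ∷ bs) g {p} l k = trans
  (block-comm-below (suc q) bs (srtIf (b ≡ᵇ head₀ bs) q g) l' k)
  (block-cong (suc q) bs (λ k' → sym (srtIf-comm (b ≡ᵇ head₀ bs) true {q} {p} (≤-trans (s≤s (s≤s (m≤m+n q (length bs)))) l') g k')) k)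
  where
  l' : 2 + q + length bs ≤ p
  l' = ≤-trans (≤-reflexive (cong suc (sym (+-suc q (length bs))))) l

≡ᵇ-yes : ∀ {a b} → a ≡ b → (a ≡ᵇ b) ≡ true
≡ᵇ-yes {a} {b} e = Equivalence.to T-≡ (≡⇒≡ᵇ a b e)

≡ᵇ-no : ∀ {a b} → a ≢ b → (a ≡ᵇ b) ≡ false
≡ᵇ-no {a} {b} ne with a ≡ᵇ b in eq
... | false = refl
... | true = contradiction (≡ᵇ⇒≡ a b (Equivalence.from T-≡ eq)) ne

≡ᵇ-true⇒≡ : ∀ {a b} → (a ≡ᵇ b) ≡ true → a ≡ b
≡ᵇ-true⇒≡ {a} {b} eq = ≡ᵇ⇒≡ a b (Equivalence.from T-≡ eq)

≤ᵇ-yes : ∀ {a b} → a ≤ b → (a ≤ᵇ b) ≡ true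
≤ᵇ-yes p = Equivalence.to T-≡ (≤⇒≤ᵇ p)

≤ᵇ-no : ∀ {a b} → ¬ a ≤ b → (a ≤ᵇ b) ≡ false
≤ᵇ-no {a} {b} ne with a ≤ᵇ b in eq
... | false = refl
... | true = contradiction (≤ᵇ⇒≤ a b (Equivalence.from T-≡ eq)) ne

-- The correction of the invariant: while the pair of blocks is processed, srtIf (pending …) turns the
-- sequence obtained from (as,bs) into the one obtained from the lowered strings.
pending : List ℕ → List ℕ → Bool
pending (a ∷ as) (b ∷ bs) = (a ≡ᵇ head₀ as) ∧ (head₀ as + depth (tail₀ as) bs ≤ᵇ b)
pending _ _ = true

depth≤head : ∀ as bs → Decreasing bs → depth as bs ≤ head₀ bs
depth≤head as [] _ = z≤n
depth≤head as (b ∷ bs) (p , d) = ⊔-lub (≤-trans (depth≤head (tail₀ as) bs d) p) (m∸n≤m b (head₀ as))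

-- A circle in the lowered second block is either inherited or created, and it is created exactly
-- where the correction of the following place is pending. This is how the correction becomes part
-- of the new word.
circled-B : ∀ as b bs → length as ≡ length bs → Decreasing as → Decreasing (b ∷ bs) →
  (head₀ (lowerB as (b ∷ bs)) ≡ᵇ head₀ (lowerB (tail₀ as) bs)) ≡ (if pending as bs then true else b ≡ᵇ head₀ bs)
circled-B [] b [] _ _ _ = refl
circled-B (a ∷ as) b (b₂ ∷ bs) _ (a₂≤a , _) (b₂≤b , dec) = go (a ≟ a₂) (a₂ + z₃ ≤? b₂)
  where
  a₂ = head₀ as
  z₃ = depth (tail₀ as) bs
  z = z₃ ⊔ (b₂ ∸ a₂)
  z₃≤b₂ : z₃ ≤ b₂
  z₃≤b₂ = ≤-trans (depth≤head (tail₀ as) bs (proj₂ dec)) (proj₁ dec)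
  goal = λ t → (a ⊓ (b ∸ z) ≡ᵇ a₂ ⊓ (b₂ ∸ z₃)) ≡ (if t then true else b ≡ᵇ b₂)
  right-min : a₂ + z₃ ≤ b₂ → a₂ ⊓ (b₂ ∸ z₃) ≡ a₂
  right-min p = m≤n⇒m⊓n≡m (≤-trans (≤-reflexive (sym (m+n∸n≡m a₂ z₃))) (∸-monoˡ-≤ z₃ p))
  z-eq : a₂ + z₃ ≤ b₂ → z ≡ b₂ ∸ a₂
  z-eq p = m≤n⇒m⊔n≡n (≤-trans (≤-reflexive (sym (m+n∸m≡n a₂ z₃))) (∸-monoˡ-≤ a₂ p))
  b₂∸z : a₂ + z₃ ≤ b₂ → b₂ ∸ (b₂ ∸ a₂) ≡ a₂
  b₂∸z p = m∸[m∸n]≡n (≤-trans (m≤m+n a₂ z₃) p)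
  -- When nothing is pending, the right minimum is `b₂ ∸ z` and `a` lies strictly above it. The left
  -- minimum then exceeds it as soon as `b` exceeds `b₂`.
  not-pending : a₂ ⊓ (b₂ ∸ z₃) ≡ b₂ ∸ z → b₂ ∸ z < a → z ≤ b₂ → (a ⊓ (b ∸ z) ≡ᵇ a₂ ⊓ (b₂ ∸ z₃)) ≡ (b ≡ᵇ b₂)
  not-pending e lt z≤b₂ with b ≟ b₂
  ... | yes refl = trans (≡ᵇ-yes (trans (m≥n⇒m⊓n≡n (<⇒≤ lt)) (sym e))) (sym (≡ᵇ-yes {b} refl))
  ... | no b≢b₂ = trans (≡ᵇ-no (λ q → <-irrefl (sym (trans q e)) (⊓-glb lt (∸-monoˡ-< (≤∧≢⇒< b₂≤b (b≢b₂ ∘ sym)) z≤b₂)))) (sym (≡ᵇ-no b≢b₂))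
  go : Dec (a ≡ a₂) → Dec (a₂ + z₃ ≤ b₂) → goal ((a ≡ᵇ a₂) ∧ (a₂ + z₃ ≤ᵇ b₂))
  go (yes e) (yes p) rewrite ≡ᵇ-yes e | ≤ᵇ-yes p | right-min p | z-eq p =
    ≡ᵇ-yes (trans (m≤n⇒m⊓n≡m (≤-trans (≤-reflexive (trans e (sym (b₂∸z p)))) (∸-monoˡ-≤ (b₂ ∸ a₂) b₂≤b))) e)
  go (no ne) (yes p) rewrite ≡ᵇ-no ne =
    not-pending (trans (right-min p) (sym (trans (cong (b₂ ∸_) (z-eq p)) (b₂∸z p))))
                (≤-trans (s≤s (≤-reflexive (trans (cong (b₂ ∸_) (z-eq p)) (b₂∸z p)))) (≤∧≢⇒< a₂≤a (ne ∘ sym)))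
                (≤-trans (≤-reflexive (z-eq p)) (m∸n≤m b₂ a₂))
  go d (no np) = subst goal (sym false-eq)
    (not-pending (trans (m≥n⇒m⊓n≡n (<⇒≤ small)) (cong (b₂ ∸_) (sym z≡z₃)))
                 (≤-trans (s≤s (≤-reflexive (cong (b₂ ∸_) z≡z₃))) (≤-trans small a₂≤a))
                 (≤-trans (≤-reflexive z≡z₃) z₃≤b₂))
    where
    b₂<sum : b₂ < a₂ + z₃
    b₂<sum = ≰⇒> np
    z≡z₃ : z ≡ z₃
    z≡z₃ = m≥n⇒m⊔n≡m (≤-trans (∸-monoˡ-≤ a₂ (<⇒≤ b₂<sum)) (≤-reflexive (m+n∸m≡n a₂ z₃)))
    small : b₂ ∸ z₃ < a₂
    small = ≤-trans (∸-monoˡ-< b₂<sum z₃≤b₂) (≤-reflexive (m+n∸n≡m a₂ z₃))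
    false-eq : ((a ≡ᵇ a₂) ∧ (a₂ + z₃ ≤ᵇ b₂)) ≡ false
    false-eq rewrite ≤ᵇ-no np with a ≡ᵇ a₂
    ... | true = refl
    ... | false = refl

-- Both summands on the left dominate those on the right, so equality of the sums forces equality of
-- each.
circled-A : ∀ a a₂ b z → a₂ ≤ a → (a + (z ⊔ (b ∸ a₂)) ≡ᵇ a₂ + z) ≡ ((a ≡ᵇ a₂) ∧ (b ≤ᵇ a₂ + z))
circled-A a a₂ b z le with a ≟ a₂
... | no ne rewrite ≡ᵇ-no ne =
  ≡ᵇ-no (λ e → <-irrefl (sym e) (+-mono-<-≤ (≤∧≢⇒< le (ne ∘ sym)) (m≤m⊔n z (b ∸ a₂))))
... | yes refl rewrite ≡ᵇ-yes {a} refl with b ≤? a + z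
...   | yes p rewrite ≤ᵇ-yes p = ≡ᵇ-yes (cong (a +_) (m≥n⇒m⊔n≡m (≤-trans (∸-monoˡ-≤ a p) (≤-reflexive (m+n∸m≡n a z)))))
...   | no np rewrite ≤ᵇ-no np = ≡ᵇ-no (λ e → np (≤-trans (m≤n+m∸n b a)
          (+-monoʳ-≤ a (≤-trans (m≤n⊔m z (b ∸ a)) (≤-reflexive (+-cancelˡ-≡ a _ _ e))))))

-- A finite check in the 0-Hecke algebra: `t₂` and `x ∧ β` are the corrections on the two sides of
-- the step, `x` and `y` the old circles, `α` and `β` the comparisons that decide the new ones. The
-- braid relation enters only when `t₂`, `x` and `y` all hold; idempotence settles the rest.
srtIf-hecke : ∀ q (t₂ x y α β : Bool) → (α ≡ false → β ≡ true) →
  (x ≡ true → t₂ ≡ true → y ≡ true → α ≡ true × β ≡ true) →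
  (x ≡ true → t₂ ≡ true → y ≡ false → α ≡ false × β ≡ true) →
  (x ≡ true → t₂ ≡ false → y ≡ true → α ≡ true × β ≡ false) → ∀ g →
  srtIf t₂ (suc q) (srtIf x q (srtIf y (suc q) g)) ≗
  srtIf (x ∧ α) q (srtIf (if t₂ then true else y) (suc q) (srtIf (x ∧ β) q g))
srtIf-hecke q false false y α β _ _ _ _ g k = refl
srtIf-hecke q true false false α β _ _ _ _ g k = refl
srtIf-hecke q true false true α β _ _ _ _ g k = srt-idem (suc q) g k
srtIf-hecke q true true true α β _ f _ _ g k with f refl refl refl
... | refl , refl = sym (srt-braid q g k)
srtIf-hecke q true true false α β _ _ f _ g k with f refl refl refl
... | refl , refl = refl
srtIf-hecke q false true true α β _ _ _ f g k with f refl refl refl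
... | refl , refl = refl
srtIf-hecke q false true false true true _ _ _ _ g k = sym (srt-idem q g k)
srtIf-hecke q false true false true false _ _ _ _ g k = refl
srtIf-hecke q false true false false true _ _ _ _ g k = refl
srtIf-hecke q false true false false false f _ _ _ g k with f refl
... | ()

-- These are the hypotheses of `srtIf-hecke`. If the correction is pending, `head₀ as + z` equals
-- the next string of the second block, so comparing it with `b` tests the circle of `b`; otherwise
-- it is strictly larger than that next string.
pending-step : ∀ as b bs → length as ≡ length bs → Decreasing as → Decreasing (b ∷ bs) →
  let z = depth (tail₀ as) bs ; y = b ≡ᵇ head₀ bs ; t₂ = pending as bs
      α = b ≤ᵇ head₀ as + z ; β = head₀ as + z ≤ᵇ b in
  (t₂ ≡ true → y ≡ true → α ≡ true × β ≡ true) ×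
  (t₂ ≡ true → y ≡ false → α ≡ false × β ≡ true) ×
  (t₂ ≡ false → y ≡ true → α ≡ true × β ≡ false)
pending-step [] b [] _ _ _ =
  (λ _ e → ≤ᵇ-yes (≤-reflexive (≡ᵇ-true⇒≡ {b} e)) , refl) ,
  (λ _ e → ≤ᵇ-no {b} {0} (λ p → true≢false (≡ᵇ-yes (n≤0⇒n≡0 p)) e) , refl) ,
  (λ ())
pending-step (a ∷ as) b (b₂ ∷ bs) _ (a₂≤a , _) (b₂≤b , dec) = go (a ≟ a₂) (a₂ + z₃ ≤? b₂)
  where
  a₂ = head₀ as
  z₃ = depth (tail₀ as) bs
  z = z₃ ⊔ (b₂ ∸ a₂)
  t₂ = (a ≡ᵇ a₂) ∧ (a₂ + z₃ ≤ᵇ b₂)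
  Goal = (t₂ ≡ true → (b ≡ᵇ b₂) ≡ true → (b ≤ᵇ a + z) ≡ true × (a + z ≤ᵇ b) ≡ true) ×
         (t₂ ≡ true → (b ≡ᵇ b₂) ≡ false → (b ≤ᵇ a + z) ≡ false × (a + z ≤ᵇ b) ≡ true) ×
         (t₂ ≡ false → (b ≡ᵇ b₂) ≡ true → (b ≤ᵇ a + z) ≡ true × (a + z ≤ᵇ b) ≡ false)
  above : t₂ ≡ false → (b₂ < a + z) → Goal
  above e lt = (λ e' → true≢false e' e) , (λ e' → true≢false e' e) ,
    λ _ e' → let b≡b₂ = ≡ᵇ-true⇒≡ {b} e' in
      ≤ᵇ-yes (≤-trans (≤-reflexive b≡b₂) (<⇒≤ lt)) ,
      ≤ᵇ-no (λ p → <-irrefl refl (≤-trans lt (≤-trans p (≤-reflexive b≡b₂))))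
  go : Dec (a ≡ a₂) → Dec (a₂ + z₃ ≤ b₂) → Goal
  go (yes refl) (yes p) =
    (λ _ e → let b≡b₂ = ≡ᵇ-true⇒≡ {b} e in
      ≤ᵇ-yes (≤-reflexive (trans b≡b₂ (sym sum-eq))) , ≤ᵇ-yes (≤-reflexive (trans sum-eq (sym b≡b₂)))) ,
    (λ _ e → ≤ᵇ-no (λ q → true≢false (≡ᵇ-yes {b} (≤-antisym (≤-trans q (≤-reflexive sum-eq)) b₂≤b)) e) ,
             ≤ᵇ-yes (≤-trans (≤-reflexive sum-eq) b₂≤b)) ,
    (λ e → true≢false (cong₂ _∧_ (≡ᵇ-yes {a} refl) (≤ᵇ-yes p)) e)
    where
    sum-eq : a + z ≡ b₂
    sum-eq = trans (cong (a +_) (m≤n⇒m⊔n≡n (≤-trans (≤-reflexive (sym (m+n∸m≡n a z₃))) (∸-monoˡ-≤ a p))))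
                   (m+[n∸m]≡n (≤-trans (m≤m+n a z₃) p))
  go (no ne) (yes p) = above (cong (_∧ (a₂ + z₃ ≤ᵇ b₂)) (≡ᵇ-no ne))
    (≤-trans (s≤s (m≤n+m∸n b₂ a₂)) (+-mono-<-≤ (≤∧≢⇒< a₂≤a (ne ∘ sym)) (m≤n⊔m z₃ (b₂ ∸ a₂))))
  go _ (no np) = above eq (≤-trans (≰⇒> np) (+-mono-≤ a₂≤a (m≤m⊔n z₃ (b₂ ∸ a₂))))
    where
    eq : t₂ ≡ false
    eq rewrite ≤ᵇ-no np with a ≡ᵇ a₂
    ... | true = refl
    ... | false = refl

≤ᵇ-connex : ∀ a b → (a ≤ᵇ b) ≡ false → (b ≤ᵇ a) ≡ true
≤ᵇ-connex a b e with ≤-total a b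
... | inj₁ p = true≢false (≤ᵇ-yes p) e
... | inj₂ p = ≤ᵇ-yes p

pending-preserved : ∀ q a as b bs → length as ≡ length bs → Decreasing (a ∷ as) → Decreasing (b ∷ bs) → ∀ g →
  srtIf (pending as bs) (suc q) (srtIf (a ≡ᵇ head₀ as) q (srtIf (b ≡ᵇ head₀ bs) (suc q) g)) ≗
  srtIf (a + depth as (b ∷ bs) ≡ᵇ head₀ as + depth (tail₀ as) bs) q
    (srtIf (head₀ (lowerB as (b ∷ bs)) ≡ᵇ head₀ (lowerB (tail₀ as) bs)) (suc q)
      (srtIf (pending (a ∷ as) (b ∷ bs)) q g))
pending-preserved q a as b bs len da db g
  rewrite circled-B as b bs len (proj₂ da) db
        | circled-A a (head₀ as) b (depth (tail₀ as) bs) (proj₁ da)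
  with pending-step as b bs len (proj₂ da) db
... | p , p' , p'' = srtIf-hecke q (pending as bs) (a ≡ᵇ head₀ as) (b ≡ᵇ head₀ bs) _ _
        (≤ᵇ-connex b _) (λ _ → p) (λ _ → p') (λ _ → p'') g

head-lowerA : ∀ as b bs → length as ≡ length bs → head₀ (lowerA as (b ∷ bs)) ≡ head₀ as + depth (tail₀ as) bs
head-lowerA [] b [] _ = refl
head-lowerA (a ∷ as) b bs _ = refl

-- The second block runs one place ahead of the first, so that each step involves the generators q,
-- q+1, q of a braid. When the lists are exhausted `pending` is true by definition, and the
-- correction left over is the generator on the left-hand side.
blocks-lower : ∀ q as b bs → length as ≡ length bs → Decreasing as → Decreasing bs → ∀ g g' →
  srtIf (pending as bs) q g ≗ g' →
  srt (q + length as) (block q as (block (suc q) bs g)) ≗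
  block q (lowerA as (b ∷ bs)) (block (suc q) (lowerB (tail₀ as) bs) g')
blocks-lower q [] b [] _ _ _ g g' e rewrite +-identityʳ q = e
blocks-lower q (a ∷ as) _ (b ∷ bs) len da db g g' e k
  rewrite +-suc q (length as) = trans
    (srt-cong (suc q + length as) (block-cong (suc q) as (block-comm (a ≡ᵇ head₀ as) ≤-refl bs (srtIf (b ≡ᵇ head₀ bs) (suc q) g))) k)
    (trans
      (blocks-lower (suc q) as b bs (suc-injective len) (proj₂ da) (proj₂ db) _
        (srtIf x' q (srtIf y' (suc q) g'))
        (λ k' → trans (pending-preserved q a as b bs (suc-injective len) da db g k')
          (trans (cong (λ c → srtIf c q (srtIf y' (suc q) (srtIf (pending (a ∷ as) (b ∷ bs)) q g)) k')
                       (cong ((a + depth as (b ∷ bs)) ≡ᵇ_) (sym (head-lowerA as b bs (suc-injective len)))))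
            (srtIf-cong x' q (srtIf-cong y' (suc q) e) k'))) k)
      (block-cong (suc q) (lowerA as (b ∷ bs)) (λ k' → sym (block-comm x' ≤-refl (lowerB (tail₀ as) bs) (srtIf y' (suc q) g') k')) k))
  where
  x' = a + depth as (b ∷ bs) ≡ᵇ head₀ (lowerA as (b ∷ bs))
  y' = head₀ (lowerB as (b ∷ bs)) ≡ᵇ head₀ (lowerB (tail₀ as) bs)

two-blocks-lower : ∀ as b bs → length as ≡ length bs → Decreasing as → Decreasing (b ∷ bs) → ∀ g →
  srt (length as) (block 0 as (block 0 (b ∷ bs) g)) ≗
  block 0 (lowerA as (b ∷ bs)) (block 0 (lowerB as (b ∷ bs)) g)
two-blocks-lower as b bs len da db g =
  blocks-lower 0 as b bs len da (proj₂ db) _ _ λ k → trans (eq (pending as bs) (b ≡ᵇ head₀ bs) k)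
    (cong (λ c → srtIf c 0 g k) (sym (circled-B as b bs len da db)))
  where
  eq : ∀ t y → srtIf t 0 (srtIf y 0 g) ≗ srtIf (if t then true else y) 0 g
  eq true true = srt-idem 0 g
  eq true false k = refl
  eq false y k = refl

-- The blocks of w₀ from the one starting at letter j (of length m) down to the one starting at
-- letter 1: raiseAll applies the operators e, keySort the circled reflections.
raiseAll : ℕ → ℕ → List ℕ → List ℕ
raiseAll zero m w = w
raiseAll (suc j) m w = raiseAll j (suc m) (raise (suc j) m w)

keySort : ℕ → ℕ → List ℕ → (ℕ → ℕ) → ℕ → ℕ
keySort zero m w g = g
keySort (suc j) m w g = block 0 (strings (suc j) m w) (keySort j (suc m) (raise (suc j) m w) g)

length-strings : ∀ k i w → length (strings i k w) ≡ k
length-strings zero i w = refl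
length-strings (suc k) i w = cong suc (length-strings k (suc i) (E₀ i w))

raise-highest′ : ∀ m j w → Highest (suc j) (j + m) w → Highest j (j + m) (raise j m w)
raise-highest′ zero j w H k p q = ⊥-elim (<-irrefl refl (≤-trans q (≤-trans (≤-reflexive (+-identityʳ j)) p)))
raise-highest′ (suc m) j w H =
  subst (λ u → Highest j u (raise j (suc m) w)) (sym (+-suc j m))
    (raise-highest m j w (subst (λ u → Highest (suc j) u w) (+-suc j m) H))

raise-highest-next : ∀ m j w → Highest (2 + j) (suc j + m) w → Highest (suc j) (j + suc m) (raise (suc j) m w)
raise-highest-next m j w H =
  subst (λ u → Highest (suc j) u (raise (suc j) m w)) (sym (+-suc j m)) (raise-highest′ m (suc j) w H)

raiseAll-highest : ∀ j m w → Highest (suc j) (j + m) w → Highest 1 (j + m) (raiseAll j m w)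
raiseAll-highest zero m w H = H
raiseAll-highest (suc j) m w H = subst (λ u → Highest 1 u (raiseAll j (suc m) (raise (suc j) m w))) (+-suc j m)
  (raiseAll-highest j (suc m) (raise (suc j) m w) (raise-highest-next m j w H))

-- The number `d` counts the blocks in front of the affected pair. They start at least two letters
-- higher, so their strings do not change, and the generator produced by the pair lies beyond the
-- neighbours of all their reflections and commutes with them.
keySort-E : ∀ d i m w g → Highest (2 + (d + suc i)) (suc (d + suc i) + m) w →
  keySort (suc (d + suc i)) m (E₀ (suc i) w) g ≗ srt (d + m) (keySort (suc (d + suc i)) m w g)
keySort-E zero i m w g H k = trans
    (cong-app (cong₂ block₂ (strings-A L) (cong₂ (λ bs u → block 0 bs (keySort i (2 + m) u g)) (strings-B L) (raise-E L))) k)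
    (sym (trans (cong (λ q → srt q (block 0 as (block 0 bs G)) k) (sym (length-strings m (2 + i) w)))
      (two-blocks-lower as (head₀ bs) (tail₀ bs) (trans (length-strings m (2 + i) w) (sym (length-strings m (2 + i) _)))
        (strings-decreasing m (2 + i) w H)
        (strings-decreasing (suc m) (suc i) (raise (2 + i) m w)
          (raise-highest-next m (suc i) w H)) G k)))
  where
  L = lowers-blocks m (suc i) w
  as = strings (2 + i) m w
  bs = strings (suc i) (suc m) (raise (2 + i) m w)
  G = keySort i (2 + m) (raise (suc i) (suc m) (raise (2 + i) m w)) g
  block₂ : List ℕ → (ℕ → ℕ) → ℕ → ℕ
  block₂ = block 0
keySort-E (suc d) i m w g H k
  rewrite strings-far {suc i} {2 + d + suc i} (s≤s (s≤s (m≤n+m (suc i) d))) m w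
        | raise-far {suc i} {2 + d + suc i} (s≤s (s≤s (m≤n+m (suc i) d))) m w = trans
    (block-cong 0 bs (keySort-E d i (suc m) (raise (2 + d + suc i) m w) g (raise-highest-next m (suc (d + suc i)) w H)) k)
    (trans (cong (λ q → block 0 bs (srt q (keySort (suc (d + suc i)) (suc m) (raise (2 + d + suc i) m w) g)) k) (+-suc d m))
      (sym (block-comm-below 0 bs _ {suc d + m} (s≤s (≤-trans (≤-reflexive (length-strings m _ w)) (m≤n+m m d))) k)))
  where bs = strings (2 + d + suc i) m w

-- Letter multiplicities as Gelfand-Tsetlin rows, and absorption of generators

count : ℕ → List ℕ → ℕ
count x [] = 0
count x (y ∷ w) = (if x ≡ᵇ y then 1 else 0) + count x w

count-E-lo : ∀ i c w → count i (E i c w) ≡ count i w + ε i c w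
count-E-lo i c [] = refl
count-E-lo i c (x ∷ w) with cls i x in eq
... | lo rewrite lo⇒≡ i x eq | ≡ᵇ-yes {i} refl = cong suc (count-E-lo i c w)
... | neither = trans (cong ((if i ≡ᵇ x then 1 else 0) +_) (count-E-lo i c w)) (sym (+-assoc (if i ≡ᵇ x then 1 else 0) (count i w) (ε i c w)))
... | hi with φ i c w
...   | zero rewrite hi⇒≡ i x eq | ≡ᵇ-yes {i} refl | ≡ᵇ-no {i} {suc i} (<⇒≢ ≤-refl) = trans (cong suc (count-E-lo i c w)) (sym (+-suc (count i w) (ε i c w)))
...   | suc f = trans (cong ((if i ≡ᵇ x then 1 else 0) +_) (count-E-lo i c w)) (sym (+-assoc (if i ≡ᵇ x then 1 else 0) (count i w) (ε i c w)))

count-E-hi : ∀ i c w → count (suc i) (E i c w) + ε i c w ≡ count (suc i) w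
count-E-hi i c [] = refl
count-E-hi i c (x ∷ w) with cls i x in eq
... | lo = trans (+-assoc (if suc i ≡ᵇ x then 1 else 0) (count (suc i) (E i c w)) (ε i c w)) (cong ((if suc i ≡ᵇ x then 1 else 0) +_) (count-E-hi i c w))
... | neither = trans (+-assoc (if suc i ≡ᵇ x then 1 else 0) (count (suc i) (E i c w)) (ε i c w)) (cong ((if suc i ≡ᵇ x then 1 else 0) +_) (count-E-hi i c w))
... | hi with φ i c w
...   | zero rewrite hi⇒≡ i x eq | ≡ᵇ-yes {i} refl | ≡ᵇ-no {suc i} {i} (<⇒≢ ≤-refl ∘ sym) = trans (+-suc _ _) (cong suc (count-E-hi i c w))
...   | suc f = trans (+-assoc (if suc i ≡ᵇ x then 1 else 0) (count (suc i) (E i c w)) (ε i c w)) (cong ((if suc i ≡ᵇ x then 1 else 0) +_) (count-E-hi i c w))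

count-E-neither : ∀ i y c w → cls i y ≡ neither → count y (E i c w) ≡ count y w
count-E-neither i y c [] _ = refl
count-E-neither i y c (x ∷ w) ne with cls i x in eq
... | lo = cong ((if y ≡ᵇ x then 1 else 0) +_) (count-E-neither i y c w ne)
... | neither = cong ((if y ≡ᵇ x then 1 else 0) +_) (count-E-neither i y c w ne)
... | hi with φ i c w
...   | suc f = cong ((if y ≡ᵇ x then 1 else 0) +_) (count-E-neither i y c w ne)
...   | zero rewrite hi⇒≡ i x eq
               | ≡ᵇ-no {y} {i} (neither⇒≢lo ne)
               | ≡ᵇ-no {y} {suc i} (neither⇒≢hi ne) =
  count-E-neither i y c w ne

φ+count : ∀ i c w → φ i c w + count (suc i) w ≡ ε i c w + count i w + c
φ+count i c [] = +-identityʳ c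
φ+count i c (x ∷ w) with φ+count i c w | cls i x in eq
... | p | lo rewrite lo⇒≡ i x eq | ≡ᵇ-yes {i} refl | ≡ᵇ-no {suc i} {i} (<⇒≢ ≤-refl ∘ sym) =
  trans (cong suc p) (cong (_+ c) (sym (+-suc (ε i c w) (count i w))))
... | p | neither
  rewrite ≡ᵇ-no {i} {x} (neither⇒≢lo eq ∘ sym)
        | ≡ᵇ-no {suc i} {x} (neither⇒≢hi eq ∘ sym) = p
... | p | hi rewrite hi⇒≡ i x eq | ≡ᵇ-yes {i} refl | ≡ᵇ-no {i} {suc i} (<⇒≢ ≤-refl) with φ i c w
...   | zero = cong suc p
...   | suc f = trans (+-suc f _) p

-- Each i+1 of `w` is either matched with an i or turned into one. This yields one of the two
-- interlacing inequalities of consecutive rows; the other is the decrease of the strings.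
count-≤-E : ∀ i w → count (suc i) w ≤ count i (E₀ i w)
count-≤-E i w = ≤-trans (m≤n+m _ (φ₀ i w)) (≤-reflexive (trans (φ+count i 0 w)
  (trans (+-identityʳ _) (trans (+-comm (ε₀ i w) (count i w)) (sym (count-E-lo i 0 w))))))

count-raise-below : ∀ k i x w → x < i → count x (raise i k w) ≡ count x w
count-raise-below zero i x w _ = refl
count-raise-below (suc k) i x w p =
  trans (count-raise-below k (suc i) x (E₀ i w) (m≤n⇒m≤1+n p)) (count-E-neither i x 0 w (cls-< i x p))

nth : List ℕ → ℕ → ℕ
nth [] p = 0
nth (b ∷ bs) zero = b
nth (b ∷ bs) (suc p) = nth bs p

nth-0 : ∀ bs → nth bs 0 ≡ head₀ bs
nth-0 [] = refl
nth-0 (b ∷ bs) = refl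

-- The letter i+1+p is lost by the operator of its own string and gained by that of the next one.
-- Two consecutive strings therefore agree exactly when the multiplicity of the letter does not
-- change.
count-raise : ∀ k i w p → p < k →
  count (suc i + p) (raise i k w) + nth (strings i k w) p ≡ count (suc i + p) w + nth (strings i k w) (suc p)
count-raise (suc zero) i w zero _ rewrite +-identityʳ i = trans (count-E-hi i 0 w) (sym (+-identityʳ _))
count-raise (suc (suc k)) i w zero _ rewrite +-identityʳ i = begin
  count (suc i) (raise (2 + i) k (E₀ (suc i) (E₀ i w))) + ε₀ i w
    ≡⟨ cong (_+ ε₀ i w) (trans (count-raise-below k (2 + i) (suc i) _ ≤-refl) (count-E-lo (suc i) 0 (E₀ i w))) ⟩
  count (suc i) (E₀ i w) + b + ε₀ i w   ≡⟨ +-assoc (count (suc i) (E₀ i w)) b (ε₀ i w) ⟩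
  count (suc i) (E₀ i w) + (b + ε₀ i w) ≡⟨ cong (count (suc i) (E₀ i w) +_) (+-comm b (ε₀ i w)) ⟩
  count (suc i) (E₀ i w) + (ε₀ i w + b) ≡⟨ +-assoc (count (suc i) (E₀ i w)) (ε₀ i w) b ⟨
  count (suc i) (E₀ i w) + ε₀ i w + b   ≡⟨ cong (_+ b) (count-E-hi i 0 w) ⟩
  count (suc i) w + b                   ∎
  where
  open ≡-Reasoning
  b = ε₀ (suc i) (E₀ i w)
count-raise (suc k) i w (suc p) (s≤s p<k) rewrite +-suc i p =
  trans (count-raise k (suc i) (E₀ i w) p p<k)
    (cong (_+ nth (strings (suc i) k (E₀ i w)) (suc p)) (count-E-neither i (2 + (i + p)) 0 w (cls-≥ i _ (s≤s (s≤s (m≤m+n i p))))))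

count-raise-≥ : ∀ k i w p → p < k → count (suc i + p) w ≤ count (i + p) (raise i k w)
count-raise-≥ (suc k) i w zero _ rewrite +-identityʳ i =
  ≤-trans (count-≤-E i w) (≤-reflexive (sym (count-raise-below k (suc i) i (E₀ i w) ≤-refl)))
count-raise-≥ (suc k) i w (suc p) (s≤s p<k) rewrite +-suc i p =
  ≤-trans (≤-reflexive (sym (count-E-neither i (2 + (i + p)) 0 w (cls-≥ i _ (s≤s (s≤s (m≤m+n i p)))))))
    (count-raise-≥ k (suc i) (E₀ i w) p p<k)

nth-decreasing : ∀ bs p → Decreasing bs → nth bs (suc p) ≤ nth bs p
nth-decreasing [] p _ = z≤n
nth-decreasing (b ∷ bs) zero (q , _) = ≤-trans (≤-reflexive (nth-0 bs)) q
nth-decreasing (b ∷ bs) (suc p) (_ , d) = nth-decreasing bs p d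

-- The circled reflection at p absorbs the incoming generator by idempotence unless the reflection
-- before it is circled too. In that case the braid relation carries the generator through the block
-- and it leaves with index lowered by one.
block-absorb : ∀ bs q p → p < length bs → nth bs p ≡ nth bs (suc p) →
  (∀ g → block q bs (srt (q + p) g) ≗ block q bs g) ⊎
  Σ ℕ λ p' → p ≡ suc p' × nth bs p' ≡ nth bs p × (∀ g → block q bs (srt (q + p) g) ≗ srt (q + p') (block q bs g))
block-absorb (b ∷ bs) q zero _ e rewrite +-identityʳ q | ≡ᵇ-yes (trans e (nth-0 bs)) =
  inj₁ λ g → block-cong (suc q) bs (srt-idem q g)
block-absorb (b ∷ b' ∷ bs) q (suc zero) _ e
  rewrite +-comm q 1 | ≡ᵇ-yes {b'} (trans e (nth-0 bs)) with b ≟ b'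
... | no ne rewrite ≡ᵇ-no ne = inj₁ λ g → block-cong (2 + q) bs (srt-idem (suc q) g)
... | yes eq rewrite ≡ᵇ-yes eq = inj₂ (0 , refl , eq , λ g k →
      trans (block-cong (2 + q) bs (λ k' → sym (srt-braid q g k')) k)
        (trans (sym (block-comm true ≤-refl bs (srt (suc q) (srt q g)) k))
          (cong (λ z → srt z (block (2 + q) bs (srt (suc q) (srt q g))) k) (sym (+-identityʳ q)))))
block-absorb (b ∷ bs) q (suc (suc p)) (s≤s l) e = push (block-absorb bs (suc q) (suc p) l e)
  where
  c = b ≡ᵇ head₀ bs
  push : (∀ g → block (suc q) bs (srt (suc q + suc p) g) ≗ block (suc q) bs g) ⊎
    (Σ ℕ λ p' → suc p ≡ suc p' × nth bs p' ≡ nth bs (suc p) × (∀ g → block (suc q) bs (srt (suc q + suc p) g) ≗ srt (suc q + p') (block (suc q) bs g))) → _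
  move : ∀ g → block (suc q) bs (srtIf c q (srt (q + (2 + p)) g)) ≗ block (suc q) bs (srt (suc q + suc p) (srtIf c q g))
  move g = block-cong (suc q) bs λ k → trans
    (srtIf-comm c true {q} {q + (2 + p)} (≤-trans (≤-reflexive (+-comm 2 q)) (+-monoʳ-≤ q (s≤s (s≤s z≤n)))) g k)
    (cong (λ z → srt z (srtIf c q g) k) (+-suc q (suc p)))
  push (inj₁ f) = inj₁ λ g k → trans (move g k) (f (srtIf c q g) k)
  push (inj₂ (p' , refl , e' , f)) = inj₂ (suc p' , refl , e' , λ g k → trans (move g k)
    (trans (f (srtIf c q g) k) (cong (λ z → srt z (block (suc q) bs (srtIf c q g)) k) (sym (+-suc q p')))))

Op : Set
Op = (ℕ → ℕ) → ℕ → ℕ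

Congruent : Op → Set
Congruent F = ∀ {g g'} → g ≗ g' → F g ≗ F g'

Absorbs : Op → ℕ → ℕ → List ℕ → Set
Absorbs F j n w = ∀ p → suc p < n → count (j + p) w ≡ count (suc j + p) w → ∀ g → F (srt p g) ≗ F g

-- Two equal entries of the longer row squeeze the entry of the shorter row between them, so string
-- p is circled. If the block only passes the generator on, string p-1 is circled as well; then the
-- shorter row has two equal entries at p-1, and the earlier blocks absorb the generator.
absorbs-block : ∀ F j m w → Congruent F → Highest (suc j) (j + m) w → Absorbs F (suc j) m w →
  Absorbs (F ∘ block 0 (strings j m w)) j (suc m) (raise j m w)
absorbs-block F j m w cF H A p (s≤s p<m) eq g with block-absorb (strings j m w) 0 p
    (≤-trans p<m (≤-reflexive (sym (length-strings m j w)))) circled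
  where
  bs = strings j m w
  circled : nth bs p ≡ nth bs (suc p)
  circled = ≤-antisym
    (+-cancelˡ-≤ (count (suc j + p) (raise j m w)) _ _
      (≤-trans (≤-reflexive (count-raise m j w p p<m))
        (+-monoˡ-≤ (nth bs (suc p)) (≤-trans (count-raise-≥ m j w p p<m) (≤-reflexive eq)))))
    (nth-decreasing bs p (strings-decreasing m j w H))
... | inj₁ f = cF (f g)
... | inj₂ (p' , refl , e , f) = λ k → trans (cF (f g) k)
        (A p' p<m (trans B₁ (sym B₀)) (block 0 bs g) k)
  where
  bs = strings j m w
  u = raise j m w
  p'<m = <⇒≤ p<m
  B₁ : count (suc j + p') w ≡ count (suc j + p') u
  B₁ = sym (+-cancelʳ-≡ (nth bs p') _ _ (trans (count-raise m j w p' p'<m) (cong (count (suc j + p') w +_) (sym e))))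
  B₀ : count (2 + j + p') w ≡ count (suc j + p') u
  B₀ = ≤-antisym
    (≤-trans (≤-reflexive (cong (λ x → count x w) (sym (cong suc (+-suc j p')))))
      (≤-trans (count-raise-≥ m j w (suc p') p<m) (≤-reflexive (cong (λ x → count x u) (+-suc j p')))))
    (≤-trans (≤-reflexive (trans (cong (λ x → count x u) (sym (+-suc j p'))) (trans eq (cong (λ x → count x u) (cong suc (+-suc j p'))))))
      (+-cancelʳ-≤ (nth bs (suc p')) _ _ (≤-trans (≤-reflexive (trans (cong (λ x → count x u + nth bs (suc p')) (cong suc (sym (+-suc j p'))))
          (trans (count-raise m j w (suc p') p<m) (cong (λ x → count x w + nth bs (2 + p')) (cong suc (+-suc j p'))))))
        (+-monoʳ-≤ _ (nth-decreasing bs (suc p') (strings-decreasing m j w H))))))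

absorbs-keySort : ∀ j m w F → Congruent F → Highest (suc j) (j + m) w → Absorbs F (suc j) m w →
  Absorbs (F ∘ keySort j m w) 1 (j + m) (raiseAll j m w)
absorbs-keySort zero m w F cF H A = A
absorbs-keySort (suc j) m w F cF H A p q = absorbs-keySort j (suc m) (raise (suc j) m w)
  (F ∘ block 0 (strings (suc j) m w)) (λ e → cF (block-cong 0 (strings (suc j) m w) e))
  (raise-highest-next m j w H) (absorbs-block F (suc j) m w cF H A) p (≤-trans q (≤-reflexive (sym (+-suc j m))))

-- Vanishing strings from a reversed sequence

Ascending : ℕ → ℕ → (ℕ → ℕ) → Set
Ascending q n g = ∀ k → k < n → g (q + k) < g (suc (q + k))

ascending-tail : ∀ q g {n} → Ascending q (suc n) g → Ascending (suc q) n g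
ascending-tail q g {n} a k k<n = subst (λ x → g x < g (suc x)) (+-suc q k) (a (suc k) (s≤s k<n))

ascending-srt : ∀ q g {n} → Ascending q (suc n) g → Ascending (suc q) n (srt q g)
ascending-srt q g {n} a zero k<n rewrite +-identityʳ q | srt-hi q g | srt-neither q g (2 + q) (cls-≥ q (2 + q) ≤-refl) =
  ≤-trans (s≤s (m⊓n≤n (g q) (g (suc q)))) (subst (λ x → g x < g (suc x)) (+-comm q 1) (a 1 (s≤s k<n)))
ascending-srt q g {n} a (suc k) k<n
  rewrite +-suc q k | srt-neither q g (2 + (q + k)) (cls-≥ q _ (s≤s (s≤s (m≤m+n q k))))
        | srt-neither q g (3 + (q + k)) (cls-≥ q _ (s≤s (s≤s (m≤n⇒m≤1+n (m≤m+n q k))))) =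
  subst (λ x → g x < g (suc x)) (trans (+-suc q (suc k)) (cong suc (+-suc q k))) (a (2 + k) (s≤s k<n))

ascending-head : ∀ q g {n} → Ascending q (suc n) g → g q < g (suc q)
ascending-head q g {n} a = subst (λ x → g x < g (suc x)) (+-identityʳ q) (a 0 z<s)

block-≥ : ∀ q bs g → Ascending q (length bs) g → g q ≤ block q bs g (q + length bs)
block-≥ q [] g a rewrite +-identityʳ q = ≤-refl
block-≥ q (b ∷ bs) g a rewrite +-suc q (length bs) with b ≡ᵇ head₀ bs
... | true = ≤-trans (≤-reflexive (sym (trans (srt-hi q g) (m≤n⇒m⊓n≡m (<⇒≤ (ascending-head q g a))))))
               (block-≥ (suc q) bs (srt q g) (ascending-srt q g a))
... | false = ≤-trans (<⇒≤ (ascending-head q g a)) (block-≥ (suc q) bs g (ascending-tail q g a))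

block-below : ∀ q bs g k → k < q → block q bs g k ≡ g k
block-below q [] g k _ = refl
block-below q (b ∷ bs) g k p with b ≡ᵇ head₀ bs
... | true = trans (block-below (suc q) bs (srt q g) k (m≤n⇒m≤1+n p)) (srt-neither q g k (cls-< q k p))
... | false = block-below (suc q) bs g k (m≤n⇒m≤1+n p)

block-above : ∀ q bs g k → q + length bs < k → block q bs g k ≡ g k
block-above q [] g k _ = refl
block-above q (b ∷ bs) g k p rewrite +-suc q (length bs) with b ≡ᵇ head₀ bs
... | true = trans (block-above (suc q) bs (srt q g) k p)
               (srt-neither q g k (cls-≥ q k (≤-trans (s≤s (s≤s (m≤m+n q (length bs)))) p)))
... | false = block-above (suc q) bs g k p

AllZero : List ℕ → Set
AllZero = All (_≡ 0)

head₀-zero : ∀ {bs} → AllZero bs → head₀ bs ≡ 0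
head₀-zero [] = refl
head₀-zero (e ∷ _) = e

-- The smallest entry reaches the end of the block only if every reflection of the block is circled.
block-full : ∀ q bs g → Ascending q (length bs) g → block q bs g (q + length bs) ≡ g q →
  AllZero bs × (∀ k → k < length bs → block q bs g (q + k) ≡ g (suc (q + k)))
block-full q [] g a e = [] , λ k ()
block-full q (b ∷ bs) g a e rewrite +-suc q (length bs) with b ≡ᵇ head₀ bs in eq
... | false = ⊥-elim (<-irrefl (sym e) (≤-trans (ascending-head q g a) (block-≥ (suc q) bs g (ascending-tail q g a))))
... | true with block-full (suc q) bs (srt q g) (ascending-srt q g a)
                  (trans e (sym (trans (srt-hi q g) (m≤n⇒m⊓n≡m (<⇒≤ (ascending-head q g a))))))
...   | z , f = trans (≡ᵇ-true⇒≡ eq) (head₀-zero z) ∷ z , go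
  where
  go : ∀ k → k < suc (length bs) → block (suc q) bs (srt q g) (q + k) ≡ g (suc (q + k))
  go zero _ rewrite +-identityʳ q = trans (block-below (suc q) bs (srt q g) q ≤-refl)
    (trans (srt-lo q g) (m≤n⇒m⊔n≡n (<⇒≤ (ascending-head q g a))))
  go (suc k) (s≤s p) rewrite +-suc q k = trans (f k p) (srt-neither q g (2 + (q + k)) (cls-≥ q _ (s≤s (s≤s (m≤m+n q k)))))

raise-zero : ∀ k i w → AllZero (strings i k w) → raise i k w ≡ w
raise-zero zero i w _ = refl
raise-zero (suc k) i w (e ∷ z) rewrite ε≡0⇒E≡ i 0 w e = raise-zero k (suc i) w z

<-pred⇒suc-< : ∀ {k m} → k < pred m → suc k < m
<-pred⇒suc-< {m = suc m} p = s≤s p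

Reverses : Op → ℕ → (ℕ → ℕ) → Set
Reverses F n g = ∀ k → k < n → F g k ≡ g (n ∸ suc k)

Fixes≥ : Op → ℕ → Set
Fixes≥ F n = ∀ g k → n ≤ k → F g k ≡ g k

-- F is the product of the blocks already passed and C the word at which they started.
reversing⇒fixed : ∀ j m w F C → Congruent F → Fixes≥ F m →
  (∀ g → Ascending 0 (pred m) g → Reverses F m g → C ≡ w) →
  ∀ g → Ascending 0 (pred (j + m)) g → Reverses (F ∘ keySort j m w) (j + m) g → C ≡ raiseAll j m w
reversing⇒fixed zero m w F C cF fF H g a r = H g a r
reversing⇒fixed (suc j) m w F C cF fF H g a r =
  reversing⇒fixed j (suc m) (raise (suc j) m w) (F ∘ block 0 bs) C (λ e → cF (block-cong 0 bs e)) fix step g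
    (subst (λ n → Ascending 0 (pred n) g) (sym (+-suc j m)) a)
    (subst (λ n → Reverses (F ∘ keySort (suc j) m w) n g) (sym (+-suc j m)) r)
  where
  bs = strings (suc j) m w
  len≡m = length-strings m (suc j) w
  fix : Fixes≥ (F ∘ block 0 bs) (suc m)
  fix g k p = trans (fF (block 0 bs g) k (<⇒≤ p)) (block-above 0 bs g k (≤-trans (s≤s (≤-reflexive len≡m)) p))
  step : ∀ g → Ascending 0 m g → Reverses (F ∘ block 0 bs) (suc m) g → C ≡ raise (suc j) m w
  step g a r with block-full 0 bs g (λ k p → a k (≤-trans p (≤-reflexive len≡m)))
      (trans (cong (block 0 bs g) len≡m) (trans (sym (fF (block 0 bs g) m ≤-refl)) (trans (r m ≤-refl) (cong g (n∸n≡0 m)))))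
  ... | z , f = trans (H (block 0 bs g) asc rev) (sym (raise-zero m (suc j) w z))
    where
    shift : ∀ k → k < m → block 0 bs g k ≡ g (suc k)
    shift k p = f k (≤-trans p (≤-reflexive (sym len≡m)))
    asc : Ascending 0 (pred m) (block 0 bs g)
    asc k p = ≤-trans (s≤s (≤-reflexive (shift k (<⇒≤ p'))))
                (≤-trans (a (suc k) p') (≤-reflexive (sym (shift (suc k) p'))))
      where
      p' : suc k < m
      p' = <-pred⇒suc-< p
    rev : Reverses F m (block 0 bs g)
    rev k p = trans (r k (m≤n⇒m≤1+n p)) (trans (cong g (sym (m∸k k p))) (sym (shift (m ∸ suc k) (∸-monoʳ-< z<s p))))
      where
      m∸k : ∀ k → k < m → suc (m ∸ suc k) ≡ m ∸ k
      m∸k k p = sym (+-∸-assoc 1 p)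

-- Tableaux and their reading words

φ-++ : ∀ i c w u → φ i c (w ++ u) ≡ φ i (φ i c u) w
φ-++ i c [] u = refl
φ-++ i c (x ∷ w) u rewrite φ-++ i c w u = refl

ε-++ : ∀ i c w u → ε i c (w ++ u) ≡ ε i (φ i c u) w + ε i c u
ε-++ i c [] u = refl
ε-++ i c (x ∷ w) u rewrite φ-++ i c w u | ε-++ i c w u =
  sym (+-assoc (hits (cls i x) (φ i (φ i c u) w)) (ε i (φ i c u) w) (ε i c u))

E-++ : ∀ i c w u → E i c (w ++ u) ≡ E i (φ i c u) w ++ E i c u
E-++ i c [] u = refl
E-++ i c (x ∷ w) u rewrite φ-++ i c w u | E-++ i c w u = refl

length-E : ∀ i c w → length (E i c w) ≡ length w
length-E i c [] = refl
length-E i c (x ∷ w) = cong suc (length-E i c w)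

ε≤length : ∀ i c w → ε i c w ≤ length w
ε≤length i c [] = z≤n
ε≤length i c (x ∷ w) = +-mono-≤ (hits≤1 (cls i x) (φ i c w)) (ε≤length i c w)
  where
  hits≤1 : ∀ k c → hits k c ≤ 1
  hits≤1 lo c = z≤n
  hits≤1 hi zero = ≤-refl
  hits≤1 hi (suc c) = z≤n
  hits≤1 neither c = z≤n

-- The top row stands last in the reading word, so it is treated first and hands its unmatched
-- letters to the rows below.
raiseRows : ∀ {n} → ℕ → ℕ → Vec (List ℕ) n → Vec (List ℕ) n
raiseRows i c [] = []
raiseRows i c (row ∷ rows) = E i c row ∷ raiseRows i (φ i c row) rows

readWord-raiseRows : ∀ {n} i c (T : Vec (List ℕ) n) → readWord (raiseRows i c T) ≡ E i c (readWord T)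
readWord-raiseRows i c [] = refl
readWord-raiseRows i c (row ∷ rows) =
  trans (cong (_++ E i c row) (readWord-raiseRows i (φ i c row) rows)) (sym (E-++ i c (readWord rows) row))

SameShape : ∀ {n} → Vec (List ℕ) n → Vec (List ℕ) n → Set
SameShape S T = ∀ j → length (lookup S j) ≡ length (lookup T j)

raiseRows-shape : ∀ {n} i c (T : Vec (List ℕ) n) → SameShape (raiseRows i c T) T
raiseRows-shape i c (row ∷ rows) F.zero = length-E i c row
raiseRows-shape i c (row ∷ rows) (F.suc j) = raiseRows-shape i (φ i c row) rows j

++-injective : ∀ (u u' : List ℕ) {v v'} → length u ≡ length u' → u ++ v ≡ u' ++ v' → u ≡ u' × v ≡ v'
++-injective [] [] _ e = refl , e
++-injective (x ∷ u) (y ∷ u') l e with ++-injective u u' (suc-injective l) (LP.∷-injectiveʳ e)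
... | p , q = cong₂ _∷_ (LP.∷-injectiveˡ e) p , q

readWord-length : ∀ {n} {S T : Vec (List ℕ) n} → SameShape S T → length (readWord S) ≡ length (readWord T)
readWord-length {S = []} {[]} _ = refl
readWord-length {S = s ∷ S} {t ∷ T} h = trans (LP.length-++ (readWord S))
  (trans (cong₂ _+_ (readWord-length {S = S} {T} (h ∘ F.suc)) (h F.zero)) (sym (LP.length-++ (readWord T))))

readWord-injective : ∀ {n} {S T : Vec (List ℕ) n} → SameShape S T → readWord S ≡ readWord T → S ≡ T
readWord-injective {S = []} {[]} _ _ = refl
readWord-injective {S = s ∷ S} {t ∷ T} h e
  with ++-injective (readWord S) (readWord T) (readWord-length {S = S} {T} (h ∘ F.suc)) e
... | p , q = cong₂ _∷_ q (readWord-injective (h ∘ F.suc) p)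

-- The signature rule in terms of ε, φ and E

hit? : Cls → ℕ → Bool
hit? lo c = false
hit? hi zero = true
hit? hi (suc c) = false
hit? neither c = false

marks : ℕ → ℕ → List ℕ → List Bool
marks i c [] = []
marks i c (x ∷ w) = hit? (cls i x) (φ i c w) ∷ marks i c w

marksRev-∷ : ∀ i x xs c → marksRev i (x ∷ xs) c ≡ hit? (cls i x) c ∷ marksRev i xs (nextCount (cls i x) c)
marksRev-∷ i x xs c with cls i x in eq
... | lo rewrite lo⇒≡ i x eq | ≡ᵇ-yes {i} refl = refl
... | neither
  rewrite ≡ᵇ-no {x} {i} (neither⇒≢lo eq)
        | ≡ᵇ-no {x} {suc i} (neither⇒≢hi eq) = refl
marksRev-∷ i x xs zero | hi rewrite hi⇒≡ i x eq | ≡ᵇ-no {suc i} {i} (<⇒≢ ≤-refl ∘ sym) | ≡ᵇ-yes {i} refl = refl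
marksRev-∷ i x xs (suc c) | hi rewrite hi⇒≡ i x eq | ≡ᵇ-no {suc i} {i} (<⇒≢ ≤-refl ∘ sym) | ≡ᵇ-yes {i} refl = refl

marksRev-++ : ∀ i u x c → marksRev i (u ++ x ∷ []) c ≡ marksRev i u c ++ hit? (cls i x) (φ i c (L.reverse u)) ∷ []
marksRev-++ i [] x c = marksRev-∷ i x [] c
marksRev-++ i (y ∷ u) x c = begin
  marksRev i (y ∷ u ++ x ∷ []) c
    ≡⟨ marksRev-∷ i y (u ++ x ∷ []) c ⟩
  b ∷ marksRev i (u ++ x ∷ []) c'
    ≡⟨ cong (b ∷_) (marksRev-++ i u x c') ⟩
  b ∷ (marksRev i u c' ++ hit? (cls i x) (φ i c' (L.reverse u)) ∷ [])
    ≡⟨ cong (λ z → b ∷ (marksRev i u c' ++ hit? (cls i x) z ∷ [])) (trans (cong (φ i c) (LP.unfold-reverse y u)) (φ-++ i c (L.reverse u) (y ∷ []))) ⟨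
  b ∷ (marksRev i u c' ++ hit? (cls i x) (φ i c (L.reverse (y ∷ u))) ∷ [])
    ≡⟨ cong (_++ hit? (cls i x) (φ i c (L.reverse (y ∷ u))) ∷ []) (marksRev-∷ i y u c) ⟨
  marksRev i (y ∷ u) c ++ hit? (cls i x) (φ i c (L.reverse (y ∷ u))) ∷ [] ∎
  where
  open ≡-Reasoning
  b = hit? (cls i y) c
  c' = nextCount (cls i y) c

marksRev-reverse : ∀ i w c → L.reverse (marksRev i (L.reverse w) c) ≡ marks i c w
marksRev-reverse i [] c = refl
marksRev-reverse i (x ∷ w) c = begin
  L.reverse (marksRev i (L.reverse (x ∷ w)) c)
    ≡⟨ cong (λ z → L.reverse (marksRev i z c)) (LP.unfold-reverse x w) ⟩
  L.reverse (marksRev i (L.reverse w ++ x ∷ []) c)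
    ≡⟨ cong L.reverse (marksRev-++ i (L.reverse w) x c) ⟩
  L.reverse (marksRev i (L.reverse w) c ++ hit? (cls i x) (φ i c (L.reverse (L.reverse w))) ∷ [])
    ≡⟨ LP.reverse-++ (marksRev i (L.reverse w) c) (hit? (cls i x) (φ i c (L.reverse (L.reverse w))) ∷ []) ⟩
  hit? (cls i x) (φ i c (L.reverse (L.reverse w))) ∷ L.reverse (marksRev i (L.reverse w) c)
    ≡⟨ cong₂ _∷_ (cong (λ z → hit? (cls i x) (φ i c z)) (LP.reverse-involutive w)) (marksRev-reverse i w c) ⟩
  marks i c (x ∷ w) ∎
  where open ≡-Reasoning

lowerAt : List ℕ → List Bool → List ℕ
lowerAt [] ms = []
lowerAt (x ∷ w) [] = x ∷ w
lowerAt (x ∷ w) (b ∷ ms) = (if b then x ∸ 1 else x) ∷ lowerAt w ms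

lowerAt-[] : ∀ w → lowerAt w [] ≡ w
lowerAt-[] [] = refl
lowerAt-[] (x ∷ w) = refl

lowerAt-++ : ∀ w u ms → lowerAt (w ++ u) ms ≡ lowerAt w ms ++ lowerAt u (L.drop (length w) ms)
lowerAt-++ [] u ms = refl
lowerAt-++ (x ∷ w) u [] = cong (x ∷_) (cong (w ++_) (sym (lowerAt-[] u)))
lowerAt-++ (x ∷ w) u (b ∷ ms) = cong ((if b then x ∸ 1 else x) ∷_) (lowerAt-++ w u ms)

lowerAt-length : ∀ w ms → length (lowerAt w ms) ≡ length w
lowerAt-length [] ms = refl
lowerAt-length (x ∷ w) [] = refl
lowerAt-length (x ∷ w) (b ∷ ms) = cong suc (lowerAt-length w ms)

repRow-lowerAt : ∀ row ms → repRow row ms ≡ (lowerAt row ms , L.drop (length row) ms)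
repRow-lowerAt [] ms = refl
repRow-lowerAt (x ∷ w) [] = refl
repRow-lowerAt (x ∷ w) (b ∷ ms) rewrite repRow-lowerAt w ms = refl

repRows-lowerAt : ∀ {n} (T : Vec (List ℕ) n) ms →
  readWord (proj₁ (repRows T ms)) ≡ lowerAt (readWord T) ms ×
  proj₂ (repRows T ms) ≡ L.drop (length (readWord T)) ms ×
  SameShape (proj₁ (repRows T ms)) T
repRows-lowerAt [] ms = refl , refl , λ ()
repRows-lowerAt (row ∷ rows) ms with repRows rows ms | repRows-lowerAt rows ms
... | rows' , .(L.drop (length (readWord rows)) ms) | e , refl , s
  rewrite repRow-lowerAt row (L.drop (length (readWord rows)) ms) =
  trans (cong (_++ lowerAt row (L.drop (length (readWord rows)) ms)) e) (sym (lowerAt-++ (readWord rows) row ms)) ,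
  trans (LP.drop-drop (length (readWord rows)) (length row) ms) (cong (λ k → L.drop k ms) (sym (LP.length-++ (readWord rows)))) ,
  λ { F.zero → lowerAt-length row _ ; (F.suc j) → s j }

lowerAt-none : ∀ w (ms : List Bool) → lowerAt w (map (λ _ → false) ms) ≡ w
lowerAt-none [] ms = refl
lowerAt-none (x ∷ w) [] = refl
lowerAt-none (x ∷ w) (b ∷ ms) = cong (x ∷_) (lowerAt-none w ms)

record Lowers (i c : ℕ) (w w' : List ℕ) : Set where
  field
    φ-suc  : φ i c w' ≡ suc (φ i c w)
    ε-pred : suc (ε i c w') ≡ ε i c w
    E-same : E i c w' ≡ E i c w

open Lowers

Neutral : ℕ → ℕ → Cls → ℕ → Set
Neutral i x k f = hits k (suc f) ≡ hits k f × nextCount k (suc f) ≡ suc (nextCount k f) × letter k i x (suc f) ≡ letter k i x f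

lowers-∷ : ∀ i c x {w w'} → Lowers i c w w' → Neutral i x (cls i x) (φ i c w) → Lowers i c (x ∷ w) (x ∷ w')
lowers-∷ i c x {w} {w'} q (a , b , d) = record
  { φ-suc  = trans (cong (nextCount k) (φ-suc q)) b
  ; ε-pred = trans (cong (λ m → suc (m + ε i c w')) (trans (cong (hits k) (φ-suc q)) a))
               (trans (sym (+-suc (hits k (φ i c w)) (ε i c w'))) (cong (hits k (φ i c w) +_) (ε-pred q)))
  ; E-same = cong₂ _∷_ (trans (cong (letter k i x) (φ-suc q)) d) (E-same q) }
  where k = cls i x

-- To the left of the first mark every i+1 already meets a positive counter. One more unmatched i
-- raises the counter there without changing any hit or letter, which is what `Neutral` records.
lowers-first : ∀ i c w → let ms = firstMark (marks i c w) in
  anyTrue ms ≡ false × ε i c w ≡ 0 ⊎ anyTrue ms ≡ true × Lowers i c w (lowerAt w ms)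
lowers-first i c [] = inj₁ (refl , refl)
lowers-first i c (x ∷ w) with cls i x in eq | lowers-first i c w
... | lo | inj₁ p = inj₁ p
... | lo | inj₂ (p , q) = inj₂ (p , lowers-∷ i c x q (subst (λ k → Neutral i x k (φ i c w)) (sym eq) (refl , refl , refl)))
... | neither | inj₁ p = inj₁ p
... | neither | inj₂ (p , q) = inj₂ (p , lowers-∷ i c x q (subst (λ k → Neutral i x k (φ i c w)) (sym eq) (refl , refl , refl)))
... | hi | IH with φ i c w in eq'
...   | zero = inj₂ (refl , go)
  where
  go : Lowers i c (x ∷ w) ((x ∸ 1) ∷ lowerAt w (map (λ _ → false) (marks i c w)))
  go rewrite hi⇒≡ i x eq | lowerAt-none w (marks i c w) = record
    { φ-suc = trans (cong (λ k → nextCount k (φ i c w)) (cls-lo i)) (cong suc (trans eq' (sym (cong₂ nextCount (cls-hi i) eq'))))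
    ; ε-pred = trans (cong (λ k → suc (hits k (φ i c w) + ε i c w)) (cls-lo i)) (cong (_+ ε i c w) (sym (cong₂ hits (cls-hi i) eq')))
    ; E-same = cong (_∷ E i c w) (trans (cong (λ k → letter k i i (φ i c w)) (cls-lo i)) (sym (cong₂ (λ k → letter k i (suc i)) (cls-hi i) eq'))) }
lowers-first i c (x ∷ w) | hi | inj₁ p | suc f = inj₁ p
lowers-first i c (x ∷ w) | hi | inj₂ (p , q) | suc f =
  inj₂ (p , lowers-∷ i c x q (subst₂ (Neutral i x) (sym eq) (sym eq') (refl , refl , refl)))

eOp-spec : ∀ {r} i (T : Tab r) →
  eOp i T ≡ nothing × ε₀ i (readWord T) ≡ 0 ⊎
  Σ (Tab r) λ T' → eOp i T ≡ just T' × Lowers i 0 (readWord T) (readWord T') × SameShape T' T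
eOp-spec i T with lowers-first i 0 (readWord T)
... | inj₁ (p , q) rewrite marksRev-reverse i (readWord T) 0 | p = inj₁ (refl , q)
... | inj₂ (p , q) rewrite marksRev-reverse i (readWord T) 0 | p
  with repRows-lowerAt T (firstMark (marks i 0 (readWord T)))
...   | e , _ , s = inj₂ (_ , refl , subst (Lowers i 0 (readWord T)) (sym e) q , s)

raiseRows-fixed : ∀ {n} i (T : Vec (List ℕ) n) → ε₀ i (readWord T) ≡ 0 → raiseRows i 0 T ≡ T
raiseRows-fixed i T e = readWord-injective (raiseRows-shape i 0 T)
  (trans (readWord-raiseRows i 0 T) (ε≡0⇒E≡ i 0 (readWord T) e))

raiseRows-lowers : ∀ {n} i (T T' : Vec (List ℕ) n) → Lowers i 0 (readWord T) (readWord T') → SameShape T' T →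
  raiseRows i 0 T' ≡ raiseRows i 0 T
raiseRows-lowers i T T' q s = readWord-injective
  (λ j → trans (raiseRows-shape i 0 T' j) (trans (s j) (sym (raiseRows-shape i 0 T j))))
  (trans (readWord-raiseRows i 0 T') (trans (E-same q) (sym (readWord-raiseRows i 0 T))))

maxEFuel-spec : ∀ {r} i f (T : Tab r) → ε₀ i (readWord T) < f →
  maxEFuel i f T ≡ (ε₀ i (readWord T) , raiseRows i 0 T)
maxEFuel-spec i (suc f) T p with eOp-spec i T
... | inj₁ (e , z) rewrite e | z = cong (0 ,_) (sym (raiseRows-fixed i T z))
... | inj₂ (T' , e , q , s) rewrite e
    | maxEFuel-spec i f T' (≤-trans (≤-reflexive (ε-pred q)) (≤-pred p)) =
  cong₂ _,_ (ε-pred q) (raiseRows-lowers i T T' q s)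

maxE-spec : ∀ {r} i (T : Tab r) → maxE i T ≡ (ε₀ i (readWord T) , raiseRows i 0 T)
maxE-spec i T = maxEFuel-spec i _ T (s≤s (ε≤length i 0 (readWord T)))

-- All tableaux on one i-string have the same top; this makes the unspecified exponent of `dem-step`
-- harmless.
eIter-same : ∀ {r} i k (T : Tab r) {T'} → eIter i k T ≡ just T' → E₀ i (readWord T') ≡ E₀ i (readWord T)
eIter-same i zero T refl = refl
eIter-same i (suc k) T e with eOp-spec i T
... | inj₁ (p , _) rewrite p = contradiction e (λ ())
... | inj₂ (T₁ , p , q , _) rewrite p = trans (eIter-same i k T₁ e) (E-same q)

eIter-max : ∀ {r} i k (T : Tab r) → ε₀ i (readWord T) ≡ k → eIter i k T ≡ just (raiseRows i 0 T)
eIter-max i zero T e = cong just (sym (raiseRows-fixed i T e))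
eIter-max i (suc k) T e with eOp-spec i T
... | inj₁ (_ , z) = contradiction (trans (sym e) z) (λ ())
... | inj₂ (T₁ , p , q , s) rewrite p =
  trans (eIter-max i k T₁ (suc-injective (trans (ε-pred q) e))) (cong just (raiseRows-lowers i T T₁ q s))

raiseTab : ∀ {r} → ℕ → ℕ → Tab r → Tab r
raiseTab i zero T = T
raiseTab i (suc k) T = raiseTab (suc i) k (raiseRows i 0 T)

readWord-raiseTab : ∀ {r} i k (T : Tab r) → readWord (raiseTab i k T) ≡ raise i k (readWord T)
readWord-raiseTab i zero T = refl
readWord-raiseTab i (suc k) T =
  trans (readWord-raiseTab (suc i) k (raiseRows i 0 T)) (cong (raise (suc i) k) (readWord-raiseRows i 0 T))

procBlock-spec : ∀ {r} i k (T : Tab r) → procBlock i k T ≡ (strings i k (readWord T) , raiseTab i k T)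
procBlock-spec i zero T = refl
procBlock-spec i (suc k) T
  rewrite maxE-spec i T | procBlock-spec (suc i) k (raiseRows i 0 T) | readWord-raiseRows i 0 T = refl

sortBy : List ℕ → Op
sortBy [] g = g
sortBy (p ∷ ps) g = srt (p ∸ 1) (sortBy ps g)

circAux-∷ : ∀ p b bs → circAux p (b ∷ bs) ≡ (if b ≡ᵇ head₀ bs then p ∷ [] else []) ++ circAux (suc p) bs
circAux-∷ p b [] = sym (LP.++-identityʳ _)
circAux-∷ p b (_ ∷ _) = refl

sortBy-circled : ∀ q bs ps g → sortBy (L.reverse (circAux (suc q) bs) ++ ps) g ≡ block q bs (sortBy ps g)
sortBy-circled q [] ps g = refl
sortBy-circled q (b ∷ bs) ps g rewrite circAux-∷ (suc q) b bs with b ≡ᵇ head₀ bs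
... | false = sortBy-circled (suc q) bs ps g
... | true rewrite LP.unfold-reverse (suc q) (circAux (2 + q) bs)
                 | LP.++-assoc (L.reverse (circAux (2 + q) bs)) (suc q ∷ []) ps =
  sortBy-circled (suc q) bs (suc q ∷ ps) g

sortBy-blocks : ∀ {r} m k (T : Tab r) g → m + k ≡ r →
  sortBy (concat (map (λ bs → L.reverse (circAux 1 bs)) (blocksFrom m k T))) g ≡ keySort k m (readWord T) g
sortBy-blocks m zero T g e = refl
sortBy-blocks {r} m (suc k) T g refl
  rewrite m+n∸m≡n m (suc k) | procBlock-spec (suc k) m T =
  trans (sortBy-circled 0 (strings (suc k) m (readWord T)) _ g)
    (cong (block 0 (strings (suc k) m (readWord T)))
      (trans (sortBy-blocks (suc m) k (raiseTab (suc k) m T) g (sym (+-suc m k)))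
        (cong (λ w → keySort k (suc m) w g) (readWord-raiseTab (suc k) m T))))

-- The additional first block, at letter r and of length 0, is empty. With it the letter r-1 also
-- acts on a pair of consecutive blocks.
sortBy-circledSeq : ∀ {r} → 1 ≤ r → (T : Tab r) → ∀ g → sortBy (circledSeq T) g ≡ keySort r 0 (readWord T) g
sortBy-circledSeq {suc r} _ T g = sortBy-blocks 1 r T g refl

-- Raising preserves semistandard tableaux

data LetterView (i x c : ℕ) : ℕ → Set where
  lowered : x ≡ suc i → c ≡ 0 → LetterView i x c i
  kept    : (x ≡ suc i → 0 < c) → LetterView i x c x

letterView : ∀ i x c → LetterView i x c (letter (cls i x) i x c)
letterView i x c with cls i x in eq
... | lo = kept λ e → ⊥-elim (<-irrefl (trans (sym (lo⇒≡ i x eq)) e) ≤-refl)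
... | neither = kept λ e → ⊥-elim (neither⇒≢hi eq e)
letterView i x zero | hi = lowered (hi⇒≡ i x eq) refl
letterView i x (suc c) | hi = kept λ _ → z<s

letter-≤ : ∀ i x c → letter (cls i x) i x c ≤ x
letter-≤ i x c with letter (cls i x) i x c | letterView i x c
... | .i | lowered refl _ = n≤1+n i
... | .x | kept _ = ≤-refl

φ-lowered : ∀ i c w → φ i c w ≡ 0 → φ i c (suc i ∷ w) ≡ 0
φ-lowered i c w e rewrite cls-hi i = cong pred e

rowWeak-tail : ∀ {x w} → RowWeak (x ∷ w) → RowWeak w
rowWeak-tail {w = []} _ = tt
rowWeak-tail {w = y ∷ w} (_ , r) = r

-- The one danger is a pair of neighbours i+1 of which only the right one is lowered. A lowered
-- letter leaves the counter at 0, so its left neighbour is lowered as well.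
rowWeak-E : ∀ i c w → RowWeak w → RowWeak (E i c w)
rowWeak-E i c [] _ = tt
rowWeak-E i c (x ∷ []) _ = tt
rowWeak-E i c (x ∷ y ∷ w) (x≤y , r) = le , rowWeak-E i c (y ∷ w) r
  where
  le : letter (cls i x) i x (φ i c (y ∷ w)) ≤ letter (cls i y) i y (φ i c w)
  le with letter (cls i y) i y (φ i c w) | letterView i y (φ i c w)
  ... | .y | kept _ = ≤-trans (letter-≤ i x (φ i c (y ∷ w))) x≤y
  ... | .i | lowered refl e with letter (cls i x) i x (φ i c (y ∷ w)) | letterView i x (φ i c (y ∷ w))
  ...   | .i | lowered _ _ = ≤-refl
  ...   | .x | kept f with m≤n⇒m<n∨m≡n x≤y
  ...     | inj₁ (s≤s p) = p
  ...     | inj₂ refl = ⊥-elim (<-irrefl (sym (φ-lowered i c w e)) (f refl))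

φ-≥ : ∀ i C w → RowWeak w → (∀ y → L.head w ≡ just y → 2 + i ≤ y) → φ i C w ≡ C
φ-≥ i C [] _ _ = refl
φ-≥ i C (y ∷ []) _ h rewrite cls-≥ i y (h y refl) = refl
φ-≥ i C (y ∷ y' ∷ w) (p , r) h =
  trans (cong (λ k → nextCount k (φ i C (y' ∷ w))) (cls-≥ i y (h y refl)))
      (φ-≥ i C (y' ∷ w) r λ { .y' refl → ≤-trans (h y refl) p })

-- Each i+1 of the lower row stands under an i of the upper row, so whatever the former take from
-- `C` is balanced by what the latter contribute. Larger letters leave the counter alone.
φ-under : ∀ i c C xs ys → RowWeak (i ∷ xs) → RowWeak (suc i ∷ ys) → ColStrict xs ys → C ≤ φ i C ys + φ i c xs
φ-under i c C xs [] _ _ _ = m≤m+n C _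
φ-under i c C (x ∷ xs) (y ∷ ys) (i≤x , rx) (i<y , ry) (x<y , cs) with m≤n⇒m<n∨m≡n i<y
... | inj₁ p = ≤-trans (≤-reflexive (sym (φ-≥ i C (y ∷ ys) ry λ { .y refl → p }))) (m≤m+n _ _)
... | inj₂ refl with ≤-antisym i≤x (≤-pred x<y)
...   | refl rewrite cls-hi i | cls-lo i =
  ≤-trans (φ-under i c C xs ys rx ry cs) (pred-suc (φ i C ys) (φ i c xs))
  where
  pred-suc : ∀ a b → a + b ≤ pred a + suc b
  pred-suc zero b = n≤1+n b
  pred-suc (suc a) b = ≤-reflexive (sym (+-suc a b))

-- `C` stands for the final counter of the whole row. To the left of a letter at most i there are
-- only such letters, so from there the counter can only grow towards `C`; to the right of an i+1 it
-- may be larger.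
Covered : ℕ → ℕ → List ℕ → ℕ → Set
Covered i c [] C = ⊤
Covered i c (x ∷ xs) C = x ≤ i → φ i c (x ∷ xs) ≤ C

φ-∷-≤ : ∀ i c x w → x ≤ i → φ i c w ≤ φ i c (x ∷ w)
φ-∷-≤ i c x w x≤i with cls i x in eq
... | lo = n≤1+n _
... | neither = ≤-refl
... | hi = ⊥-elim (<-irrefl refl (≤-trans (≤-reflexive (sym (hi⇒≡ i x eq))) x≤i))

covered-tail : ∀ i c x xs C → RowWeak (x ∷ xs) → Covered i c (x ∷ xs) C → Covered i c xs C
covered-tail i c x [] C _ _ = tt
covered-tail i c x (x' ∷ xs) C (x≤x' , _) h x'≤i =
  ≤-trans (φ-∷-≤ i c x (x' ∷ xs) (≤-trans x≤x' x'≤i)) (h (≤-trans x≤x' x'≤i))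

-- Only a lowered i+1 under an i could violate strictness. Its counter is 0, so `φ-under` bounds `C`
-- by the counter just right of the upper i, whereas that i alone pushes the counter one higher and
-- still within `C`.
colStrict-E : ∀ i c C xs ys → RowWeak xs → RowWeak ys → Covered i c xs C → ColStrict xs ys →
  ColStrict (E i c xs) (E i C ys)
colStrict-E i c C xs [] _ _ _ _ = tt
colStrict-E i c C (x ∷ xs) (y ∷ ys) rx ry h (x<y , cs) =
  lt , colStrict-E i c C xs ys (rowWeak-tail {x} {xs} rx) (rowWeak-tail {y} {ys} ry) (covered-tail i c x xs C rx h) cs
  where
  lt : letter (cls i x) i x (φ i c xs) < letter (cls i y) i y (φ i C ys)
  lt with letter (cls i y) i y (φ i C ys) | letterView i y (φ i C ys)
  ... | .y | kept _ = ≤-trans (s≤s (letter-≤ i x (φ i c xs))) x<y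
  ... | .i | lowered refl e with m≤n⇒m<n∨m≡n (≤-pred x<y)
  ...   | inj₁ x<i = ≤-trans (s≤s (letter-≤ i x (φ i c xs))) x<i
  ...   | inj₂ refl = ⊥-elim (1+n≰n (≤-trans (h' (h ≤-refl)) (≤-trans (φ-under i c C xs ys rx ry cs)
                        (≤-reflexive (cong (_+ φ i c xs) e)))))
    where
    h' : φ i c (i ∷ xs) ≤ C → suc (φ i c xs) ≤ C
    h' p = ≤-trans (≤-reflexive (sym (cong (λ k → nextCount k (φ i c xs)) (cls-lo i)))) p

covered-self : ∀ i c xs → Covered i c xs (φ i c xs)
covered-self i c [] = tt
covered-self i c (x ∷ xs) _ = ≤-refl

colsOK-raiseRows : ∀ {n} i c (T : Vec (List ℕ) n) → (∀ j → RowWeak (lookup T j)) → ColsOK T → ColsOK (raiseRows i c T)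
colsOK-raiseRows i c [] _ _ = tt
colsOK-raiseRows i c (a ∷ []) _ _ = tt
colsOK-raiseRows i c (a ∷ b ∷ T) rw (cs , ok) =
  colStrict-E i c (φ i c a) a b (rw F.zero) (rw (F.suc F.zero)) (covered-self i c a) cs ,
  colsOK-raiseRows i (φ i c a) (b ∷ T) (rw ∘ F.suc) ok

rowWeak-raiseRows : ∀ {n} i c (T : Vec (List ℕ) n) → (∀ j → RowWeak (lookup T j)) → ∀ j → RowWeak (lookup (raiseRows i c T) j)
rowWeak-raiseRows i c (a ∷ T) rw F.zero = rowWeak-E i c a (rw F.zero)
rowWeak-raiseRows i c (a ∷ T) rw (F.suc j) = rowWeak-raiseRows i (φ i c a) T (rw ∘ F.suc) j

InRange : ℕ → List ℕ → Set
InRange r = All (λ x → 1 ≤ x × x ≤ r)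

inRange-E : ∀ {r i} → 1 ≤ i → ∀ c w → InRange r w → InRange r (E i c w)
inRange-E p c [] [] = []
inRange-E {r} {i} p c (x ∷ w) ((1≤x , x≤r) ∷ a) = (lb , ≤-trans (letter-≤ i x (φ i c w)) x≤r) ∷ inRange-E p c w a
  where
  lb : 1 ≤ letter (cls i x) i x (φ i c w)
  lb with letter (cls i x) i x (φ i c w) | letterView i x (φ i c w)
  ... | .i | lowered _ _ = p
  ... | .x | kept _ = 1≤x

inRange-raiseRows : ∀ {n r i} → 1 ≤ i → ∀ c (T : Vec (List ℕ) n) →
  (∀ j → InRange r (lookup T j)) → ∀ j → InRange r (lookup (raiseRows i c T) j)
inRange-raiseRows p c (a ∷ T) h F.zero = inRange-E p c a (h F.zero)
inRange-raiseRows {i = i} p c (a ∷ T) h (F.suc j) = inRange-raiseRows p (φ i c a) T (h ∘ F.suc) j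

inB-raiseRows : ∀ {r} (lam : Vec ℕ r) {i} → 1 ≤ i → (T : Tab r) → InB lam T → InB lam (raiseRows i 0 T)
inB-raiseRows lam {i} p T (l , rg , rw , ok) =
  (λ j → trans (raiseRows-shape i 0 T j) (l j)) , inRange-raiseRows p 0 T rg ,
  rowWeak-raiseRows i 0 T rw , colsOK-raiseRows i 0 T rw ok

inB-raiseTab : ∀ {r} (lam : Vec ℕ r) k {i} → 1 ≤ i → (T : Tab r) → InB lam T → InB lam (raiseTab i k T)
inB-raiseTab lam zero p T b = b
inB-raiseTab lam (suc k) {i} p T b = inB-raiseTab lam k (s≤s z≤n) (raiseRows i 0 T) (inB-raiseRows lam p T b)

-- Recognising the highest weight tableau

AtLeast : ℕ → List ℕ → Set
AtLeast t = All (t ≤_)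

-- By induction the rest of the row consists of letters t. A first letter i+1 above t would have
-- nothing to its right, because of weak increase, and hence would be unmatched.
highest-row : ∀ t r w → AtLeast t w → All (_≤ r) w → RowWeak w → (∀ i → t ≤ i → i < r → ε₀ i w ≡ 0) →
  w ≡ replicate (length w) t
highest-row t r [] _ _ _ _ = refl
highest-row t r (x ∷ w) (t≤x ∷ al) (x≤r ∷ ar) rw H = cong₂ _∷_ x≡t IH
  where
  IH : w ≡ replicate (length w) t
  IH = highest-row t r w al ar (rowWeak-tail {x} {w} rw)
         λ i p q → m+n≡0⇒n≡0 (hits (cls i x) (φ₀ i w)) (H i p q)
  x≡t : x ≡ t
  x≡t with m≤n⇒m<n∨m≡n t≤x
  ... | inj₂ e = sym e
  x≡t | inj₁ (s≤s {n = i} t≤i) = ⊥-elim (bad w IH rw (H i t≤i x≤r))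
    where
    bad : ∀ w → w ≡ replicate (length w) t → RowWeak (suc i ∷ w) → ε₀ i (suc i ∷ w) ≡ 0 → ⊥
    bad [] _ _ e rewrite cls-hi i = contradiction e (λ ())
    bad (y ∷ w) e (p , _) _ rewrite LP.∷-injectiveˡ e = <-irrefl refl (≤-trans p t≤i)

φ-replicate : ∀ i k t → t < i → φ₀ i (replicate k t) ≡ 0
φ-replicate i zero t _ = refl
φ-replicate i (suc k) t p rewrite cls-< i t p = φ-replicate i k t p

atLeast-below : ∀ t xs ys → AtLeast t xs → ColStrict xs ys → AtLeast (suc t) ys
atLeast-below t xs [] _ _ = []
atLeast-below t (x ∷ xs) (y ∷ ys) (p ∷ a) (q , cs) = ≤-trans (s≤s p) q ∷ atLeast-below t xs ys a cs

-- A top row consisting of t leaves no unmatched i for i > t. The rows below it are therefore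
-- highest by themselves, and column strictness raises their lower bound to t+1.
highest-rows : ∀ {n} t r (T : Vec (List ℕ) n) → (∀ a rows → V.toList T ≡ a ∷ rows → AtLeast t a) →
  (∀ j → All (_≤ r) (lookup T j)) → (∀ j → RowWeak (lookup T j)) → ColsOK T →
  (∀ i → t ≤ i → i < r → ε₀ i (readWord T) ≡ 0) →
  ∀ j → lookup T j ≡ replicate (length (lookup T j)) (t + toℕ j)
highest-rows t r (a ∷ T) al ar rw ok H = go
  where
  row : a ≡ replicate (length a) t
  row = highest-row t r a (al a _ refl) (ar F.zero) (rw F.zero)
          λ i p q → m+n≡0⇒n≡0 (ε i (φ₀ i a) (readWord T)) (trans (sym (ε-++ i 0 (readWord T) a)) (H i p q))
  below : ∀ {n} (T : Vec (List ℕ) n) → ColsOK (a ∷ T) → ∀ b rows → V.toList T ≡ b ∷ rows → AtLeast (suc t) b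
  below (b ∷ T) (cs , _) .b _ refl = atLeast-below t a b (al a _ refl) cs
  ok-tail : ∀ {n} (T : Vec (List ℕ) n) → ColsOK (a ∷ T) → ColsOK T
  ok-tail [] _ = tt
  ok-tail (b ∷ T) (_ , ok) = ok
  go : ∀ j → lookup (a ∷ T) j ≡ replicate (length (lookup (a ∷ T) j)) (t + toℕ j)
  go F.zero = trans row (cong (replicate (length a)) (sym (+-identityʳ t)))
  go (F.suc j) = trans
    (highest-rows (suc t) r T (below T ok) (ar ∘ F.suc) (rw ∘ F.suc) (ok-tail T ok)
      (λ i p q → m+n≡0⇒m≡0 _ (trans (cong (λ z → ε i z (readWord T) + ε₀ i a)
           (sym (trans (cong (φ₀ i) row) (φ-replicate i (length a) t p))))
         (trans (sym (ε-++ i 0 (readWord T) a)) (H i (<⇒≤ p) q)))) j)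
    (cong (replicate (length (lookup T j))) (sym (+-suc t (toℕ j))))

highest⇒vhw : ∀ {r} (lam : Vec ℕ r) (T : Tab r) → InB lam T → Highest 1 r (readWord T) → T ≡ vhw lam
highest⇒vhw {r} lam T (l , rg , rw , ok) H = trans (sym (VP.tabulate∘lookup T))
  (VP.tabulate-cong λ j → trans (rows j) (cong (λ k → replicate k (suc (toℕ j))) (l j)))
  where
  first-row : ∀ {n} (T : Vec (List ℕ) n) → (∀ j → InRange r (lookup T j)) → ∀ a rows → V.toList T ≡ a ∷ rows → AtLeast 1 a
  first-row (a ∷ T) rg .a _ refl = All.map proj₁ (rg F.zero)
  rows = highest-rows 1 r T (first-row T rg) (λ j → All.map proj₂ (rg j)) rw ok H

count-++ : ∀ x w u → count x (w ++ u) ≡ count x w + count x u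
count-++ x [] u = refl
count-++ x (y ∷ w) u = trans (cong ((if x ≡ᵇ y then 1 else 0) +_) (count-++ x w u))
  (sym (+-assoc (if x ≡ᵇ y then 1 else 0) (count x w) (count x u)))

count-replicate : ∀ k x → count x (replicate k x) ≡ k
count-replicate zero x = refl
count-replicate (suc k) x rewrite ≡ᵇ-yes {x} refl = cong suc (count-replicate k x)

count-replicate-≢ : ∀ k x y → x ≢ y → count x (replicate k y) ≡ 0
count-replicate-≢ zero x y ne = refl
count-replicate-≢ (suc k) x y ne rewrite ≡ᵇ-no ne = count-replicate-≢ k x y ne

count-constant-rows : ∀ {n} t (lam : Vec ℕ n) (T : Vec (List ℕ) n) →
  (∀ j → lookup T j ≡ replicate (lookup lam j) (t + toℕ j)) →
  (∀ x → x < t → count x (readWord T) ≡ 0) × (∀ p → count (t + toℕ p) (readWord T) ≡ lookup lam p)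
count-constant-rows t [] [] _ = (λ _ _ → refl) , λ ()
count-constant-rows t (a ∷ lam) (row ∷ T) h = below , at
  where
  IH = count-constant-rows (suc t) lam T λ j → trans (h (F.suc j)) (cong (replicate (lookup lam j)) (+-suc t (toℕ j)))
  row≡ : row ≡ replicate a t
  row≡ = trans (h F.zero) (cong (replicate a) (+-identityʳ t))
  below : ∀ x → x < t → count x (readWord T ++ row) ≡ 0
  below x p = trans (count-++ x (readWord T) row) (cong₂ _+_ (proj₁ IH x (m≤n⇒m≤1+n p))
    (trans (cong (count x) row≡) (count-replicate-≢ a x t (<⇒≢ p))))
  at : ∀ p → count (t + toℕ p) (readWord T ++ row) ≡ lookup (a ∷ lam) p
  at F.zero rewrite +-identityʳ t = trans (count-++ t (readWord T) row) (cong₂ _+_ (proj₁ IH t ≤-refl)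
    (trans (cong (count t) row≡) (count-replicate a t)))
  at (F.suc p) rewrite +-suc t (toℕ p) = trans (count-++ _ (readWord T) row) (trans (cong₂ _+_ (proj₂ IH p)
    (trans (cong (count _) row≡) (count-replicate-≢ a _ t (<⇒≢ (s≤s (m≤m+n t (toℕ p))) ∘ sym)))) (+-identityʳ _))

count-vhw : ∀ {r} (lam : Vec ℕ r) p → count (suc (toℕ p)) (readWord (vhw lam)) ≡ lookup lam p
count-vhw lam = proj₂ (count-constant-rows 1 lam (vhw lam) (λ j → VP.lookup∘tabulate _ j))

raiseAllTab : ∀ {r} → ℕ → ℕ → Tab r → Tab r
raiseAllTab zero m T = T
raiseAllTab (suc j) m T = raiseAllTab j (suc m) (raiseTab (suc j) m T)

readWord-raiseAllTab : ∀ {r} j m (T : Tab r) → readWord (raiseAllTab j m T) ≡ raiseAll j m (readWord T)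
readWord-raiseAllTab zero m T = refl
readWord-raiseAllTab (suc j) m T = trans (readWord-raiseAllTab j (suc m) (raiseTab (suc j) m T))
  (cong (raiseAll j (suc m)) (readWord-raiseTab (suc j) m T))

inB-raiseAllTab : ∀ {r} (lam : Vec ℕ r) j m (T : Tab r) → InB lam T → InB lam (raiseAllTab j m T)
inB-raiseAllTab lam zero m T b = b
inB-raiseAllTab lam (suc j) m T b = inB-raiseAllTab lam j (suc m) (raiseTab (suc j) m T) (inB-raiseTab lam m (s≤s z≤n) T b)

highest-vacuous : ∀ r w → Highest (suc r) (r + 0) w
highest-vacuous r w j p q = ⊥-elim (<-irrefl refl (≤-trans q (≤-trans (≤-reflexive (+-identityʳ r)) (<⇒≤ p))))

raiseAllTab≡vhw : ∀ {r} (lam : Vec ℕ r) (T : Tab r) → InB lam T → raiseAllTab r 0 T ≡ vhw lam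
raiseAllTab≡vhw {r} lam T b = highest⇒vhw lam (raiseAllTab r 0 T) (inB-raiseAllTab lam r 0 T b)
  (subst₂ (λ u w → Highest 1 u w) (+-identityʳ r) (sym (readWord-raiseAllTab r 0 T))
    (raiseAll-highest r 0 (readWord T) (highest-vacuous r (readWord T))))

raiseAll≡vhw : ∀ {r} (lam : Vec ℕ r) (T : Tab r) → InB lam T → raiseAll r 0 (readWord T) ≡ readWord (vhw lam)
raiseAll≡vhw {r} lam T b = trans (sym (readWord-raiseAllTab r 0 T)) (cong readWord (raiseAllTab≡vhw lam T b))

-- Permutations, length and Bruhat order

swap : ℕ → ℕ → ℕ → ℕ
swap a b k = if k ≡ᵇ a then b else (if k ≡ᵇ b then a else k)

swap-a : ∀ a b → swap a b a ≡ b
swap-a a b rewrite ≡ᵇ-yes {a} refl = refl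

swap-b : ∀ a b → swap a b b ≡ a
swap-b a b with b ≟ a
... | yes refl rewrite ≡ᵇ-yes {a} refl = refl
... | no ne rewrite ≡ᵇ-no ne | ≡ᵇ-yes {b} refl = refl

swap-other : ∀ a b k → k ≢ a → k ≢ b → swap a b k ≡ k
swap-other a b k p q rewrite ≡ᵇ-no p | ≡ᵇ-no q = refl

swap-sym : ∀ a b k → swap a b k ≡ swap b a k
swap-sym a b k with k ≟ a | k ≟ b
... | yes refl | _ = trans (swap-a k b) (sym (swap-b b k))
... | no _ | yes refl = trans (swap-b a k) (sym (swap-a k a))
... | no p | no q = trans (swap-other a b k p q) (sym (swap-other b a k q p))

swap-involutive : ∀ a b k → swap a b (swap a b k) ≡ k
swap-involutive a b k with k ≟ a | k ≟ b
... | yes refl | _ = trans (cong (swap k b) (swap-a k b)) (swap-b k b)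
... | no _ | yes refl = trans (cong (swap a k) (swap-b a k)) (swap-a a k)
... | no p | no q = trans (cong (swap a b) (swap-other a b k p q)) (swap-other a b k p q)

swap-< : ∀ {r a b k} → a < r → b < r → k < r → swap a b k < r
swap-< {r} {a} {b} {k} p q l with k ≟ a | k ≟ b
... | yes refl | _ = subst (_< r) (sym (swap-a k b)) q
... | no _ | yes refl = subst (_< r) (sym (swap-b a k)) p
... | no x | no y = subst (_< r) (sym (swap-other a b k x y)) l

swap-suc : ∀ a b k → swap (suc a) (suc b) (suc k) ≡ suc (swap a b k)
swap-suc a b k with k ≡ᵇ a | k ≡ᵇ b
... | true | _ = refl
... | false | true = refl
... | false | false = refl

swap-order : ∀ q x y → ¬ (x ≡ q × y ≡ suc q) → ¬ (x ≡ suc q × y ≡ q) →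
  (swap q (suc q) x <ᵇ swap q (suc q) y) ≡ (x <ᵇ y)
swap-order zero zero zero _ _ = refl
swap-order zero zero (suc zero) p _ = ⊥-elim (p (refl , refl))
swap-order zero zero (suc (suc y)) _ _ = refl
swap-order zero (suc zero) zero _ p = ⊥-elim (p (refl , refl))
swap-order zero (suc zero) (suc zero) _ _ = refl
swap-order zero (suc zero) (suc (suc y)) _ _ = refl
swap-order zero (suc (suc x)) zero _ _ = refl
swap-order zero (suc (suc x)) (suc zero) _ _ = refl
swap-order zero (suc (suc x)) (suc (suc y)) _ _ = refl
swap-order (suc q) zero zero _ _ = refl
swap-order (suc q) zero (suc y) _ _ rewrite swap-suc q (suc q) y = refl
swap-order (suc q) (suc x) zero _ _ = refl
swap-order (suc q) (suc x) (suc y) p p' rewrite swap-suc q (suc q) x | swap-suc q (suc q) y =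
  swap-order q x y (λ { (refl , refl) → p (refl , refl) }) (λ { (refl , refl) → p' (refl , refl) })

<ᵇ-yes : ∀ {m n} → m < n → (m <ᵇ n) ≡ true
<ᵇ-yes p = Equivalence.to T-≡ (<⇒<ᵇ p)

<ᵇ-no : ∀ {m n} → ¬ m < n → (m <ᵇ n) ≡ false
<ᵇ-no {m} {n} ne with m <ᵇ n in eq
... | false = refl
... | true = contradiction (<ᵇ⇒< m n (Equivalence.from T-≡ eq)) ne

<ᵇ-true⇒< : ∀ {m n} → (m <ᵇ n) ≡ true → m < n
<ᵇ-true⇒< {m} {n} e = <ᵇ⇒< m n (Equivalence.from T-≡ e)

swap-mono : ∀ q {x y} → x < y → ¬ (x ≡ q × y ≡ suc q) → swap q (suc q) x < swap q (suc q) y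
swap-mono q {x} {y} p ne = <ᵇ-true⇒< (trans
  (swap-order q x y ne (λ { (refl , refl) → <-irrefl refl (m≤n⇒m≤1+n p) })) (<ᵇ-yes p))

srt-swap : ∀ q g → g q < g (suc q) → srt q g ≗ g ∘ swap q (suc q)
srt-swap q g p k with cls q k in eq
... | lo rewrite lo⇒≡ q k eq | swap-a q (suc q) = m≤n⇒m⊔n≡n (<⇒≤ p)
... | hi rewrite hi⇒≡ q k eq | swap-b q (suc q) = m≤n⇒m⊓n≡m (<⇒≤ p)
... | neither = sym (cong g (swap-other q (suc q) k
        (neither⇒≢lo eq)
        (neither⇒≢hi eq)))

srt-fixed : ∀ q g → g (suc q) ≤ g q → srt q g ≗ g
srt-fixed q g p k with cls q k in eq
... | lo rewrite lo⇒≡ q k eq = m≥n⇒m⊔n≡m p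
... | hi rewrite hi⇒≡ q k eq = m≥n⇒m⊓n≡n p
... | neither = refl

-- π⁻¹ as a function on ℕ, extended by the identity outside [0,r).
pos : ∀ {r} → Perm r → ℕ → ℕ
pos {r} π k with k <? r
... | yes p = toℕ (π ⟨$⟩ˡ fromℕ< p)
... | no _ = k

pos-toℕ : ∀ {r} (π : Perm r) a → pos π (toℕ a) ≡ toℕ (π ⟨$⟩ˡ a)
pos-toℕ {r} π a with toℕ a <? r
... | yes p = cong (λ b → toℕ (π ⟨$⟩ˡ b)) (FP.fromℕ<-toℕ a p)
... | no np = ⊥-elim (np (FP.toℕ<n a))

pos-outside : ∀ {r} (π : Perm r) k → r ≤ k → pos π k ≡ k
pos-outside {r} π k p with k <? r
... | yes q = ⊥-elim (<-irrefl refl (≤-trans q p))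
... | no _ = refl

pos-< : ∀ {r} (π : Perm r) {k} → k < r → pos π k < r
pos-< {r} π {k} p with k <? r
... | yes q = FP.toℕ<n (π ⟨$⟩ˡ fromℕ< q)
... | no np = ⊥-elim (np p)

pos-ext : ∀ {r} (f g : ℕ → ℕ) → (∀ k → r ≤ k → f k ≡ g k) → (∀ (a : Fin r) → f (toℕ a) ≡ g (toℕ a)) → f ≗ g
pos-ext {r} f g out inn k with k <? r
... | yes p = subst (λ x → f x ≡ g x) (FP.toℕ-fromℕ< p) (inn (fromℕ< p))
... | no np = out k (≮⇒≥ np)

⟨$⟩ˡ-cong : ∀ {r} (π σ : Perm r) → π ≈ σ → ∀ i → π ⟨$⟩ˡ i ≡ σ ⟨$⟩ˡ i
⟨$⟩ˡ-cong π σ e i = trans (sym (P.inverseˡ σ)) (cong (σ ⟨$⟩ˡ_) (trans (sym (e (π ⟨$⟩ˡ i))) (P.inverseʳ π)))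

pos-cong : ∀ {r} (π σ : Perm r) → π ≈ σ → pos π ≗ pos σ
pos-cong π σ e = pos-ext (pos π) (pos σ) (λ k p → trans (pos-outside π k p) (sym (pos-outside σ k p)))
  λ a → trans (pos-toℕ π a) (trans (cong toℕ (⟨$⟩ˡ-cong π σ e a)) (sym (pos-toℕ σ a)))

pos⇒≈ : ∀ {r} {π σ : Perm r} → (∀ (a : Fin r) → pos π (toℕ a) ≡ pos σ (toℕ a)) → π ≈ σ
pos⇒≈ {π = π} {σ} e i = trans (sym (P.inverseʳ σ)) (cong (σ ⟨$⟩ʳ_) (trans (sym (FP.toℕ-injective
  (trans (sym (pos-toℕ π (π ⟨$⟩ʳ i))) (trans (e (π ⟨$⟩ʳ i)) (pos-toℕ σ (π ⟨$⟩ʳ i)))))) (P.inverseˡ π)))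

pos-injective : ∀ {r} (π : Perm r) {x y} → x < r → y < r → pos π x ≡ pos π y → x ≡ y
pos-injective {r} π {x} {y} p q e = trans (sym (FP.toℕ-fromℕ< p)) (trans (cong toℕ a≡b) (FP.toℕ-fromℕ< q))
  where
  a = fromℕ< p
  b = fromℕ< q
  a≡b : a ≡ b
  a≡b = trans (sym (P.inverseʳ π)) (trans (cong (π ⟨$⟩ʳ_) (FP.toℕ-injective
    (trans (sym (pos-toℕ π a)) (trans (cong (pos π) (FP.toℕ-fromℕ< p)) (trans e (trans (cong (pos π) (sym (FP.toℕ-fromℕ< q))) (pos-toℕ π b)))))))
    (P.inverseʳ π))

toℕ-transpose : ∀ {r} (a b k : Fin r) → toℕ (PC.transpose a b k) ≡ swap (toℕ a) (toℕ b) (toℕ k)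
toℕ-transpose a b k with k FP.≟ a
... | yes refl = sym (swap-a (toℕ k) (toℕ b))
... | no p with k FP.≟ b
...   | yes refl = sym (swap-b (toℕ a) (toℕ k))
...   | no q = sym (swap-other _ _ _ (p ∘ FP.toℕ-injective) (q ∘ FP.toℕ-injective))

pos-transpose : ∀ {r} (a b : Fin r) π → pos (transpose a b · π) ≗ pos π ∘ swap (toℕ a) (toℕ b)
pos-transpose {r} a b π = pos-ext _ _
  (λ k p → trans (pos-outside (transpose a b · π) k p) (sym (trans (cong (pos π) (swap-other _ _ k
     (λ e → <-irrefl (sym e) (≤-trans (FP.toℕ<n a) p)) (λ e → <-irrefl (sym e) (≤-trans (FP.toℕ<n b) p)))) (pos-outside π k p))))
  λ c → trans (pos-toℕ (transpose a b · π) c) (trans (sym (pos-toℕ π (PC.transpose b a c)))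
     (cong (pos π) (trans (toℕ-transpose b a c) (swap-sym (toℕ b) (toℕ a) (toℕ c)))))

sref-transpose : ∀ {r} q (p : suc q < r) → Σ (Fin r) λ a → Σ (Fin r) λ b →
  toℕ a ≡ q × toℕ b ≡ suc q × sref (suc q) ≡ transpose a b
sref-transpose {r} q p with suc q <? r
... | yes p' = _ , _ , FP.toℕ-fromℕ< _ , FP.toℕ-fromℕ< p' , refl
... | no np = ⊥-elim (np p)

pos-sref : ∀ {r} q → suc q < r → (π : Perm r) → pos (sref (suc q) · π) ≗ pos π ∘ swap q (suc q)
pos-sref q p π k with sref-transpose q p
... | a , b , ea , eb , es rewrite es = trans (pos-transpose a b π k) (cong (pos π) (cong₂ (λ x y → swap x y k) ea eb))

-- Length as a number of inversions

inverted : ℕ → ℕ → ℕ → ℕ → ℕ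
inverted i j x y = if (i <ᵇ j) ∧ (y <ᵇ x) then 1 else 0

inverted-≮ : ∀ {i j} x y → ¬ i < j → inverted i j x y ≡ 0
inverted-≮ x y np rewrite <ᵇ-no np = refl

sum-map-allFin : ∀ {n} (f : Fin n → ℕ) → sum (map f (allFin n)) ≡ ∑ f
sum-map-allFin {n} f = trans (cong sum (LP.map-tabulate (λ i → i) f)) (go n f)
  where
  go : ∀ n (f : Fin n → ℕ) → sum (L.tabulate f) ≡ ∑ f
  go zero f = refl
  go (suc n) f = cong (f F.zero +_) (go n (f ∘ F.suc))

sum-concatMap : ∀ {A B : Set} (f : A → B → ℕ) ys xs →
  sum (concatMap (λ i → map (f i) ys) xs) ≡ sum (map (λ i → sum (map (f i) ys)) xs)
sum-concatMap f ys [] = refl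
sum-concatMap f ys (x ∷ xs) = trans (sum-++ (map (f x) ys) _) (cong (sum (map (f x) ys) +_) (sum-concatMap f ys xs))

inv : ∀ {r} → Perm r → Fin r → Fin r → ℕ
inv π i j = inverted (toℕ i) (toℕ j) (toℕ (π ⟨$⟩ʳ i)) (toℕ (π ⟨$⟩ʳ j))

len-∑ : ∀ {r} (π : Perm r) → len π ≡ ∑ λ i → ∑ λ j → inv π i j
len-∑ {r} π = trans (sum-concatMap (inv π) (allFin r) (allFin r))
  (trans (sum-map-allFin (λ i → sum (map (inv π i) (allFin r)))) (sum-cong-≗ (λ i → sum-map-allFin (inv π i))))

len-cong : ∀ {r} (π σ : Perm r) → π ≈ σ → len π ≡ len σ
len-cong π σ e = trans (len-∑ π) (trans
  (sum-cong-≗ λ i → sum-cong-≗ λ j → cong₂ (λ a b → inverted (toℕ i) (toℕ j) (toℕ a) (toℕ b)) (e i) (e j))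
  (sym (len-∑ σ)))

δ : ∀ {n} → Fin n → Fin n → ℕ
δ p i = if does (i FP.≟ p) then 1 else 0

∑-δ : ∀ {n} (p : Fin n) → ∑ (δ p) ≡ 1
∑-δ {suc n} F.zero = cong suc (sum-replicate-zero n)
∑-δ {suc n} (F.suc p) = ∑-δ p

∑-* : ∀ {n} c (g : Fin n → ℕ) → ∑ (λ i → c * g i) ≡ c * ∑ g
∑-* {zero} c g = sym (*-zeroʳ c)
∑-* {suc n} c g = trans (cong (c * g F.zero +_) (∑-* c (g ∘ F.suc))) (sym (*-distribˡ-+ c (g F.zero) _))

module _ {r : ℕ} (q : ℕ) (q<r : suc q < r) (π : Perm r) (asc : pos π q < pos π (suc q)) where
  private
    s : Perm r
    s = sref (suc q)
    lower upper : Fin r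
    lower = proj₁ (sref-transpose q q<r)
    upper = proj₁ (proj₂ (sref-transpose q q<r))
    lower≡ : toℕ lower ≡ q
    lower≡ = proj₁ (proj₂ (proj₂ (sref-transpose q q<r)))
    upper≡ : toℕ upper ≡ suc q
    upper≡ = proj₁ (proj₂ (proj₂ (proj₂ (sref-transpose q q<r))))
    s≡ : s ≡ transpose lower upper
    s≡ = proj₂ (proj₂ (proj₂ (proj₂ (sref-transpose q q<r))))
    i₀ = π ⟨$⟩ˡ lower
    j₀ = π ⟨$⟩ˡ upper

    at : ∀ i {k} c → toℕ c ≡ k → toℕ (π ⟨$⟩ʳ i) ≡ k → i ≡ π ⟨$⟩ˡ c
    at i c e e' = trans (sym (P.inverseˡ π)) (cong (π ⟨$⟩ˡ_) (FP.toℕ-injective (trans e' (sym e))))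

    i₀<j₀ : toℕ i₀ < toℕ j₀
    i₀<j₀ = subst₂ _<_ (trans (cong (pos π) (sym lower≡)) (pos-toℕ π lower)) (trans (cong (pos π) (sym upper≡)) (pos-toℕ π upper)) asc

    value : ∀ i → toℕ ((s · π) ⟨$⟩ʳ i) ≡ swap q (suc q) (toℕ (π ⟨$⟩ʳ i))
    value i = trans (cong (λ τ → toℕ (τ ⟨$⟩ʳ (π ⟨$⟩ʳ i))) s≡)
      (trans (toℕ-transpose lower upper (π ⟨$⟩ʳ i)) (cong₂ (λ x y → swap x y (toℕ (π ⟨$⟩ʳ i))) lower≡ upper≡))

    same : ∀ i j → ¬ (i ≡ i₀ × j ≡ j₀) → inv (s · π) i j ≡ inv π i j
    same i j ne with toℕ i <? toℕ j
    ... | no np = trans (inverted-≮ (toℕ ((s · π) ⟨$⟩ʳ i)) (toℕ ((s · π) ⟨$⟩ʳ j)) np) (sym (inverted-≮ (toℕ (π ⟨$⟩ʳ i)) (toℕ (π ⟨$⟩ʳ j)) np))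
    ... | yes p = trans (cong₂ (inverted (toℕ i) (toℕ j)) (value i) (value j))
      (cong (λ b → if (toℕ i <ᵇ toℕ j) ∧ b then 1 else 0) (swap-order q (toℕ (π ⟨$⟩ʳ j)) (toℕ (π ⟨$⟩ʳ i))
        (λ (e , e') → <-irrefl refl (<-trans i₀<j₀ (subst₂ (λ a b → toℕ a < toℕ b) (at i upper upper≡ e') (at j lower lower≡ e) p)))
        (λ (e , e') → ne (at i lower lower≡ e' , at j upper upper≡ e))))

    changed : inv (s · π) i₀ j₀ ≡ suc (inv π i₀ j₀)
    changed = trans
      (trans (cong₂ (inverted (toℕ i₀) (toℕ j₀))
               (trans (value i₀) (trans (cong (swap q (suc q)) at-lower) (swap-a q (suc q))))
               (trans (value j₀) (trans (cong (swap q (suc q)) at-upper) (swap-b q (suc q)))))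
             (cong₂ (λ b c → if b ∧ c then 1 else 0) (<ᵇ-yes i₀<j₀) (<ᵇ-yes (n<1+n q))))
      (cong suc (sym (trans (cong₂ (inverted (toℕ i₀) (toℕ j₀)) at-lower at-upper)
        (cong₂ (λ b c → if b ∧ c then 1 else 0) (<ᵇ-yes i₀<j₀) (<ᵇ-no {suc q} {q} (λ p → <-irrefl refl (<-trans p (n<1+n q))))))))
      where
      at-lower : toℕ (π ⟨$⟩ʳ i₀) ≡ q
      at-lower = trans (cong toℕ (P.inverseʳ π)) lower≡
      at-upper : toℕ (π ⟨$⟩ʳ j₀) ≡ suc q
      at-upper = trans (cong toℕ (P.inverseʳ π)) upper≡

    pointwise : ∀ i j → inv (s · π) i j ≡ inv π i j + δ i₀ i * δ j₀ j
    pointwise i j with i FP.≟ i₀ | j FP.≟ j₀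
    ... | yes i≡ | yes j≡ = trans (cong₂ (inv (s · π)) i≡ j≡) (trans changed
      (trans (sym (+-comm _ 1)) (cong (_+ 1) (sym (cong₂ (inv π) i≡ j≡)))))
    ... | yes _ | no ne = trans (same i j (ne ∘ proj₂)) (sym (+-identityʳ _))
    ... | no ne | _ = trans (same i j (ne ∘ proj₁)) (sym (+-identityʳ _))

  -- Exchanging the values q and q+1 changes the relative order of one pair of positions only,
  -- namely those carrying these values. The double sum grows by the indicator of that pair.
  len-sref-ascent : len (sref (suc q) · π) ≡ suc (len π)
  len-sref-ascent = begin
    len (s · π)
      ≡⟨ len-∑ (s · π) ⟩
    ∑ (λ i → ∑ λ j → inv (s · π) i j)
      ≡⟨ sum-cong-≗ (λ i → trans (sum-cong-≗ (pointwise i)) (∑-distrib-+ (inv π i) (λ j → δ i₀ i * δ j₀ j))) ⟩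
    ∑ (λ i → ∑ (inv π i) + ∑ (λ j → δ i₀ i * δ j₀ j))
      ≡⟨ ∑-distrib-+ (λ i → ∑ (inv π i)) _ ⟩
    ∑ (λ i → ∑ (inv π i)) + ∑ (λ i → ∑ (λ j → δ i₀ i * δ j₀ j))
      ≡⟨ cong₂ _+_ (sym (len-∑ π)) (trans (sum-cong-≗ (λ i → trans (∑-* (δ i₀ i) (δ j₀)) (trans (cong (δ i₀ i *_) (∑-δ j₀)) (*-identityʳ _)))) (∑-δ i₀)) ⟩
    len π + 1
      ≡⟨ +-comm (len π) 1 ⟩
    suc (len π) ∎
    where open ≡-Reasoning

sref-involutive : ∀ {r} q → suc q < r → (π : Perm r) → sref (suc q) · (sref (suc q) · π) ≈ π
sref-involutive q p π = pos⇒≈ λ a → trans (pos-sref q p (sref (suc q) · π) (toℕ a))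
  (trans (pos-sref q p π (swap q (suc q) (toℕ a))) (cong (pos π) (swap-involutive q (suc q) (toℕ a))))

len-sref-descent : ∀ {r} q → suc q < r → (π : Perm r) → pos π (suc q) < pos π q → suc (len (sref (suc q) · π)) ≡ len π
len-sref-descent q p π d = trans (sym (len-sref-ascent q p (sref (suc q) · π)
    (subst₂ _<_ (sym (trans (pos-sref q p π q) (cong (pos π) (swap-a q (suc q)))))
                (sym (trans (pos-sref q p π (suc q)) (cong (pos π) (swap-b q (suc q))))) d)))
  (len-cong (sref (suc q) · (sref (suc q) · π)) π (sref-involutive q p π))

pos-connex : ∀ {r} (π : Perm r) {x y} → x < r → y < r → x ≢ y → pos π x < pos π y ⊎ pos π y < pos π x
pos-connex π {x} {y} p q ne with <-cmp (pos π x) (pos π y)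
... | tri< l _ _ = inj₁ l
... | tri≈ _ e _ = ⊥-elim (ne (pos-injective π p q e))
... | tri> _ _ g = inj₂ g

-- A reflection is written as a product of simple ones; only the two lengths at its ends matter.
len-transpose-far : ∀ {r} d a b → b ≡ suc (a + d) → b < r → ∀ (π σ : Perm r) → pos σ ≗ pos π ∘ swap a b →
  pos π a < pos π b → len π < len σ
len-transpose-far zero a .(suc (a + 0)) refl b<r π σ e p rewrite +-identityʳ a =
  ≤-reflexive (sym (trans (len-cong σ (sref (suc a) · π) (pos⇒≈ λ c → trans (e (toℕ c)) (sym (pos-sref a b<r π (toℕ c)))))
    (len-sref-ascent a b<r π p)))
len-transpose-far {r} (suc d) a .(suc (a + suc d)) refl b<r π σ e p rewrite +-suc a d = main (pos-connex π b'<r b<r (<⇒≢ ≤-refl))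
  where
  b' = suc (a + d)
  b = suc b'
  b'<r = <⇒≤ b<r
  a<b' : a < b'
  a<b' = s≤s (m≤m+n a d)
  a<r : a < r
  a<r = ≤-trans a<b' (<⇒≤ b'<r)
  π₁ = sref b · π
  π₂ = transpose (fromℕ< a<r) (fromℕ< b'<r) · π₁
  π₃ = sref b · π₂
  pos₁ : pos π₁ ≗ pos π ∘ swap b' b
  pos₁ = pos-sref b' b<r π
  pos₂ : pos π₂ ≗ pos π₁ ∘ swap a b'
  pos₂ k = trans (pos-transpose (fromℕ< a<r) (fromℕ< b'<r) π₁ k)
    (cong (pos π₁) (cong₂ (λ x y → swap x y k) (FP.toℕ-fromℕ< a<r) (FP.toℕ-fromℕ< b'<r)))
  a≢b' = <⇒≢ a<b'
  a≢b = <⇒≢ (<-trans a<b' (n<1+n b'))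
  swap³ : ∀ k → swap b' b (swap a b' (swap b' b k)) ≡ swap a b k
  swap³ k with k ≟ a | k ≟ b' | k ≟ b
  ... | yes refl | _ | _ = trans (cong (swap b' b ∘ swap a b') (swap-other b' b a a≢b' a≢b))
        (trans (cong (swap b' b) (swap-a a b')) (trans (swap-a b' b) (sym (swap-a a b))))
  ... | no _ | yes refl | _ = trans (cong (swap b' b ∘ swap a b') (swap-a b' b))
        (trans (cong (swap b' b) (swap-other a b' b (a≢b ∘ sym) (<⇒≢ ≤-refl ∘ sym)))
          (trans (swap-b b' b) (sym (swap-other a b b' (a≢b' ∘ sym) (<⇒≢ ≤-refl)))))
  ... | no _ | no _ | yes refl = trans (cong (swap b' b ∘ swap a b') (swap-b b' b))
        (trans (cong (swap b' b) (swap-b a b')) (trans (swap-other b' b a a≢b' a≢b) (sym (swap-b a b))))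
  ... | no x | no y | no z = trans (cong (swap b' b ∘ swap a b') (swap-other b' b k y z))
        (trans (cong (swap b' b) (swap-other a b' k x y)) (trans (swap-other b' b k y z) (sym (swap-other a b k x z))))
  len₃ : len π₃ ≡ len σ
  len₃ = len-cong π₃ σ (pos⇒≈ λ c → trans (pos-sref b' b<r π₂ (toℕ c)) (trans (pos₂ (swap b' b (toℕ c)))
    (trans (pos₁ _) (trans (cong (pos π) (swap³ (toℕ c))) (sym (e (toℕ c)))))))
  at-a : pos π₁ a ≡ pos π a
  at-a = trans (pos₁ a) (cong (pos π) (swap-other b' b a a≢b' a≢b))
  at-b' : pos π₁ b' ≡ pos π b
  at-b' = trans (pos₁ b') (cong (pos π) (swap-a b' b))
  len₁₂ : len π₁ < len π₂
  len₁₂ = len-transpose-far d a b' refl b'<r π₁ π₂ pos₂ (subst₂ _<_ (sym at-a) (sym at-b') p)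
  len₂₃ : len π₂ ≤ suc (len π₃)
  len₂₃ with pos-connex π₂ b'<r b<r (<⇒≢ ≤-refl)
  ... | inj₁ q = <⇒≤ (≤-trans (≤-reflexive (sym (len-sref-ascent b' b<r π₂ q))) (n≤1+n _))
  ... | inj₂ q = ≤-reflexive (sym (len-sref-descent b' b<r π₂ q))
  main : pos π b' < pos π b ⊎ pos π b < pos π b' → len π < len σ
  main (inj₁ q) = subst (len π <_) len₃ (≤-pred (≤-trans (s≤s (≤-reflexive (sym (len-sref-ascent b' b<r π q)))) (≤-trans len₁₂ len₂₃)))
  main (inj₂ q) = subst₂ _<_ (len-sref-descent b' b<r π q) (trans (sym (len-sref-ascent b' b<r π₂ asc₂)) len₃) (s≤s len₁₂)
    where
    asc₂ : pos π₂ b' < pos π₂ b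
    asc₂ = subst₂ _<_ (sym (trans (pos₂ b') (trans (cong (pos π₁) (swap-b a b')) at-a)))
      (sym (trans (pos₂ b) (trans (cong (pos π₁) (swap-other a b' b (a≢b ∘ sym) (<⇒≢ ≤-refl ∘ sym)))
        (trans (pos₁ b) (cong (pos π) (swap-b b' b)))))) (<-trans p q)

-- A Bruhat step with the length condition replaced by the order of two inverse values, a form that
-- can be conjugated by a simple reflection.
data Reflects {r} (v w : Perm r) : Set where
  reflection : ∀ a b → a < b → b < r → pos v a < pos v b → pos w ≗ pos v ∘ swap a b → Reflects v w

reflects-len : ∀ {r} {v w : Perm r} → Reflects v w → len v < len w
reflects-len {v = v} {w} (reflection a b a<b b<r p e) =
  len-transpose-far (b ∸ suc a) a b (sym (m+[n∸m]≡n a<b)) b<r v w e p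

≤B-reflects : ∀ {r} {u v w : Perm r} → u ≤B v → Reflects v w → u ≤B w
≤B-reflects {r} {u} {v} {w} h R@(reflection a b a<b b<r p e) =
  ≤B-step h (fromℕ< a<r) (fromℕ< b<r)
    (λ q → <⇒≢ a<b (trans (sym (FP.toℕ-fromℕ< a<r)) (trans (cong toℕ q) (FP.toℕ-fromℕ< b<r))))
    (≤-trans (reflects-len R) (≤-reflexive (len-cong w (transpose (fromℕ< a<r) (fromℕ< b<r) · v) w≈)))
    w≈
  where
  a<r = <-trans a<b b<r
  w≈ : w ≈ transpose (fromℕ< a<r) (fromℕ< b<r) · v
  w≈ = pos⇒≈ λ c → trans (e (toℕ c)) (sym (trans (pos-transpose (fromℕ< a<r) (fromℕ< b<r) v (toℕ c))
    (cong (pos v) (cong₂ (λ x y → swap x y (toℕ c)) (FP.toℕ-fromℕ< a<r) (FP.toℕ-fromℕ< b<r)))))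

-- Were the two inverse values in the wrong order, the same reflection read backwards would lengthen
-- `w` to `v`, against the hypothesis on lengths.
step⇒reflects : ∀ {r} {v w : Perm r} (a b : Fin r) → a ≢ b → len v < len (transpose a b · v) → w ≈ transpose a b · v →
  Reflects v w
step⇒reflects {r} {v} {w} a b ne l e with <-cmp (toℕ a) (toℕ b)
... | tri≈ _ p _ = ⊥-elim (ne (FP.toℕ-injective p))
... | tri< p _ _ = go a b p (λ k → trans (pos-cong w (transpose a b · v) e k) (pos-transpose a b v k))
  where
  go : ∀ a b → toℕ a < toℕ b → pos w ≗ pos v ∘ swap (toℕ a) (toℕ b) → Reflects v w
  go a b p e' with pos-connex v (FP.toℕ<n a) (FP.toℕ<n b) (<⇒≢ p)
  ... | inj₁ q = reflection (toℕ a) (toℕ b) p (FP.toℕ<n b) q e'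
  ... | inj₂ q = ⊥-elim (<-irrefl refl (<-trans (≤-trans l (≤-reflexive (sym (len-cong w (transpose _ _ · v) e))))
    (reflects-len (reflection {v = w} {v} (toℕ a) (toℕ b) p (FP.toℕ<n b)
      (subst₂ _<_ (sym (trans (e' (toℕ a)) (cong (pos v) (swap-a (toℕ a) (toℕ b)))))
                 (sym (trans (e' (toℕ b)) (cong (pos v) (swap-b (toℕ a) (toℕ b))))) q)
      λ k → trans (cong (pos v) (sym (swap-involutive (toℕ a) (toℕ b) k))) (sym (e' (swap (toℕ a) (toℕ b) k)))))))
... | tri> _ _ p with pos-connex v (FP.toℕ<n b) (FP.toℕ<n a) (<⇒≢ p)
...   | inj₁ q = reflection (toℕ b) (toℕ a) p (FP.toℕ<n a) q
  λ k → trans (pos-cong w (transpose a b · v) e k) (trans (pos-transpose a b v k) (cong (pos v) (swap-sym (toℕ a) (toℕ b) k)))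
...   | inj₂ q = ⊥-elim (<-irrefl refl (<-trans l (reflects-len (reflection {v = transpose a b · v} {v} (toℕ b) (toℕ a) p (FP.toℕ<n a)
      (subst₂ _<_ (sym (trans (pos-transpose a b v (toℕ b)) (cong (pos v) (swap-b (toℕ a) (toℕ b)))))
                 (sym (trans (pos-transpose a b v (toℕ a)) (cong (pos v) (swap-a (toℕ a) (toℕ b))))) q)
      λ k → trans (cong (pos v) (sym (trans (cong (swap (toℕ a) (toℕ b)) (swap-sym (toℕ b) (toℕ a) k)) (swap-involutive (toℕ a) (toℕ b) k)))) (sym (pos-transpose a b v (swap (toℕ b) (toℕ a) k)))))))

≤B-trans : ∀ {r} {u v w : Perm r} → u ≤B v → v ≤B w → u ≤B w
≤B-trans (≤B-refl e) (≤B-refl e') = ≤B-refl λ i → trans (e i) (e' i)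
≤B-trans (≤B-step h a b ne l e) (≤B-refl e') = ≤B-step h a b ne l λ i → trans (sym (e' i)) (e i)
≤B-trans h (≤B-step h' a b ne l e) = ≤B-step (≤B-trans h h') a b ne l e

≤B-pos : ∀ {r} {u v : Perm r} → pos u ≗ pos v → u ≤B v
≤B-pos {u = u} {v} e = ≤B-refl (pos⇒≈ {π = u} {σ = v} (e ∘ toℕ))

-- Keys and Demazure crystals

Ascent Descent : ∀ {r} → ℕ → Perm r → Set
Ascent q u = pos u q < pos u (suc q)
Descent q u = pos u (suc q) < pos u q

-- `Up` gives the 0-Hecke product with s_{q+1}, the longer of the two elements, and `Down` the
-- shorter one. They are relations because permutations are compared pointwise.
Up Down : ∀ {r} → ℕ → Perm r → Perm r → Set
Up q u u' = Ascent q u × (pos u' ≗ pos u ∘ swap q (suc q)) ⊎ Descent q u × (pos u' ≗ pos u)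
Down q u u' = Ascent q u × (pos u' ≗ pos u) ⊎ Descent q u × (pos u' ≗ pos u ∘ swap q (suc q))

ascent? : ∀ {r} q → suc q < r → (u : Perm r) → Ascent q u ⊎ Descent q u
ascent? q p u = pos-connex u (<-trans (n<1+n q) p) p (<⇒≢ ≤-refl)

up-exists : ∀ {r} q → suc q < r → (u : Perm r) → Σ (Perm r) (Up q u)
up-exists q p u with ascent? q p u
... | inj₁ a = sref (suc q) · u , inj₁ (a , pos-sref q p u)
... | inj₂ d = u , inj₂ (d , λ _ → refl)

down-exists : ∀ {r} q → suc q < r → (u : Perm r) → Σ (Perm r) (Down q u)
down-exists q p u with ascent? q p u
... | inj₁ a = u , inj₁ (a , λ _ → refl)
... | inj₂ d = sref (suc q) · u , inj₂ (d , pos-sref q p u)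

swap-conj : ∀ q a b k → swap q (suc q) (swap a b (swap q (suc q) k)) ≡ swap (swap q (suc q) a) (swap q (suc q) b) k
swap-conj q a b k with s k ≟ a | s k ≟ b
  where s = swap q (suc q)
... | yes refl | _ = trans (cong s (swap-a (s k) b)) (trans (sym (swap-a k (s b))) (cong (λ x → swap x (s b) k) (sym (swap-involutive q (suc q) k))))
  where s = swap q (suc q)
... | no _ | yes refl = trans (cong s (swap-b a (s k))) (trans (sym (swap-b (s a) k)) (cong (λ x → swap (s a) x k) (sym (swap-involutive q (suc q) k))))
  where s = swap q (suc q)
... | no x | no y = trans (cong s (swap-other a b (s k) x y)) (trans (swap-involutive q (suc q) k)
    (sym (swap-other (s a) (s b) k (λ e → x (trans (cong s e) (swap-involutive q (suc q) a))) (λ e → y (trans (cong s e) (swap-involutive q (suc q) b))))))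
  where s = swap q (suc q)

Simple-at : ∀ {r} {v w : Perm r} → ℕ → Reflects v w → Set
Simple-at q (reflection a b _ _ _ _) = a ≡ q × b ≡ suc q

reflects-conj : ∀ {r} {v w v' w' : Perm r} q → suc q < r → (R : Reflects v w) → ¬ Simple-at q R →
  pos v' ≗ pos v ∘ swap q (suc q) → pos w' ≗ pos w ∘ swap q (suc q) → Reflects v' w'
reflects-conj {v = v} {w} {v'} {w'} q q<r (reflection a b a<b b<r lt e) ne ev ew =
  reflection (s a) (s b) (swap-mono q a<b ne) (swap-< (<-trans (n<1+n q) q<r) q<r b<r)
  (subst₂ _<_ (sym (trans (ev (s a)) (cong (pos v) (swap-involutive q (suc q) a))))
             (sym (trans (ev (s b)) (cong (pos v) (swap-involutive q (suc q) b)))) lt)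
  λ k → trans (ew k) (trans (e (s k)) (trans (cong (pos v) (sym (swap-involutive q (suc q) (swap a b (s k)))))
    (trans (sym (ev (s (swap a b (s k))))) (cong (pos v') (swap-conj q a b k)))))
  where s = swap q (suc q)

ascent-reflects : ∀ {r} {u u' : Perm r} q → suc q < r → Ascent q u → pos u' ≗ pos u ∘ swap q (suc q) → Reflects u u'
ascent-reflects q p a e = reflection q (suc q) (n<1+n q) p a e

swap-back : ∀ {r} {u u' : Perm r} q → pos u' ≗ pos u ∘ swap q (suc q) → pos u ≗ pos u' ∘ swap q (suc q)
swap-back {u = u} q e k = trans (cong (pos u) (sym (swap-involutive q (suc q) k))) (sym (e (swap q (suc q) k)))

descent-swap : ∀ {r} {u u' : Perm r} q → Descent q u → pos u' ≗ pos u ∘ swap q (suc q) → Ascent q u'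
descent-swap {u = u} q d e = subst₂ _<_ (sym (trans (e q) (cong (pos u) (swap-a q (suc q)))))
  (sym (trans (e (suc q)) (cong (pos u) (swap-b q (suc q))))) d

ascent-swap : ∀ {r} {u u' : Perm r} q → Ascent q u → pos u' ≗ pos u ∘ swap q (suc q) → Descent q u'
ascent-swap {u = u} q a e = subst₂ _<_ (sym (trans (e (suc q)) (cong (pos u) (swap-b q (suc q)))))
  (sym (trans (e q) (cong (pos u) (swap-a q (suc q))))) a

descent-reflects : ∀ {r} {u u' : Perm r} q → suc q < r → Descent q u → pos u' ≗ pos u ∘ swap q (suc q) → Reflects u' u
descent-reflects {u = u} {u'} q p d e =
  ascent-reflects q p (descent-swap {u = u} {u'} q d e) (swap-back {u = u} {u'} q e)

reflects⇒≤B : ∀ {r} {v w : Perm r} → Reflects v w → v ≤B w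
reflects⇒≤B R = ≤B-reflects (≤B-refl (λ _ → refl)) R

≤B-up : ∀ {r} {u u' : Perm r} q → suc q < r → Up q u u' → u ≤B u'
≤B-up {u = u} {u'} q p (inj₁ (a , e)) = reflects⇒≤B (ascent-reflects q p a e)
≤B-up q p (inj₂ (_ , e)) = ≤B-pos (sym ∘ e)

down-≤B : ∀ {r} {u u' : Perm r} q → suc q < r → Down q u u' → u' ≤B u
down-≤B q p (inj₁ (_ , e)) = ≤B-pos e
down-≤B {u = u} {u'} q p (inj₂ (d , e)) = reflects⇒≤B (descent-reflects q p d e)

same-reflection? : ∀ q a b → Dec (a ≡ q × b ≡ suc q)
same-reflection? q a b with a ≟ q | b ≟ suc q
... | yes p | yes p' = yes (p , p')
... | no np | _ = no (np ∘ proj₁)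
... | yes _ | no np = no (np ∘ proj₂)

-- If the reflection is the simple one itself, both results coincide. Any other reflection remains
-- one that goes up after conjugation by the simple reflection, and the remaining combinations
-- follow from u ≤ s * u.
up-reflects : ∀ {r} {v v' w w' : Perm r} q → suc q < r → Reflects v w → Up q v v' → Up q w w' → v' ≤B w'
up-reflects {v = v} {v'} {w} {w'} q p R@(reflection a b a<b b<r lt e) V W with same-reflection? q a b
up-reflects {v = v} {v'} {w} {w'} q p (reflection .q .(suc q) a<b b<r lt e) V W | yes (refl , refl) with V | W
... | inj₂ (d , _) | _ = ⊥-elim (<-asym d lt)
... | inj₁ (_ , _) | inj₁ (a , _) = ⊥-elim (<-asym a (ascent-swap {u = v} {w} q lt e))
... | inj₁ (_ , ev) | inj₂ (_ , ew) = ≤B-pos λ k → trans (ev k) (trans (sym (e k)) (sym (ew k)))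
up-reflects {v = v} {v'} {w} {w'} q p R V W | no ne with V | W
... | inj₁ (a , ev) | inj₁ (a' , ew) = reflects⇒≤B (reflects-conj q p R ne ev ew)
... | inj₁ (a , ev) | inj₂ (d , ew) = ≤B-trans
      (reflects⇒≤B (reflects-conj q p R ne ev (pos-sref q p w)))
      (≤B-trans (reflects⇒≤B (descent-reflects q p d (pos-sref q p w))) (≤B-pos (sym ∘ ew)))
... | inj₂ (d , ev) | W' = ≤B-trans (≤B-pos ev) (≤B-trans (reflects⇒≤B R) (≤B-up q p W'))

down-reflects : ∀ {r} {v v' w w' : Perm r} q → suc q < r → Reflects v w → Down q v v' → Down q w w' → v' ≤B w'
down-reflects {v = v} {v'} {w} {w'} q p R@(reflection a b a<b b<r lt e) V W with same-reflection? q a b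
down-reflects {v = v} {v'} {w} {w'} q p (reflection .q .(suc q) a<b b<r lt e) V W | yes (refl , refl) with V | W
... | inj₂ (d , _) | _ = ⊥-elim (<-asym d lt)
... | inj₁ (_ , _) | inj₁ (a , _) = ⊥-elim (<-asym a (ascent-swap {u = v} {w} q lt e))
... | inj₁ (_ , ev) | inj₂ (_ , ew) = ≤B-pos λ k → trans (ev k) (trans (swap-back {u = v} {w} q e k) (sym (ew k)))
down-reflects {v = v} {v'} {w} {w'} q p R V W | no ne with V | W
... | V' | inj₁ (a , ew) = ≤B-trans (down-≤B q p V') (≤B-trans (reflects⇒≤B R) (≤B-pos (sym ∘ ew)))
... | inj₂ (d , ev) | inj₂ (d' , ew) = reflects⇒≤B (reflects-conj q p R ne ev ew)
... | inj₁ (a , ev) | inj₂ (d , ew) = ≤B-trans (≤B-pos ev) (≤B-trans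
      (reflects⇒≤B (ascent-reflects q p a (pos-sref q p v)))
      (reflects⇒≤B (reflects-conj q p R ne (pos-sref q p v) ew)))

up-unique : ∀ {r} {u w u' w' : Perm r} q → pos u ≗ pos w → Up q u u' → Up q w w' → pos u' ≗ pos w'
up-unique q e (inj₁ (_ , e₁)) (inj₁ (_ , e₂)) k = trans (e₁ k) (trans (e _) (sym (e₂ k)))
up-unique q e (inj₂ (_ , e₁)) (inj₂ (_ , e₂)) k = trans (e₁ k) (trans (e k) (sym (e₂ k)))
up-unique q e (inj₁ (a , _)) (inj₂ (d , _)) k = ⊥-elim (<-asym d (subst₂ _<_ (e q) (e (suc q)) a))
up-unique q e (inj₂ (d , _)) (inj₁ (a , _)) k = ⊥-elim (<-asym a (subst₂ _<_ (e (suc q)) (e q) d))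

down-unique : ∀ {r} {u w u' w' : Perm r} q → pos u ≗ pos w → Down q u u' → Down q w w' → pos u' ≗ pos w'
down-unique q e (inj₁ (_ , e₁)) (inj₁ (_ , e₂)) k = trans (e₁ k) (trans (e k) (sym (e₂ k)))
down-unique q e (inj₂ (_ , e₁)) (inj₂ (_ , e₂)) k = trans (e₁ k) (trans (e _) (sym (e₂ k)))
down-unique q e (inj₁ (a , _)) (inj₂ (d , _)) k = ⊥-elim (<-asym d (subst₂ _<_ (e q) (e (suc q)) a))
down-unique q e (inj₂ (d , _)) (inj₁ (a , _)) k = ⊥-elim (<-asym a (subst₂ _<_ (e (suc q)) (e q) d))

up-monotone : ∀ {r} {u u' w w' : Perm r} q → suc q < r → u ≤B w → Up q u u' → Up q w w' → u' ≤B w'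
up-monotone {u = u} {w = w} q p (≤B-refl e) U W = ≤B-pos (up-unique {u = u} {w} q (pos-cong u w e) U W)
up-monotone {w = w} q p (≤B-step {v = v} h a b ne l e) U W with up-exists q p v
... | v' , V = ≤B-trans (up-monotone q p h U V) (up-reflects {v = v} {v'} {w} q p (step⇒reflects a b ne l e) V W)

down-monotone : ∀ {r} {u u' w w' : Perm r} q → suc q < r → u ≤B w → Down q u u' → Down q w w' → u' ≤B w'
down-monotone {u = u} {w = w} q p (≤B-refl e) U W = ≤B-pos (down-unique {u = u} {w} q (pos-cong u w e) U W)
down-monotone {w = w} q p (≤B-step {v = v} h a b ne l e) U W with down-exists q p v
... | v' , V = ≤B-trans (down-monotone q p h U V) (down-reflects {v = v} {v'} {w} q p (step⇒reflects a b ne l e) V W)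

-- The key w₀ ω(v) under raising

Simple : ℕ → ℕ → Set
Simple r p = 1 ≤ p × p < r

pos-nd : ∀ {r} q → suc q < r → (π : Perm r) →
  pos (if len π <ᵇ len (sref (suc q) · π) then sref (suc q) · π else π) ≗ srt q (pos π)
pos-nd q p π k with ascent? q p π
... | inj₁ a rewrite <ᵇ-yes (≤-reflexive (sym (len-sref-ascent q p π a))) =
  trans (pos-sref q p π k) (sym (srt-swap q (pos π) a k))
... | inj₂ d rewrite <ᵇ-no (λ l → <-asym l (≤-reflexive (len-sref-descent q p π d))) =
  sym (srt-fixed q (pos π) (<⇒≤ d) k)

pos-id : ∀ {r} k → pos {r} P.id k ≡ k
pos-id {r} k with k <? r
... | yes p = FP.toℕ-fromℕ< p
... | no _ = refl

pos-Πnd : ∀ {r} ps → All (Simple r) ps → pos (Πnd {r} ps) ≗ sortBy ps (λ k → k)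
pos-Πnd {r} [] [] = pos-id {r}
pos-Πnd {r} (suc q ∷ ps) ((_ , p) ∷ a) k = trans (pos-nd q p (Πnd ps) k) (srt-cong q (pos-Πnd ps a) k)

circAux-simple : ∀ {r} p bs → 1 ≤ p → p + length bs ≤ r → All (Simple r) (circAux p bs)
circAux-simple p [] _ _ = []
circAux-simple {r} p (b ∷ bs) 1≤p l rewrite circAux-∷ p b bs = AP.++⁺ (head (b ≡ᵇ head₀ bs))
  (circAux-simple (suc p) bs (s≤s z≤n) (≤-trans (≤-reflexive (sym (+-suc p (length bs)))) l))
  where
  head : ∀ c → All (Simple r) (if c then p ∷ [] else [])
  head true = (1≤p , ≤-trans (s≤s (m≤m+n p (length bs))) (≤-trans (≤-reflexive (sym (+-suc p (length bs)))) l)) ∷ []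
  head false = []

all-reverse : ∀ {Q : ℕ → Set} xs → All Q xs → All Q (L.reverse xs)
all-reverse [] [] = []
all-reverse {Q} (x ∷ xs) (q ∷ a) = subst (All Q) (sym (LP.unfold-reverse x xs)) (AP.++⁺ (all-reverse xs a) (q ∷ []))

blocks-simple : ∀ {r} m k (T : Tab r) → m + k ≡ r →
  All (Simple r) (concat (map (λ bs → L.reverse (circAux 1 bs)) (blocksFrom m k T)))
blocks-simple m zero T e = []
blocks-simple {r} m (suc k) T refl rewrite m+n∸m≡n m (suc k) | procBlock-spec (suc k) m T =
  AP.++⁺ (all-reverse (circAux 1 (strings (suc k) m (readWord T))) (circAux-simple 1 (strings (suc k) m (readWord T)) ≤-refl
           (≤-trans (s≤s (≤-reflexive (length-strings m (suc k) (readWord T)))) (≤-trans (s≤s (m≤m+n m k)) (≤-reflexive (sym (+-suc m k)))))))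
         (blocks-simple (suc m) k (raiseTab (suc k) m T) (sym (+-suc m k)))

circledSeq-simple : ∀ {r} → 1 ≤ r → (T : Tab r) → All (Simple r) (circledSeq T)
circledSeq-simple {suc r} _ T = blocks-simple 1 r T refl

pos-ω : ∀ {r} → 1 ≤ r → (v : Tab r) → pos (ω v) ≗ keySort r 0 (readWord v) (λ k → k)
pos-ω 1≤r v k = trans (pos-Πnd (circledSeq v) (circledSeq-simple 1≤r v) k) (cong-app (sortBy-circledSeq 1≤r v (λ k → k)) k)

κ : ∀ {r} → Tab r → Perm r
κ v = w₀ · ω v

pos-w₀ : ∀ {r} (π : Perm r) {k} → k < r → pos (w₀ · π) k ≡ pos π (r ∸ suc k)
pos-w₀ {r} π {k} p = trans (cong (pos (w₀ · π)) (sym (FP.toℕ-fromℕ< p))) (trans (pos-toℕ (w₀ · π) a)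
  (trans (sym (pos-toℕ π (F.opposite a))) (cong (pos π) (trans (FP.opposite-prop a) (cong (λ x → r ∸ suc x) (FP.toℕ-fromℕ< p))))))
  where a = fromℕ< p

pos-κ : ∀ {r} → 1 ≤ r → (v : Tab r) → ∀ {k} → k < r → pos (κ v) k ≡ keySort r 0 (readWord v) (λ k → k) (r ∸ suc k)
pos-κ {r} 1≤r v {k} p = trans (pos-w₀ (ω v) p) (pos-ω 1≤r v (r ∸ suc k))

keySort-raise : ∀ {r} q → suc q < r → ∀ w g →
  keySort r 0 (E₀ (suc q) w) g ≗ srt (r ∸ suc (suc q)) (keySort r 0 w g)
keySort-raise {r} q p w g k = subst (λ r → keySort r 0 (E₀ (suc q) w) g k ≡ srt d (keySort r 0 w g) k) r≡
  (trans (keySort-E d q 0 w g (highest-vacuous (suc (d + suc q)) w) k)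
    (cong (λ z → srt z (keySort (suc (d + suc q)) 0 w g) k) (+-identityʳ d)))
  where
  d = r ∸ suc (suc q)
  r≡ : suc (d + suc q) ≡ r
  r≡ = trans (sym (+-suc d (suc q))) (m∸n+n≡m p)

-- Multiplication by w₀ reads the sequence backwards: places q and q+1 become d+1 and d. The
-- decreasing sort of the latter is an increasing sort of the former, so going up for ω is going
-- down for κ.
κ-raise : ∀ {r} q → suc q < r → (v v' : Tab r) → readWord v' ≡ E₀ (suc q) (readWord v) → Down q (κ v) (κ v')
κ-raise {r} q p v v' e = go (ascent? q p (κ v))
  where
  1≤r : 1 ≤ r
  1≤r = ≤-trans (s≤s z≤n) p
  f = keySort r 0 (readWord v) (λ k → k)
  d = r ∸ suc (suc q)
  q<r = <-trans (n<1+n q) p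
  d+1 : r ∸ suc q ≡ suc d
  d+1 = +-∸-assoc 1 {r} {suc (suc q)} p
  at-q : pos (κ v) q ≡ f (suc d)
  at-q = trans (pos-κ 1≤r v q<r) (cong f d+1)
  at-q+1 : pos (κ v) (suc q) ≡ f d
  at-q+1 = pos-κ 1≤r v p
  raised : ∀ {k} → k < r → pos (κ v') k ≡ srt d f (r ∸ suc k)
  raised {k} l = trans (pos-κ 1≤r v' l) (trans (cong (λ w → keySort r 0 w (λ k → k) (r ∸ suc k)) e)
    (keySort-raise q p (readWord v) (λ k → k) (r ∸ suc k)))
  go : Ascent q (κ v) ⊎ Descent q (κ v) → Down q (κ v) (κ v')
  go (inj₁ a) = inj₁ (a , pos-ext _ _ (λ k l → trans (pos-outside (κ v') k l) (sym (pos-outside (κ v) k l)))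
    λ c → trans (raised (FP.toℕ<n c)) (trans (srt-fixed d f (<⇒≤ (subst₂ _<_ at-q at-q+1 a)) (r ∸ suc (toℕ c)))
      (sym (pos-κ 1≤r v (FP.toℕ<n c)))))
  go (inj₂ desc) = inj₂ (desc , pos-ext _ _
    (λ k l → trans (pos-outside (κ v') k l) (sym (trans (cong (pos (κ v)) (swap-other q (suc q) k
       (λ e → <-irrefl (sym e) (≤-trans q<r l)) (λ e → <-irrefl (sym e) (≤-trans p l)))) (pos-outside (κ v) k l))))
    λ c → trans (raised (FP.toℕ<n c)) (trans (srt-swap d f (subst₂ _<_ at-q+1 at-q desc) (r ∸ suc (toℕ c)))
      (trans (cong f (mirror (toℕ c) (FP.toℕ<n c))) (sym (pos-κ 1≤r v (swap-< q<r p (FP.toℕ<n c)))))))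
    where
    mirror : ∀ k → k < r → swap d (suc d) (r ∸ suc k) ≡ r ∸ suc (swap q (suc q) k)
    mirror k l with k ≟ q | k ≟ suc q
    ... | yes refl | _ = trans (cong (swap d (suc d)) d+1) (trans (swap-b d (suc d)) (cong (λ z → r ∸ suc z) (sym (swap-a k (suc k)))))
    ... | no _ | yes refl = trans (swap-a d (suc d)) (trans (sym d+1) (cong (λ z → r ∸ suc z) (sym (swap-b q (suc q)))))
    ... | no x | no y = trans (swap-other d (suc d) (r ∸ suc k)
          (λ e → y (suc-injective (∸-cancelˡ-≡ l p e))) (λ e → x (suc-injective (∸-cancelˡ-≡ l q<r (trans e (sym d+1))))))
        (cong (λ z → r ∸ suc z) (sym (swap-other q (suc q) k x y)))

increasing⇒≤ : ∀ {r} (f : ℕ → ℕ) → (∀ q → suc q < r → f q < f (suc q)) → ∀ k → k < r → k ≤ f k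
increasing⇒≤ f inc zero _ = z≤n
increasing⇒≤ f inc (suc k) p = ≤-trans (s≤s (increasing⇒≤ f inc k (<-trans (n<1+n k) p))) (inc k p)

increasing⇒≥ : ∀ {r} (f : ℕ → ℕ) → (∀ q → suc q < r → f q < f (suc q)) → (∀ k → k < r → f k < r) →
  ∀ d k → k + suc d ≡ r → f k ≤ k
increasing⇒≥ f inc bd zero k e = ≤-pred (≤-trans (bd k k<r) (≤-reflexive (trans (sym e) (+-comm k 1))))
  where k<r = ≤-trans (≤-reflexive (+-comm 1 k)) (≤-reflexive e)
increasing⇒≥ f inc bd (suc d) k e = ≤-pred (≤-trans (inc k (≤-trans (s≤s (s≤s (m≤m+n k d)))
    (≤-reflexive (trans (cong suc (sym (+-suc k d))) e'))))
    (increasing⇒≥ f inc bd d (suc k) e'))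
  where e' = trans (sym (+-suc k (suc d))) e

increasing⇒id : ∀ {r} (f : ℕ → ℕ) → (∀ q → suc q < r → f q < f (suc q)) → (∀ k → k < r → f k < r) →
  ∀ k → k < r → f k ≡ k
increasing⇒id {r} f inc bd k p = ≤-antisym
  (increasing⇒≥ f inc bd (r ∸ suc k) k (trans (+-suc k (r ∸ suc k)) (m+[n∸m]≡n p)))
  (increasing⇒≤ f inc k p)

ascents⇒id : ∀ {r} (w : Perm r) → (∀ q → suc q < r → Ascent q w) → w ≈ P.id
ascents⇒id {r} w asc = pos⇒≈ λ a →
  trans (increasing⇒id {r} (pos w) asc (λ k → pos-< w) (toℕ a) (FP.toℕ<n a)) (sym (pos-id {r} (toℕ a)))

descent-search : ∀ {r} (w : Perm r) n → n < r → (∀ q → q < n → Ascent q w) ⊎ Σ ℕ λ q → suc q < r × Descent q w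
descent-search w zero _ = inj₁ λ q ()
descent-search w (suc n) p with descent-search w n (<-trans (n<1+n n) p)
... | inj₂ d = inj₂ d
... | inj₁ a with ascent? n p w
...   | inj₂ d = inj₂ (n , p , d)
...   | inj₁ a' = inj₁ λ q l → case q l (m≤n⇒m<n∨m≡n (≤-pred l))
  where
  case : ∀ q → q < suc n → q < n ⊎ q ≡ n → Ascent q w
  case q _ (inj₁ l) = a q l
  case .n _ (inj₂ refl) = a'

id-or-descent : ∀ {r} → 1 ≤ r → (w : Perm r) → w ≈ P.id ⊎ Σ ℕ λ q → suc q < r × Descent q w
id-or-descent {suc r} _ w with descent-search w r ≤-refl
... | inj₁ a = inj₁ (ascents⇒id w λ q p → a q (≤-pred p))
... | inj₂ d = inj₂ d

below-id : ∀ {r} {u w : Perm r} → u ≤B w → w ≈ P.id → u ≈ P.id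
below-id (≤B-refl e) i a = trans (e a) (i a)
below-id {r} {w = w} (≤B-step {v = v} h a b ne l e) i with step⇒reflects a b ne l e
... | reflection x y x<y y<r lt e' = ⊥-elim (<-asym lt (subst₂ _<_
    (trans (sym (pos≡ x)) (trans (e' x) (cong (pos v) (swap-a x y))))
    (trans (sym (pos≡ y)) (trans (e' y) (cong (pos v) (swap-b x y)))) x<y))
  where
  pos≡ : ∀ k → pos w k ≡ k
  pos≡ k = trans (pos-cong w P.id i k) (pos-id {r} k)

-- No string of `vhw` is computed: raising any tableau of the shape through all blocks gives a
-- highest word, and that tableau is `vhw`.
vhw-highest : ∀ {r} (lam : Vec ℕ r) (v : Tab r) → InB lam v → Highest 1 r (readWord (vhw lam))
vhw-highest {r} lam v b = subst₂ (λ u w → Highest 1 u w) (+-identityʳ r) (raiseAll≡vhw lam v b)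
  (raiseAll-highest r 0 (readWord v) (highest-vacuous r (readWord v)))

-- Raising leaves `vhw` unchanged and by `κ-raise` removes any descent from its key. So there is no
-- descent to remove.
κ-vhw : ∀ {r} → 1 ≤ r → (lam : Vec ℕ r) → Highest 1 r (readWord (vhw lam)) → κ (vhw lam) ≈ P.id
κ-vhw {r} 1≤r lam H = ascents⇒id (κ (vhw lam)) asc
  where
  v = vhw lam
  asc : ∀ q → suc q < r → Ascent q (κ v)
  asc q p with κ-raise q p v v (sym (ε≡0⇒E≡ (suc q) 0 (readWord v) (H (suc q) (s≤s z≤n) p)))
  ... | inj₁ (a , _) = a
  ... | inj₂ (d , e) = ⊥-elim (<-asym d (descent-swap {u = κ v} {κ v} q d e))

-- If the key is trivial, ω(v) = w₀ and `keySort` reverses the identity sequence. By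
-- `reversing⇒fixed` the tableau is then unchanged by all the raising.
κ-id⇒vhw : ∀ {r} → 1 ≤ r → (lam : Vec ℕ r) (v : Tab r) → InB lam v → κ v ≈ P.id → v ≡ vhw lam
κ-id⇒vhw {r} 1≤r lam v b e = trans
  (readWord-injective (λ j → trans (proj₁ b j) (sym (proj₁ b' j)))
    (trans fixed (sym (readWord-raiseAllTab r 0 v))))
  (raiseAllTab≡vhw lam v b)
  where
  b' = inB-raiseAllTab lam r 0 v b
  rev : Reverses (keySort r 0 (readWord v)) r (λ k → k)
  rev k p = begin
    keySort r 0 (readWord v) (λ k → k) k
      ≡⟨ cong (keySort r 0 (readWord v) (λ k → k)) (trans (cong (r ∸_) (sym (+-∸-assoc 1 {r} {suc k} p))) (m∸[m∸n]≡n (<⇒≤ p))) ⟨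
    keySort r 0 (readWord v) (λ k → k) (r ∸ suc (r ∸ suc k))
      ≡⟨ pos-κ 1≤r v m<r ⟨
    pos (κ v) (r ∸ suc k)
      ≡⟨ trans (pos-cong (κ v) P.id e (r ∸ suc k)) (pos-id {r} (r ∸ suc k)) ⟩
    r ∸ suc k ∎
    where
    open ≡-Reasoning
    m<r : r ∸ suc k < r
    m<r = ∸-monoʳ-< z<s p
  fixed : readWord v ≡ raiseAll r 0 (readWord v)
  fixed = reversing⇒fixed r 0 (readWord v) (λ g → g) (readWord v) (λ e → e) (λ g k _ → refl) (λ _ _ _ → refl)
    (λ k → k) (λ k _ → ≤-refl) (subst (λ n → Reverses (keySort r 0 (readWord v)) n (λ k → k)) (sym (+-identityʳ r)) rev)

ascent⇐len : ∀ {r} q → suc q < r → (w : Perm r) → len w < len (sref (suc q) · w) → Ascent q w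
ascent⇐len q p w l with ascent? q p w
... | inj₁ a = a
... | inj₂ d = ⊥-elim (<-asym l (≤-reflexive (len-sref-descent q p w d)))

-- The top `x⁺` of the string through `x` is also the top for `y`, so its key is at most κ(y) ≤ w.
-- The key of `x` is that of `x⁺` or s times it, hence at most s * κ(x⁺) ≤ s * w = w'.
demazure⇒≤ : ∀ {r} → 1 ≤ r → (lam : Vec ℕ r) → Highest 1 r (readWord (vhw lam)) →
  ∀ {w v} → Dem lam w v → κ v ≤B w
demazure⇒≤ 1≤r lam H {w} (dem-id e) = ≤B-refl λ i → trans (κ-vhw 1≤r lam H i) (sym (e i))
demazure⇒≤ {r} 1≤r lam H {v = v} (dem-step {w} {w'} {x} {y} (suc q) _ p l e b k it d) =
  up-lowered (κ-raise q p x x⁺ raised-x) (up-exists q p (κ x⁺))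
  where
  x⁺ = raiseRows (suc q) 0 x
  raised-x : readWord x⁺ ≡ E₀ (suc q) (readWord x)
  raised-x = readWord-raiseRows (suc q) 0 x
  lowered≤ : κ x⁺ ≤B w
  lowered≤ = ≤B-trans (down-≤B q p (κ-raise q p y x⁺ (trans raised-x (sym (eIter-same (suc q) k x it)))))
              (demazure⇒≤ 1≤r lam H d)
  W : Up q w w'
  W = inj₁ (ascent⇐len q p w l , λ k → trans (pos-cong w' (sref (suc q) · w) e k) (pos-sref q p w k))
  up-lowered : Down q (κ x) (κ x⁺) → Σ (Perm r) (Up q (κ x⁺)) → κ x ≤B w'
  up-lowered (inj₁ (_ , same)) (u , U) = ≤B-trans (≤B-pos (sym ∘ same)) (≤B-trans (≤B-up q p U) (up-monotone q p lowered≤ U W))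
  up-lowered (inj₂ (desc , sw)) (u , inj₁ (a , e')) = ≤B-trans
    (≤B-pos λ k → trans (swap-back {u = κ x} {κ x⁺} q sw k) (sym (e' k)))
    (up-monotone q p lowered≤ (inj₁ (a , e')) W)
  up-lowered (inj₂ (desc , sw)) (u , inj₂ (d' , _)) = ⊥-elim (<-asym d' (descent-swap {u = κ x} {κ x⁺} q desc sw))

-- A descent of `w` provides a shorter `w₁` with w = s w₁. Lowering both sides of κ(v) ≤ w puts the
-- key of the string top `v⁺` below `w₁`, and ε is the exponent that leads from `v` to `v⁺`.
≤⇒demazure : ∀ {r} → 1 ≤ r → (lam : Vec ℕ r) → ∀ n w → len w ≤ n → ∀ v → InB lam v → κ v ≤B w → Dem lam w v
≤⇒demazure {r} 1≤r lam n w l v b h with id-or-descent 1≤r w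
... | inj₁ i = subst (Dem lam w) (sym (κ-id⇒vhw 1≤r lam v b (below-id h i))) (dem-id i)
≤⇒demazure {r} 1≤r lam zero w l v b h | inj₂ (q , p , d) =
  contradiction (≤-trans (≤-reflexive (len-sref-descent q p w d)) l) λ ()
≤⇒demazure {r} 1≤r lam (suc n) w l v b h | inj₂ (q , p , d) =
  dem-step {w = w₁} (suc q) (s≤s z≤n) p
    (≤-trans (≤-reflexive (len-sref-descent q p w d)) (≤-reflexive (len-cong w (sref (suc q) · w₁) (λ i → sym (sref-involutive q p w i)))))
    (λ i → sym (sref-involutive q p w i)) b (ε₀ (suc q) (readWord v)) (eIter-max (suc q) _ v refl)
    (≤⇒demazure 1≤r lam n w₁ (≤-pred (≤-trans (≤-reflexive (len-sref-descent q p w d)) l)) v⁺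
      (inB-raiseRows lam (s≤s z≤n) v b)
      (down-monotone q p h (κ-raise q p v v⁺ (readWord-raiseRows (suc q) 0 v)) (inj₂ (d , pos-sref q p w))))
  where
  w₁ = sref (suc q) · w
  v⁺ = raiseRows (suc q) 0 v

-- Cosets

Before : ℕ → (ℕ → ℕ) → Set
Before p g = Σ ℕ λ x → Σ ℕ λ y → x < y × g x ≡ suc p × g y ≡ p

srt-moves : ∀ q g → Σ ℕ λ x → (x ≡ q ⊎ x ≡ suc q) × srt q g x ≡ g q
srt-moves q g with ≤-total (g q) (g (suc q))
... | inj₁ p = suc q , inj₂ refl , trans (srt-hi q g) (m≤n⇒m⊓n≡m p)
... | inj₂ p = q , inj₁ refl , trans (srt-lo q g) (m≥n⇒m⊔n≡m p)

srt-moves′ : ∀ q g → Σ ℕ λ x → (x ≡ q ⊎ x ≡ suc q) × srt q g x ≡ g (suc q)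
srt-moves′ q g with ≤-total (g q) (g (suc q))
... | inj₁ p = q , inj₁ refl , trans (srt-lo q g) (m≤n⇒m⊔n≡n p)
... | inj₂ p = suc q , inj₂ refl , trans (srt-hi q g) (m≥n⇒m⊓n≡n p)

-- An exchange at q can invert the order of two values only if both sit at q and q+1, and there the
-- sort keeps the larger one in front.
before-srt : ∀ p q g → Before p g → Before p (srt q g)
before-srt p q g (x , y , x<y , ex , ey) with cls q x in eq | cls q y in eq'
... | neither | neither = x , y , x<y , trans (srt-neither q g x eq) ex , trans (srt-neither q g y eq') ey
... | lo | lo = ⊥-elim (<-irrefl (trans (lo⇒≡ q x eq) (sym (lo⇒≡ q y eq'))) x<y)
... | hi | hi = ⊥-elim (<-irrefl (trans (hi⇒≡ q x eq) (sym (hi⇒≡ q y eq'))) x<y)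
... | hi | lo = ⊥-elim (<-asym x<y (≤-reflexive (trans (cong suc (lo⇒≡ q y eq')) (sym (hi⇒≡ q x eq)))))
... | lo | hi rewrite lo⇒≡ q x eq | hi⇒≡ q y eq' = q , suc q , x<y , trans (sorted q) ex , trans (sorted (suc q)) ey
  where sorted = srt-fixed q g (≤-trans (≤-reflexive ey) (<⇒≤ (≤-reflexive (sym ex))))
... | lo | neither rewrite lo⇒≡ q x eq with srt-moves q g
...   | z , inj₁ refl , e = z , y , x<y , trans e ex , trans (srt-neither q g y eq') ey
...   | z , inj₂ refl , e = z , y , ≤∧≢⇒< x<y (λ { refl → contradiction (trans (sym eq') (cls-hi q)) λ () }) , trans e ex , trans (srt-neither q g y eq') ey
before-srt p q g (x , y , x<y , ex , ey) | hi | neither rewrite hi⇒≡ q x eq with srt-moves′ q g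
...   | z , inj₁ refl , e = z , y , <-trans (n<1+n q) x<y , trans e ex , trans (srt-neither q g y eq') ey
...   | z , inj₂ refl , e = z , y , x<y , trans e ex , trans (srt-neither q g y eq') ey
before-srt p q g (x , y , x<y , ex , ey) | neither | lo rewrite lo⇒≡ q y eq' with srt-moves q g
...   | z , inj₁ refl , e = x , z , x<y , trans (srt-neither q g x eq) ex , trans e ey
...   | z , inj₂ refl , e = x , z , <-trans x<y (n<1+n q) , trans (srt-neither q g x eq) ex , trans e ey
before-srt p q g (x , y , x<y , ex , ey) | neither | hi rewrite hi⇒≡ q y eq' with srt-moves′ q g
...   | z , inj₁ refl , e = x , z , ≤∧≢⇒< (≤-pred x<y) (λ { refl → contradiction (trans (sym eq) (cls-lo q)) λ () }) , trans (srt-neither q g x eq) ex , trans e ey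
...   | z , inj₂ refl , e = x , z , x<y , trans (srt-neither q g x eq) ex , trans e ey

before-block : ∀ p q bs g → Before p g → Before p (block q bs g)
before-block p q [] g b = b
before-block p q (c ∷ bs) g b with c ≡ᵇ head₀ bs
... | true = before-block p (suc q) bs (srt q g) (before-srt p q g b)
... | false = before-block p (suc q) bs g b

before-keySort : ∀ p j m w g → Before p g → Before p (keySort j m w g)
before-keySort p zero m w g b = b
before-keySort p (suc j) m w g b = before-block p 0 (strings (suc j) m w) _ (before-keySort p j (suc m) (raise (suc j) m w) g b)

pos-inside : ∀ {r} (π : Perm r) z {k} → k < r → pos π z ≡ k → z < r
pos-inside {r} π z k<r e with <-≤-connex z r
... | inj₁ z<r = z<r
... | inj₂ r≤z = ⊥-elim (<-irrefl (trans (sym e) (pos-outside π z r≤z)) (≤-trans k<r r≤z))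

pos⇒value : ∀ {r} (π : Perm r) {x} c → x < r → pos π x ≡ toℕ c → toℕ (π ⟨$⟩ʳ c) ≡ x
pos⇒value π c p e = pos-injective π (FP.toℕ<n (π ⟨$⟩ʳ c)) p
  (trans (pos-toℕ π (π ⟨$⟩ʳ c)) (trans (cong toℕ (P.inverseˡ π)) (sym e)))

AdjacentIncreasing BlockIncreasing : ∀ {r} → Vec ℕ r → Perm r → Set
AdjacentIncreasing {r} lam w = ∀ (a b : Fin r) → toℕ b ≡ suc (toℕ a) → lookup lam a ≡ lookup lam b →
  toℕ (w ⟨$⟩ʳ a) < toℕ (w ⟨$⟩ʳ b)
BlockIncreasing {r} lam w = ∀ (a b : Fin r) → toℕ a < toℕ b → lookup lam a ≡ lookup lam b →
  toℕ (w ⟨$⟩ʳ a) < toℕ (w ⟨$⟩ʳ b)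

-- Equal parts give equal multiplicities in `vhw`, so starting from the identity with p and p+1
-- exchanged yields the same sequence. In that start p+1 precedes p, no sort undoes this, and w₀
-- reverses it.
κ-adjacent : ∀ {r} → 1 ≤ r → (lam : Vec ℕ r) (v : Tab r) → InB lam v → AdjacentIncreasing lam (κ v)
κ-adjacent {r} 1≤r lam v inB a b e λ≡ = go (before-keySort p r 0 w (srt p (λ k → k)) swapped)
  where
  p = toℕ a
  w = readWord v
  sp<r : suc p < r
  sp<r = subst (_< r) e (FP.toℕ<n b)
  absorbed : keySort r 0 w (srt p (λ k → k)) ≗ keySort r 0 w (λ k → k)
  absorbed = absorbs-keySort r 0 w (λ g → g) (λ e → e) (highest-vacuous r w) (λ _ ()) p
    (subst (suc p <_) (sym (+-identityʳ r)) sp<r)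
    (trans (counts a) (trans λ≡ (trans (sym (counts b)) (cong (λ x → count (suc x) (raiseAll r 0 w)) e)))) (λ k → k)
    where
    counts : ∀ c → count (suc (toℕ c)) (raiseAll r 0 w) ≡ lookup lam c
    counts c = trans (cong (count (suc (toℕ c))) (raiseAll≡vhw lam v inB)) (count-vhw lam c)
  swapped : Before p (srt p (λ k → k))
  swapped = p , suc p , n<1+n p , trans (srt-lo p (λ k → k)) (m≤n⇒m⊔n≡n (n≤1+n p)) , trans (srt-hi p (λ k → k)) (m≤n⇒m⊓n≡m (n≤1+n p))
  go : Before p (keySort r 0 w (srt p (λ k → k))) → toℕ (κ v ⟨$⟩ʳ a) < toℕ (κ v ⟨$⟩ʳ b)
  go (x , y , x<y , ex , ey) = subst₂ _<_ (sym (at a ωa)) (sym (at b ωb)) (∸-monoʳ-< (s≤s x<y) y<r)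
    where
    pos-x : pos (ω v) x ≡ suc p
    pos-x = trans (pos-ω 1≤r v x) (trans (sym (absorbed x)) ex)
    pos-y : pos (ω v) y ≡ p
    pos-y = trans (pos-ω 1≤r v y) (trans (sym (absorbed y)) ey)
    x<r = pos-inside (ω v) x sp<r pos-x
    y<r = pos-inside (ω v) y (<-trans (n<1+n p) sp<r) pos-y
    ωa : toℕ (ω v ⟨$⟩ʳ a) ≡ y
    ωa = pos⇒value (ω v) a y<r pos-y
    ωb : toℕ (ω v ⟨$⟩ʳ b) ≡ x
    ωb = pos⇒value (ω v) b x<r (trans pos-x (sym e))
    at : ∀ c {z} → toℕ (ω v ⟨$⟩ʳ c) ≡ z → toℕ (κ v ⟨$⟩ʳ c) ≡ r ∸ suc z
    at c ez = trans (FP.opposite-prop (ω v ⟨$⟩ʳ c)) (cong (λ z → r ∸ suc z) ez)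

module Cosets {r : ℕ} (lam : Vec ℕ r) (partition : IsPartition lam) where

  -- The equation wλ = w'λ in coordinates; it turns membership in a coset of the stabilizer into a
  -- pointwise condition.
  Orbit : Perm r → Perm r → Set
  Orbit w w' = ∀ a → lookup lam (w ⟨$⟩ˡ a) ≡ lookup lam (w' ⟨$⟩ˡ a)

  coset⇒orbit : ∀ w w' → SameCoset lam w w' → Orbit w w'
  coset⇒orbit w w' (u , st , e) a = trans (cong (lookup lam) (trans (cong (w ⟨$⟩ˡ_) (sym w∘u)) (P.inverseˡ w))) (st c)
    where
    c = w' ⟨$⟩ˡ a
    w∘u : w ⟨$⟩ʳ (u ⟨$⟩ʳ c) ≡ a
    w∘u = trans (sym (e c)) (P.inverseʳ w')

  orbit⇒coset : ∀ w w' → Orbit w w' → SameCoset lam w w'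
  orbit⇒coset w w' o = P.flip w · w' ,
    (λ i → trans (o (w' ⟨$⟩ʳ i)) (cong (lookup lam) (P.inverseˡ w'))) ,
    (λ i → sym (P.inverseʳ w))

  coset-sym : ∀ w w' → SameCoset lam w w' → SameCoset lam w' w
  coset-sym w w' c = orbit⇒coset w' w (sym ∘ coset⇒orbit w w' c)

  coset-trans : ∀ u v w → SameCoset lam u v → SameCoset lam v w → SameCoset lam u w
  coset-trans u v w c c' = orbit⇒coset u w λ a → trans (coset⇒orbit u v c a) (coset⇒orbit v w c' a)

  ≈⇒coset : ∀ w w' → w ≈ w' → SameCoset lam w w'
  ≈⇒coset w w' e = orbit⇒coset w w' λ a → cong (lookup lam) (⟨$⟩ˡ-cong w w' e a)

  adjacent⇒block : ∀ w → AdjacentIncreasing lam w → BlockIncreasing lam w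
  adjacent⇒block w adj a b a<b = go (toℕ b ∸ suc (toℕ a)) a b (sym (m+[n∸m]≡n a<b))
    where
    go : ∀ d a b → toℕ b ≡ suc (toℕ a + d) → lookup lam a ≡ lookup lam b → toℕ (w ⟨$⟩ʳ a) < toℕ (w ⟨$⟩ʳ b)
    go zero a b e λ≡ = adj a b (trans e (cong suc (+-identityʳ (toℕ a)))) λ≡
    go (suc d) a b e λ≡ = <-trans (go d a c c≡ (trans λ≡ (sym λc≡))) (adj c b b≡ λc≡)
      where
      c<r : suc (toℕ a + d) < r
      c<r = <-trans (≤-reflexive (trans (cong suc (sym (+-suc (toℕ a) d))) (sym e))) (FP.toℕ<n b)
      c = fromℕ< c<r
      c≡ : toℕ c ≡ suc (toℕ a + d)
      c≡ = FP.toℕ-fromℕ< c<r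
      b≡ : toℕ b ≡ suc (toℕ c)
      b≡ = trans e (trans (cong suc (+-suc (toℕ a) d)) (cong suc (sym c≡)))
      λc≡ : lookup lam c ≡ lookup lam b
      λc≡ = ≤-antisym
        (≤-trans (partition a c (≤-trans (m≤m+n (toℕ a) d) (<⇒≤ (≤-reflexive (sym c≡))))) (≤-reflexive λ≡))
        (partition c b (<⇒≤ (≤-reflexive (sym b≡))))

  value-connex : ∀ (w : Perm r) a b → a ≢ b → toℕ (w ⟨$⟩ʳ a) < toℕ (w ⟨$⟩ʳ b) ⊎ toℕ (w ⟨$⟩ʳ b) < toℕ (w ⟨$⟩ʳ a)
  value-connex w a b ne with <-cmp (toℕ (w ⟨$⟩ʳ a)) (toℕ (w ⟨$⟩ʳ b))
  ... | tri< l _ _ = inj₁ l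
  ... | tri> _ _ l = inj₂ l
  ... | tri≈ _ e _ = ⊥-elim (ne (trans (sym (P.inverseˡ w)) (trans (cong (w ⟨$⟩ˡ_) (FP.toℕ-injective e)) (P.inverseˡ w))))

  -- The permutation u⁻¹w preserves λ, so it can invert two positions only inside a block of equal
  -- parts. There both `u` and `w` increase, hence it inverts nothing and is the identity.
  block-increasing-unique : ∀ u w → BlockIncreasing lam u → BlockIncreasing lam w → Orbit u w → u ≈ w
  block-increasing-unique u w incᵤ inc o i =
    trans (cong (u ⟨$⟩ʳ_) (sym (FP.toℕ-injective (trans (cong (λ k → toℕ (v k)) (sym (FP.fromℕ<-toℕ i (FP.toℕ<n i))))
        (trans (sym (f-fromℕ< (FP.toℕ<n i))) (increasing⇒id {r} f f-inc f-< (toℕ i) (FP.toℕ<n i)))))))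
      (P.inverseʳ u)
    where
    v : Fin r → Fin r
    v c = u ⟨$⟩ˡ (w ⟨$⟩ʳ c)
    λv : ∀ c → lookup lam (v c) ≡ lookup lam c
    λv c = trans (o (w ⟨$⟩ʳ c)) (cong (lookup lam) (P.inverseˡ w))
    v-inc : ∀ a b → toℕ a < toℕ b → toℕ (v a) < toℕ (v b)
    v-inc a b a<b with toℕ (v a) <? toℕ (v b)
    ... | yes p = p
    ... | no np = ⊥-elim (bad (m≤n⇒m<n∨m≡n (≮⇒≥ np)))
      where
      λ≡ : lookup lam a ≡ lookup lam b
      λ≡ = ≤-antisym (≤-trans (≤-reflexive (sym (λv a))) (≤-trans (partition (v b) (v a) (≮⇒≥ np)) (≤-reflexive (λv b))))
             (partition a b (<⇒≤ a<b))
      wa<wb = inc a b a<b λ≡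
      bad : toℕ (v b) < toℕ (v a) ⊎ toℕ (v b) ≡ toℕ (v a) → ⊥
      bad (inj₁ p) = <-asym wa<wb (subst₂ (λ x y → toℕ x < toℕ y) (P.inverseʳ u) (P.inverseʳ u)
        (incᵤ (v b) (v a) p (trans (λv b) (trans (sym λ≡) (sym (λv a))))))
      bad (inj₂ e) = <-irrefl (cong toℕ (trans (sym (P.inverseʳ u)) (trans (cong (u ⟨$⟩ʳ_) (sym (FP.toℕ-injective e))) (P.inverseʳ u)))) wa<wb
    f : ℕ → ℕ
    f k with k <? r
    ... | yes p = toℕ (v (fromℕ< p))
    ... | no _ = k
    f-fromℕ< : ∀ {k} (p : k < r) → f k ≡ toℕ (v (fromℕ< p))
    f-fromℕ< {k} p with k <? r
    ... | yes p' = cong (toℕ ∘ v) (FP.fromℕ<-cong k k refl p' p)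
    ... | no np = ⊥-elim (np p)
    f-inc : ∀ q → suc q < r → f q < f (suc q)
    f-inc q p = subst₂ _<_ (sym (f-fromℕ< q<r)) (sym (f-fromℕ< p)) (v-inc (fromℕ< q<r) (fromℕ< p)
      (≤-reflexive (trans (cong suc (FP.toℕ-fromℕ< q<r)) (sym (FP.toℕ-fromℕ< p)))))
      where q<r = <-trans (n<1+n q) p
    f-< : ∀ k → k < r → f k < r
    f-< k p = subst (_< r) (sym (f-fromℕ< p)) (FP.toℕ<n (v (fromℕ< p)))

  AdjacentDescent : Perm r → Fin r → Fin r → Set
  AdjacentDescent w a b = toℕ b ≡ suc (toℕ a) × lookup lam a ≡ lookup lam b × toℕ (w ⟨$⟩ʳ b) < toℕ (w ⟨$⟩ʳ a)

  adjacent-descent? : ∀ w → Dec (Σ (Fin r) λ a → Σ (Fin r) (AdjacentDescent w a))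
  adjacent-descent? w = FP.any? λ a → FP.any? λ b →
    (toℕ b ≟ suc (toℕ a)) ×-dec ((lookup lam a ≟ lookup lam b) ×-dec (toℕ (w ⟨$⟩ʳ b) <? toℕ (w ⟨$⟩ʳ a)))

  -- Bubble sort within the blocks: each removed adjacent descent is one Bruhat step down inside the
  -- coset. When none is left, uniqueness identifies the result with `u`.
  block-increasing-minimal : ∀ u → BlockIncreasing lam u → ∀ n w → len w ≤ n → Orbit u w → u ≤B w
  block-increasing-minimal u incᵤ n w l o with adjacent-descent? w
  ... | no none = ≤B-refl (block-increasing-unique u w incᵤ (adjacent⇒block w adj) o)
    where
    adj : AdjacentIncreasing lam w
    adj a b e λ≡ with value-connex w a b (λ { refl → <-irrefl e (n<1+n _) })
    ... | inj₁ p = p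
    ... | inj₂ p = ⊥-elim (none (a , b , e , λ≡ , p))
  ... | yes (a , b , e , λ≡ , p) = smaller n l
    where
    x = toℕ (w ⟨$⟩ʳ b)
    y = toℕ (w ⟨$⟩ʳ a)
    -- Exchanging the positions a and b is multiplication on the right; it is written as the left
    -- transposition of the two values, the form required by the Bruhat order.
    t = transpose (w ⟨$⟩ʳ b) (w ⟨$⟩ʳ a)
    at : ∀ c → pos w (toℕ (w ⟨$⟩ʳ c)) ≡ toℕ c
    at c = trans (pos-toℕ w (w ⟨$⟩ʳ c)) (cong toℕ (P.inverseˡ w))
    pos-t : pos (t · w) ≗ pos w ∘ swap x y
    pos-t = pos-transpose (w ⟨$⟩ʳ b) (w ⟨$⟩ʳ a) w
    R : Reflects (t · w) w
    R = reflection x y p (FP.toℕ<n (w ⟨$⟩ʳ a))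
      (subst₂ _<_ (sym (trans (pos-t x) (trans (cong (pos w) (swap-a x y)) (at a))))
                 (sym (trans (pos-t y) (trans (cong (pos w) (swap-b x y)) (at b)))) (≤-reflexive (sym e)))
      λ k → trans (cong (pos w) (sym (swap-involutive x y k))) (sym (pos-t (swap x y k)))
    o' : Orbit u (t · w)
    o' c = trans (o c) (orb c)
      where
      orb : ∀ c → lookup lam (w ⟨$⟩ˡ c) ≡ lookup lam (w ⟨$⟩ˡ PC.transpose (w ⟨$⟩ʳ a) (w ⟨$⟩ʳ b) c)
      orb c with c FP.≟ (w ⟨$⟩ʳ a)
      ... | yes refl = trans (cong (lookup lam) (P.inverseˡ w)) (trans λ≡ (cong (lookup lam) (sym (P.inverseˡ w))))
      ... | no _ with c FP.≟ (w ⟨$⟩ʳ b)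
      ...   | yes refl = trans (cong (lookup lam) (P.inverseˡ w)) (trans (sym λ≡) (cong (lookup lam) (sym (P.inverseˡ w))))
      ...   | no _ = refl
    smaller : ∀ n → len w ≤ n → u ≤B w
    smaller zero l = contradiction (≤-trans (reflects-len R) l) λ ()
    smaller (suc n) l = ≤B-reflects
      (block-increasing-minimal u incᵤ n (t · w) (≤-pred (≤-trans (reflects-len R) l)) o') R

≤B⇒len≤ : ∀ {r} {u w : Perm r} → u ≤B w → len u ≤ len w
≤B⇒len≤ {u = u} {w} (≤B-refl e) = ≤-reflexive (len-cong u w e)
≤B⇒len≤ {w = w} (≤B-step {v = v} h a b ne l e) =
  ≤-trans (≤B⇒len≤ h) (<⇒≤ (≤-trans l (≤-reflexive (sym (len-cong w (transpose a b · v) e)))))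

≤B-len⇒≈ : ∀ {r} {u w : Perm r} → u ≤B w → len w ≤ len u → u ≈ w
≤B-len⇒≈ (≤B-refl e) _ = e
≤B-len⇒≈ {w = w} (≤B-step {v = v} h a b ne l e) le = ⊥-elim (<-irrefl refl
  (≤-trans (≤-trans l (≤-reflexive (sym (len-cong w (transpose a b · v) e)))) (≤-trans le (≤B⇒len≤ h))))

-- Tableaux of extremal weight

rowWeak-append : ∀ x k row → RowWeak row → All (_≤ x) row → RowWeak (row ++ replicate k x)
rowWeak-append x zero [] _ _ = tt
rowWeak-append x (suc zero) [] _ _ = tt
rowWeak-append x (suc (suc k)) [] _ _ = ≤-refl , rowWeak-append x (suc k) [] tt []
rowWeak-append x zero (y ∷ []) _ _ = tt
rowWeak-append x (suc k) (y ∷ []) _ (p ∷ _) = p , rowWeak-append x (suc k) [] tt []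
rowWeak-append x k (y ∷ z ∷ row) (p , r) (_ ∷ a) = p , rowWeak-append x k (z ∷ row) r a

colStrict-append : ∀ x k as bs → ColStrict as bs → All (_< x) as → length bs + k ≤ length as → ColStrict as (bs ++ replicate k x)
colStrict-append x zero as [] _ _ _ = tt
colStrict-append x (suc k) (a ∷ as) [] _ (p ∷ ps) (s≤s l) = p , colStrict-append x k as [] tt ps l
colStrict-append x k (a ∷ as) (b ∷ bs) (p , c) (_ ∷ ps) (s≤s l) = p , colStrict-append x k as bs c ps l

colStrict-widen : ∀ as cs ys → ColStrict as ys → ColStrict (as ++ cs) ys
colStrict-widen as cs [] _ = tt
colStrict-widen (a ∷ as) cs (y ∷ ys) (p , c) = p , colStrict-widen as cs ys c

fillRow : ℕ → ℕ → List ℕ → List ℕ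
fillRow x k row = row ++ replicate (k ∸ length row) x

-- Adds a horizontal strip of letters `x`, the last row being new. Interlacing of the shapes ensures
-- that no column receives two of them.
extend : ∀ {n} → ℕ → Vec ℕ (suc n) → Vec (List ℕ) n → Vec (List ℕ) (suc n)
extend x (k ∷ lam) [] = fillRow x k [] ∷ []
extend x (k ∷ lam) (row ∷ T) = fillRow x k row ∷ extend x lam T

Interlaces : ∀ {n} → Vec ℕ (suc n) → Vec (List ℕ) n → Set
Interlaces {n} lam T = ∀ (j : Fin n) → length (lookup T j) ≤ lookup lam (F.inject₁ j) × lookup lam (F.suc j) ≤ length (lookup T j)

module _ (x : ℕ) where

  fillRow-length : ∀ k row → length row ≤ k → length (fillRow x k row) ≡ k
  fillRow-length k row p = trans (LP.length-++ row) (trans (cong (length row +_) (LP.length-replicate (k ∸ length row))) (m+[n∸m]≡n p))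

  extend-length : ∀ {n} (lam : Vec ℕ (suc n)) T → Interlaces lam T → ∀ j → length (lookup (extend x lam T) j) ≡ lookup lam j
  extend-length (k ∷ lam) [] _ F.zero = fillRow-length k [] z≤n
  extend-length (k ∷ lam) (row ∷ T) i F.zero = fillRow-length k row (proj₁ (i F.zero))
  extend-length (k ∷ lam) (row ∷ T) i (F.suc j) = extend-length lam T (i ∘ F.suc) j

  extend-row : ∀ {n} (Q : List ℕ → Set) → (∀ k → Q (fillRow x k [])) → (lam : Vec ℕ (suc n)) → ∀ T →
    (∀ j k → Q (fillRow x k (lookup T j))) → ∀ j → Q (lookup (extend x lam T) j)
  extend-row Q q₀ (k ∷ lam) [] _ F.zero = q₀ k
  extend-row Q q₀ (k ∷ lam) (row ∷ T) q F.zero = q F.zero k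
  extend-row Q q₀ (k ∷ lam) (row ∷ T) q (F.suc j) = extend-row Q q₀ lam T (q ∘ F.suc) j

  extend-cols : ∀ {n} (lam : Vec ℕ (suc n)) T → Interlaces lam T → (∀ j → All (_< x) (lookup T j)) → ColsOK T → ColsOK (extend x lam T)
  extend-cols (k ∷ lam) [] _ _ _ = tt
  extend-cols (k ∷ k' ∷ []) (a ∷ []) i bd _ =
    colStrict-widen a _ _ (colStrict-append x k' a [] tt (bd F.zero) (proj₂ (i F.zero))) , tt
  extend-cols (k ∷ k' ∷ lam) (a ∷ b ∷ T) i bd (c , ok) =
    colStrict-widen a _ _ (colStrict-append x (k' ∸ length b) a b c (bd F.zero)
      (≤-trans (≤-reflexive (m+[n∸m]≡n (proj₁ (i (F.suc F.zero))))) (proj₂ (i F.zero)))) ,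
    extend-cols (k' ∷ lam) (b ∷ T) (i ∘ F.suc) (bd ∘ F.suc) ok

  count-fillRow : ∀ y k row → y ≢ x → count y (fillRow x k row) ≡ count y row
  count-fillRow y k row ne = trans (count-++ y row _) (trans (cong (count y row +_) (count-replicate-≢ (k ∸ length row) y x ne)) (+-identityʳ _))

  count-extend-old : ∀ {n} y (lam : Vec ℕ (suc n)) T → y ≢ x → count y (readWord (extend x lam T)) ≡ count y (readWord T)
  count-extend-old y (k ∷ lam) [] ne = count-fillRow y k [] ne
  count-extend-old y (k ∷ lam) (row ∷ T) ne = trans (count-++ y (readWord (extend x lam T)) _)
    (trans (cong₂ _+_ (count-extend-old y lam T ne) (count-fillRow y k row ne)) (sym (count-++ y (readWord T) row)))

  count-absent : ∀ row → All (_< x) row → count x row ≡ 0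
  count-absent [] [] = refl
  count-absent (y ∷ row) (p ∷ a) rewrite ≡ᵇ-no {x} {y} (<⇒≢ p ∘ sym) = count-absent row a

  count-fillRow-new : ∀ k row → All (_< x) row → count x (fillRow x k row) ≡ k ∸ length row
  count-fillRow-new k row a = trans (count-++ x row _) (cong₂ _+_ (count-absent row a) (count-replicate (k ∸ length row) x))

  count-extend-new : ∀ {n} (lam : Vec ℕ (suc n)) T → Interlaces lam T → (∀ j → All (_< x) (lookup T j)) →
    count x (readWord (extend x lam T)) + ∑ (λ j → length (lookup T j)) ≡ ∑ (lookup lam)
  count-extend-new (k ∷ []) [] _ _ = cong (_+ 0) (count-fillRow-new k [] [])
  count-extend-new (k ∷ lam) (row ∷ T) i bd = begin
    count x (readWord (extend x lam T) ++ fillRow x k row) + (length row + L)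
      ≡⟨ cong (_+ (length row + L)) (trans (count-++ x (readWord (extend x lam T)) _) (cong (c +_) (count-fillRow-new k row (bd F.zero)))) ⟩
    (c + (k ∸ length row)) + (length row + L)
      ≡⟨ +-assoc c (k ∸ length row) _ ⟩
    c + ((k ∸ length row) + (length row + L))
      ≡⟨ cong (c +_) (trans (sym (+-assoc (k ∸ length row) (length row) L)) (cong (_+ L) (m∸n+n≡m (proj₁ (i F.zero))))) ⟩
    c + (k + L)
      ≡⟨ trans (sym (+-assoc c k L)) (trans (cong (_+ L) (+-comm c k)) (+-assoc k c L)) ⟩
    k + (c + L)
      ≡⟨ cong (k +_) (count-extend-new lam T (i ∘ F.suc) (bd ∘ F.suc)) ⟩
    k + ∑ (lookup lam) ∎
    where
    open ≡-Reasoning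
    c = count x (readWord (extend x lam T))
    L = ∑ (λ j → length (lookup T j))

punchIn-near : ∀ {n} (i : Fin (suc n)) (j : Fin n) → toℕ j ≤ toℕ (F.punchIn i j) × toℕ (F.punchIn i j) ≤ suc (toℕ j)
punchIn-near F.zero j = n≤1+n _ , ≤-refl
punchIn-near (F.suc i) F.zero = z≤n , z≤n
punchIn-near (F.suc i) (F.suc j) with punchIn-near i j
... | p , q = s≤s p , s≤s q

punchIn-last : ∀ {n} (j : Fin n) → F.punchIn (F.fromℕ n) j ≡ F.inject₁ j
punchIn-last F.zero = refl
punchIn-last (F.suc j) = cong F.suc (punchIn-last j)

HasWeight : ∀ {r} → Vec ℕ r → Perm r → Tab r → Set
HasWeight {r} lam w T = ∀ (a : Fin r) → count (suc (toℕ a)) (readWord T) ≡ lookup lam (w ⟨$⟩ˡ a)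

-- Recursion on the largest letter, which must occur λ_k times, where k is the preimage of the last
-- index under w. Deleting λ_k from λ leaves an interlacing partition; the strip that restores λ has
-- size |λ| - |λ'| = λ_k.
weight-exists : ∀ {r} (lam : Vec ℕ r) → IsPartition lam → (w : Perm r) → Σ (Tab r) λ T → InB lam T × HasWeight lam w T
weight-exists {zero} [] _ w = [] , ((λ ()) , (λ ()) , (λ ()) , tt) , λ ()
weight-exists {suc n} lam part w = T , (extend-length x lam T' inter ,
    extend-row x (InRange (suc n)) (λ k → inRange-fill k [] []) lam T' (λ j k → inRange-fill k _ (widen (proj₁ (proj₂ b') j))) ,
    extend-row x RowWeak (λ k → rowWeak-append x k [] tt []) lam T'
      (λ j k → rowWeak-append x _ _ (proj₁ (proj₂ (proj₂ b')) j) (All.map (λ p → m≤n⇒m≤1+n (proj₂ p)) (proj₁ (proj₂ b') j))) ,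
    extend-cols x lam T' inter small (proj₂ (proj₂ (proj₂ b')))) , weight
  where
  x = suc n
  last = F.fromℕ n
  k = w ⟨$⟩ˡ last
  w' : Perm n
  w' = P.remove k w
  lam' : Vec ℕ n
  lam' = tabulate λ j → lookup lam (F.punchIn k j)
  lam'≡ : ∀ j → lookup lam' j ≡ lookup lam (F.punchIn k j)
  lam'≡ j = VP.lookup∘tabulate _ j
  part' : IsPartition lam'
  part' i j p = subst₂ _≤_ (sym (lam'≡ j)) (sym (lam'≡ i)) (part _ _ (FP.punchIn-mono-≤ k i j p))
  IH = weight-exists lam' part' w'
  T' = proj₁ IH
  b' = proj₁ (proj₂ IH)
  weight' = proj₂ (proj₂ IH)
  T = extend x lam T'
  inter : Interlaces lam T'
  inter j rewrite proj₁ b' j | lam'≡ j =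
    part _ _ (≤-trans (≤-reflexive (FP.toℕ-inject₁ j)) (proj₁ (punchIn-near k j))) ,
    part _ _ (proj₂ (punchIn-near k j))
  small : ∀ j → All (_< x) (lookup T' j)
  small j = All.map (λ p → s≤s (proj₂ p)) (proj₁ (proj₂ b') j)
  widen : ∀ {row} → InRange n row → InRange (suc n) row
  widen = All.map λ (p , q) → p , m≤n⇒m≤1+n q
  inRange-fill : ∀ k row → InRange (suc n) row → InRange (suc n) (fillRow x k row)
  inRange-fill k row a = AP.++⁺ a (AP.replicate⁺ (k ∸ length row) (s≤s z≤n , ≤-refl))
  punch : ∀ b → w ⟨$⟩ˡ F.inject₁ b ≡ F.punchIn k (w' ⟨$⟩ˡ b)
  punch b = begin
    w ⟨$⟩ˡ F.inject₁ b
      ≡⟨ cong (w ⟨$⟩ˡ_) (punchIn-last b) ⟨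
    w ⟨$⟩ˡ F.punchIn last b
      ≡⟨ cong (λ c → w ⟨$⟩ˡ F.punchIn last c) (P.inverseʳ w') ⟨
    w ⟨$⟩ˡ F.punchIn last (w' ⟨$⟩ʳ (w' ⟨$⟩ˡ b))
      ≡⟨ cong (w ⟨$⟩ˡ_) (P.punchIn-permute′ w last (w' ⟨$⟩ˡ b)) ⟨
    w ⟨$⟩ˡ (w ⟨$⟩ʳ F.punchIn k (w' ⟨$⟩ˡ b))
      ≡⟨ P.inverseˡ w ⟩
    F.punchIn k (w' ⟨$⟩ˡ b) ∎
    where open ≡-Reasoning
  weight-last : count x (readWord T) ≡ lookup lam k
  weight-last = +-cancelʳ-≡ (∑ (lookup lam')) _ _ (begin
    count x (readWord T) + ∑ (lookup lam')
      ≡⟨ cong (count x (readWord T) +_) (sum-cong-≗ (proj₁ b')) ⟨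
    count x (readWord T) + ∑ (λ j → length (lookup T' j))
      ≡⟨ count-extend-new x lam T' inter small ⟩
    ∑ (lookup lam)
      ≡⟨ sum-remove {i = k} (lookup lam) ⟩
    lookup lam k + ∑ (λ j → lookup lam (F.punchIn k j))
      ≡⟨ cong (lookup lam k +_) (sum-cong-≗ lam'≡) ⟨
    lookup lam k + ∑ (lookup lam') ∎)
    where open ≡-Reasoning
  weight : HasWeight lam w T
  weight a with n ≟ toℕ a
  ... | yes e = trans (cong (λ m → count (suc m) (readWord T)) (sym e))
          (trans weight-last (cong (λ c → lookup lam (w ⟨$⟩ˡ c)) (FP.toℕ-injective (trans (FP.toℕ-fromℕ n) e))))
  ... | no ne = begin
    count (suc (toℕ a)) (readWord T)
      ≡⟨ count-extend-old x (suc (toℕ a)) lam T' (ne ∘ sym ∘ suc-injective) ⟩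
    count (suc (toℕ a)) (readWord T')
      ≡⟨ cong (λ m → count (suc m) (readWord T')) (trans (cong toℕ (sym a≡)) (FP.toℕ-inject₁ b)) ⟩
    count (suc (toℕ b)) (readWord T')
      ≡⟨ weight' b ⟩
    lookup lam' (w' ⟨$⟩ˡ b)
      ≡⟨ lam'≡ (w' ⟨$⟩ˡ b) ⟩
    lookup lam (F.punchIn k (w' ⟨$⟩ˡ b))
      ≡⟨ cong (lookup lam) (punch b) ⟨
    lookup lam (w ⟨$⟩ˡ F.inject₁ b)
      ≡⟨ cong (λ c → lookup lam (w ⟨$⟩ˡ c)) a≡ ⟩
    lookup lam (w ⟨$⟩ˡ a) ∎
    where
    open ≡-Reasoning
    b = F.lower₁ a ne
    a≡ : F.inject₁ b ≡ a
    a≡ = FP.inject₁-lower₁ a ne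

-- Convexity and tableaux whose weight rearranges λ

∑-change-two : ∀ {n} q (f g : ℕ → ℕ) → suc q < n → (∀ k → k ≢ q → k ≢ suc q → f k ≡ g k) →
  ∑ {n} (f ∘ toℕ) + (g q + g (suc q)) ≡ ∑ {n} (g ∘ toℕ) + (f q + f (suc q))
∑-change-two {suc (suc n)} zero f g _ same = begin
  f 0 + (f 1 + R) + G  ≡⟨ cong (_+ G) (+-assoc (f 0) (f 1) R) ⟨
  f 0 + f 1 + R + G    ≡⟨ +-assoc (f 0 + f 1) R G ⟩
  f 0 + f 1 + (R + G)  ≡⟨ +-comm (f 0 + f 1) (R + G) ⟩
  R + G + (f 0 + f 1)  ≡⟨ cong (_+ (f 0 + f 1)) (trans (+-comm R G) (trans (+-assoc (g 0) (g 1) R) (cong (λ z → g 0 + (g 1 + z)) R≡))) ⟩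
  g 0 + (g 1 + ∑ {n} (λ i → g (suc (suc (toℕ i))))) + (f 0 + f 1) ∎
  where
  open ≡-Reasoning
  G = g 0 + g 1
  R = ∑ {n} (λ i → f (suc (suc (toℕ i))))
  R≡ : R ≡ ∑ {n} (λ i → g (suc (suc (toℕ i))))
  R≡ = sum-cong-≗ {n} λ i → same (suc (suc (toℕ i))) (λ ()) (λ ())
∑-change-two {suc zero} zero f g (s≤s ()) same
∑-change-two {suc n} (suc q) f g (s≤s p) same = trans (+-assoc (f 0) _ _) (trans (cong₂ _+_ (same 0 (λ ()) (λ ()))
  (∑-change-two q (f ∘ suc) (g ∘ suc) p (λ k x y → same (suc k) (x ∘ suc-injective) (y ∘ suc-injective)))) (sym (+-assoc (g 0) _ _)))

-- Convexity of x ↦ x ∸ c.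
spread-≤ : ∀ c {s t s' t'} → s ≤ s' → t ≤ s' → s' + t' ≡ s + t → (s ∸ c) + (t ∸ c) ≤ (s' ∸ c) + (t' ∸ c)
spread-≤ c {s} {t} {s'} {t'} p q e with ≤-total s c | ≤-total t c
... | inj₁ s≤c | _ rewrite m≤n⇒m∸n≡0 s≤c = ≤-trans (∸-monoˡ-≤ c q) (m≤m+n _ _)
... | inj₂ _ | inj₁ t≤c rewrite m≤n⇒m∸n≡0 t≤c | +-identityʳ (s ∸ c) = ≤-trans (∸-monoˡ-≤ c p) (m≤m+n _ _)
... | inj₂ c≤s | inj₂ c≤t = +-cancelʳ-≤ (c + c) _ _ (≤-trans (≤-reflexive (trans (regroup (s ∸ c) (t ∸ c)) (cong₂ _+_ (m∸n+n≡m c≤s) (m∸n+n≡m c≤t))))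
    (≤-trans (≤-reflexive (sym e)) (≤-trans (+-mono-≤ (bound s') (bound t')) (≤-reflexive (sym (regroup (s' ∸ c) (t' ∸ c)))))))
  where
  bound : ∀ m → m ≤ m ∸ c + c
  bound m = ≤-trans (m≤n+m∸n m c) (≤-reflexive (+-comm c (m ∸ c)))
  regroup : ∀ a b → a + b + (c + c) ≡ (a + c) + (b + c)
  regroup a b = trans (+-assoc a b (c + c)) (trans (cong (a +_) (trans (sym (+-assoc b c c)) (trans (cong (_+ c) (+-comm b c)) (+-assoc c b c)))) (sym (+-assoc a c (b + c))))

-- For varying `c` these convex sums test majorization between weights of equal total.
excess : ℕ → ℕ → List ℕ → ℕ
excess r c w = ∑ {r} (λ a → count (suc (toℕ a)) w ∸ c)

count-E-sum : ∀ i w → count i (E₀ i w) + count (suc i) (E₀ i w) ≡ count i w + count (suc i) w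
count-E-sum i w = begin
  count i (E₀ i w) + count (suc i) (E₀ i w)       ≡⟨ cong (_+ count (suc i) (E₀ i w)) (count-E-lo i 0 w) ⟩
  count i w + ε₀ i w + count (suc i) (E₀ i w)     ≡⟨ +-assoc (count i w) (ε₀ i w) _ ⟩
  count i w + (ε₀ i w + count (suc i) (E₀ i w))   ≡⟨ cong (count i w +_) (trans (+-comm (ε₀ i w) _) (count-E-hi i 0 w)) ⟩
  count i w + count (suc i) w                     ∎
  where open ≡-Reasoning

count-lo-≤-E : ∀ i w → count i w ≤ count i (E₀ i w)
count-lo-≤-E i w = ≤-trans (m≤m+n _ (ε₀ i w)) (≤-reflexive (sym (count-E-lo i 0 w)))

module _ {r : ℕ} (q : ℕ) (p : suc q < r) (w : List ℕ) where
  private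
    f g : ℕ → ℕ → ℕ
    f c k = count (suc k) w ∸ c
    g c k = count (suc k) (E₀ (suc q) w) ∸ c

    change : ∀ c → excess r c w + (g c q + g c (suc q)) ≡ excess r c (E₀ (suc q) w) + (f c q + f c (suc q))
    change c = ∑-change-two q (f c) (g c) p λ k x y →
      cong (_∸ c) (sym (count-E-neither (suc q) (suc k) 0 w (neither-of k x y)))
      where
      neither-of : ∀ k → k ≢ q → k ≢ suc q → cls q k ≡ neither
      neither-of k x y with cls q k in eq
      ... | lo = ⊥-elim (x (lo⇒≡ q k eq))
      ... | hi = ⊥-elim (y (hi⇒≡ q k eq))
      ... | neither = refl

    spread : ∀ c → f c q + f c (suc q) ≤ g c q + g c (suc q)
    spread c = spread-≤ c (count-lo-≤-E (suc q) w) (count-≤-E (suc q) w) (count-E-sum (suc q) w)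

  excess-E : ∀ c → excess r c w ≤ excess r c (E₀ (suc q) w)
  excess-E c = +-cancelʳ-≤ (f c q + f c (suc q)) _ _
    (≤-trans (+-monoʳ-≤ (excess r c w) (spread c)) (≤-reflexive (change c)))

  excess-E-max : (∀ c → excess r c w ≡ excess r c (E₀ (suc q) w)) →
    count (suc q) (E₀ (suc q) w) ≡ count (suc q) w ⊔ count (2 + q) w
  excess-E-max e = ≤-antisym
    (m∸n≡0⇒m≤n (m+n≡0⇒m≡0 _ (trans (sym same) (cong₂ _+_ (m≤n⇒m∸n≡0 (m≤m⊔n (count (suc q) w) (count (2 + q) w))) (m≤n⇒m∸n≡0 (m≤n⊔m (count (suc q) w) (count (2 + q) w)))))))
    (⊔-lub (count-lo-≤-E (suc q) w) (count-≤-E (suc q) w))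
    where
    -- At c = M both old multiplicities contribute 0. Equality of the excesses leaves no room for a
    -- new multiplicity above M.
    M = count (suc q) w ⊔ count (2 + q) w
    same : f M q + f M (suc q) ≡ g M q + g M (suc q)
    same = sym (+-cancelˡ-≡ (excess r M w) _ _ (trans (change M) (cong (_+ (f M q + f M (suc q))) (sym (e M)))))

excess-raise : ∀ r c k i w → 1 ≤ i → i + k ≤ r → excess r c w ≤ excess r c (raise i k w)
excess-raise r c zero i w _ _ = ≤-refl
excess-raise r c (suc k) (suc q) w _ l = ≤-trans
  (excess-E {r} q (≤-trans (s≤s (s≤s (m≤m+n q k))) l') w c)
  (excess-raise r c k (2 + q) (E₀ (suc q) w) (s≤s z≤n) l')
  where l' = ≤-trans (≤-reflexive (cong suc (sym (+-suc q k)))) l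

excess-raiseAll : ∀ r c j m w → j + m ≤ r → excess r c w ≤ excess r c (raiseAll j m w)
excess-raiseAll r c zero m w _ = ≤-refl
excess-raiseAll r c (suc j) m w l = ≤-trans (excess-raise r c m (suc j) w (s≤s z≤n) l)
  (excess-raiseAll r c j (suc m) (raise (suc j) m w) (≤-trans (≤-reflexive (+-suc j m)) l))

partAt : ∀ {r} → Vec ℕ r → ℕ → ℕ
partAt [] k = 0
partAt (l ∷ lam) zero = l
partAt (l ∷ lam) (suc k) = partAt lam k

part-lookup : ∀ {r} (lam : Vec ℕ r) a → partAt lam (toℕ a) ≡ lookup lam a
part-lookup (l ∷ lam) F.zero = refl
part-lookup (l ∷ lam) (F.suc a) = part-lookup lam a

part-outside : ∀ {r} (lam : Vec ℕ r) k → r ≤ k → partAt lam k ≡ 0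
part-outside [] k _ = refl
part-outside (l ∷ lam) (suc k) (s≤s p) = part-outside lam k p

part-fromℕ< : ∀ {r} (lam : Vec ℕ r) {k} (p : k < r) → partAt lam k ≡ lookup lam (fromℕ< p)
part-fromℕ< lam p = trans (cong (partAt lam) (sym (FP.toℕ-fromℕ< p))) (part-lookup lam (fromℕ< p))

module Extremal {r : ℕ} (1≤r : 1 ≤ r) (lam : Vec ℕ r) (partition : IsPartition lam) where

  parts : (ℕ → ℕ) → ℕ → ℕ
  parts g k = partAt lam (g k)

  part-antitone : ∀ {k k'} → k ≤ k' → partAt lam k' ≤ partAt lam k
  part-antitone {k} {k'} p with <-≤-connex k' r
  ... | inj₂ out = ≤-trans (≤-reflexive (part-outside lam k' out)) z≤n
  ... | inj₁ k'<r = subst₂ _≤_ (sym (part-fromℕ< lam k'<r)) (sym (part-fromℕ< lam k<r))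
        (partition (fromℕ< k<r) (fromℕ< k'<r) (subst₂ _≤_ (sym (FP.toℕ-fromℕ< k<r)) (sym (FP.toℕ-fromℕ< k'<r)) p))
    where k<r = ≤-<-trans p k'<r

  part-⊔ : ∀ x y → partAt lam (x ⊔ y) ≡ partAt lam x ⊓ partAt lam y
  part-⊔ = antimono-≤-distrib-⊔ part-antitone

  part-⊓ : ∀ x y → partAt lam (x ⊓ y) ≡ partAt lam x ⊔ partAt lam y
  part-⊓ = antimono-≤-distrib-⊓ part-antitone

  -- An extremal word is a tableau word whose weight is a rearrangement of λ;
  -- equivalently, its excesses are maximal.
  ExtremalWord : List ℕ → Set
  ExtremalWord w = Σ (Tab r) λ T → InB lam T × readWord T ≡ w × (∀ c → excess r c w ≡ ∑ (λ a → lookup lam a ∸ c))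

  excess-≤ : ∀ T → InB lam T → ∀ c → excess r c (readWord T) ≤ ∑ (λ a → lookup lam a ∸ c)
  excess-≤ T b c = ≤-trans (excess-raiseAll r c r 0 (readWord T) (≤-reflexive (+-identityʳ r)))
    (≤-reflexive (trans (cong (excess r c) (raiseAll≡vhw lam T b)) (sum-cong-≗ λ a → cong (_∸ c) (count-vhw lam a))))

  -- The excesses cannot fall under `E`, and those of λ bound them for every tableau of the shape.
  -- Being already at the bound, they stay there, so the operator can only sort the two
  -- multiplicities.
  extremal-E : ∀ q → suc q < r → ∀ {w} → ExtremalWord w →
    ExtremalWord (E₀ (suc q) w) × count (suc q) (E₀ (suc q) w) ≡ count (suc q) w ⊔ count (2 + q) w
  extremal-E q p {w} (T , b , refl , e) =
    (T' , b' , readWord-raiseRows (suc q) 0 T , e') ,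
    excess-E-max q p w λ c → trans (e c) (sym (e' c))
    where
    T' = raiseRows (suc q) 0 T
    b' = inB-raiseRows lam (s≤s z≤n) T b
    e' : ∀ c → excess r c (E₀ (suc q) w) ≡ ∑ (λ a → lookup lam a ∸ c)
    e' c = ≤-antisym
      (≤-trans (≤-reflexive (cong (excess r c) (sym (readWord-raiseRows (suc q) 0 T)))) (excess-≤ T' b' c))
      (≤-trans (≤-reflexive (sym (e c))) (excess-E q p w c))

  extremal-raise : ∀ k i w → 1 ≤ i → i + k ≤ r → ExtremalWord w → ExtremalWord (raise i k w)
  extremal-raise zero i w _ _ x = x
  extremal-raise (suc k) (suc q) w _ l x = extremal-raise k (2 + q) (E₀ (suc q) w) (s≤s z≤n) l'
      (proj₁ (extremal-E q (≤-trans (s≤s (s≤s (m≤m+n q k))) l') x))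
    where l' = ≤-trans (≤-reflexive (cong suc (sym (+-suc q k)))) l

  -- With vanishing strings every reflection is circled. Sorting indices decreasingly sorts parts
  -- increasingly, so a largest part in front is carried to the end while the others move forward
  -- one place.
  zero-block : ∀ bs q g → AllZero bs → (∀ p → p ≤ length bs → partAt lam (g (q + p)) ≤ partAt lam (g q)) →
    (∀ p → p < length bs → partAt lam (block q bs g (q + p)) ≡ partAt lam (g (suc q + p))) ×
    partAt lam (block q bs g (q + length bs)) ≡ partAt lam (g q)
  zero-block [] q g _ _ rewrite +-identityʳ q = (λ _ ()) , refl
  zero-block (b ∷ bs) q g (refl ∷ z) top rewrite ≡ᵇ-yes {0} {head₀ bs} (sym (head₀-zero z)) = shifted , trans (cong (parts (block (suc q) bs (srt q g))) (+-suc q (length bs))) (trans (proj₂ IH) at-q+1)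
    where
    next≤ : partAt lam (g (suc q)) ≤ partAt lam (g q)
    next≤ = subst (λ k → partAt lam (g k) ≤ partAt lam (g q)) (+-comm q 1) (top 1 (s≤s z≤n))
    at-q : partAt lam (srt q g q) ≡ partAt lam (g (suc q))
    at-q = trans (cong (partAt lam) (srt-lo q g)) (trans (part-⊔ (g q) (g (suc q))) (m≥n⇒m⊓n≡n next≤))
    at-q+1 : partAt lam (srt q g (suc q)) ≡ partAt lam (g q)
    at-q+1 = trans (cong (partAt lam) (srt-hi q g)) (trans (part-⊓ (g q) (g (suc q))) (m≥n⇒m⊔n≡m next≤))
    far : ∀ p → srt q g (suc q + suc p) ≡ g (q + (2 + p))
    far p = trans (srt-neither q g _ (cls-≥ q _ (s≤s (≤-trans (≤-reflexive (+-comm 1 q)) (+-monoʳ-≤ q (s≤s z≤n))))))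
      (cong g (sym (+-suc q (suc p))))
    top' : ∀ p → p ≤ length bs → partAt lam (srt q g (suc q + p)) ≤ partAt lam (srt q g (suc q))
    top' zero _ = ≤-reflexive (cong (parts (srt q g)) (+-identityʳ (suc q)))
    top' (suc p) l = ≤-trans (≤-reflexive (cong (partAt lam) (far p))) (≤-trans (top (2 + p) (s≤s l)) (≤-reflexive (sym at-q+1)))
    IH = zero-block bs (suc q) (srt q g) z top'
    shifted : ∀ p → p < suc (length bs) → partAt lam (block (suc q) bs (srt q g) (q + p)) ≡ partAt lam (g (suc q + p))
    shifted zero _ rewrite +-identityʳ q = trans (cong (partAt lam) (block-below (suc q) bs (srt q g) q ≤-refl)) at-q
    shifted (suc p) (s≤s l) = trans (cong (parts (block (suc q) bs (srt q g))) (+-suc q p))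
      (trans (proj₁ IH p l) (cong (partAt lam) (trans (cong (srt q g) (sym (+-suc (suc q) p))) (trans (far p) (cong g (+-suc q (suc p)))))))

  strings-zero : ∀ k j w → Highest j (j + k) w → AllZero (strings j k w) × raise j k w ≡ w
  strings-zero zero j w _ = [] , refl
  strings-zero (suc k) j w H with H j ≤-refl (m<m+n j z<s)
  ... | e rewrite ε≡0⇒E≡ j 0 w e with strings-zero k (suc j) w (λ i p q → H i (<⇒≤ p) (≤-trans q (≤-reflexive (sym (+-suc j k)))))
  ...   | z , s = e ∷ z , s

  count-decreasing : ∀ i w → ε₀ i w ≡ 0 → count (suc i) w ≤ count i w
  count-decreasing i w e = ≤-trans (count-≤-E i w) (≤-reflexive (cong (count i) (ε≡0⇒E≡ i 0 w e)))

  count-chain : ∀ k j w → Highest j (j + k) w → ∀ p → p ≤ k → count (j + p) w ≤ count j w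
  count-chain k j w H zero _ = ≤-reflexive (cong (λ x → count x w) (+-identityʳ j))
  count-chain k j w H (suc p) l = ≤-trans
    (≤-trans (≤-reflexive (cong (λ x → count x w) (+-suc j p))) (count-decreasing (j + p) w (H (j + p) (m≤m+n j p) (+-monoʳ-< j l))))
    (count-chain k j w H p (<⇒≤ l))

  -- The raising inserts the multiplicity of j into the sorted row of the larger letters; the
  -- circled reflections must undo this insertion. If it belongs in front, all strings vanish and
  -- `zero-block` applies. Otherwise `E₀ j` exchanges it with the next multiplicity, and the
  -- insertion continues one place later.
  block-sorts : ∀ m j w q g → 1 ≤ j → j + m ≤ r → ExtremalWord w → Highest (suc j) (j + m) w →
    (∀ p → p ≤ m → partAt lam (g (q + p)) ≡ count (j + p) (raise j m w)) →
    (∀ p → p < m → partAt lam (block q (strings j m w) g (q + p)) ≡ count (suc j + p) w) ×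
    partAt lam (block q (strings j m w) g (q + m)) ≡ count j w
  block-sorts zero j w q g _ _ _ _ h = (λ _ ()) , trans (h 0 z≤n) (cong (λ x → count x w) (+-identityʳ j))
  block-sorts (suc m) j@(suc j') w q g 1≤j l x H h with ≤-total (count (suc j) w) (count j w)
  ... | inj₁ le = shift , trans (cong (λ k → partAt lam (block q (strings j (suc m) w) g (q + k))) (sym len≡))
      (trans (proj₂ Z) (trans (cong (parts g) (sym (+-identityʳ q))) (trans (h 0 z≤n) (trans (cong₂ count (+-identityʳ j) fixed) refl))))
    where
    j<r : suc j' < r
    j<r = ≤-trans (m<m+n j z<s) l
    ε≡0 : ε₀ j w ≡ 0
    ε≡0 = m+n≡m⇒n≡0 (count j w) (trans (sym (count-E-lo j 0 w)) (trans (proj₂ (extremal-E j' j<r x)) (m≥n⇒m⊔n≡m le)))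
      where
      m+n≡m⇒n≡0 : ∀ a {b} → a + b ≡ a → b ≡ 0
      m+n≡m⇒n≡0 a e = +-cancelˡ-≡ a _ _ (trans e (sym (+-identityʳ a)))
    H' : Highest j (j + suc m) w
    H' i p p' with m≤n⇒m<n∨m≡n p
    ... | inj₁ p″ = H i p″ p'
    ... | inj₂ refl = ε≡0
    len≡ = length-strings (suc m) j w
    fixed : raise j (suc m) w ≡ w
    fixed = proj₂ (strings-zero (suc m) j w H')
    value : ∀ p → p ≤ suc m → partAt lam (g (q + p)) ≡ count (j + p) w
    value p l = trans (h p l) (cong (count (j + p)) fixed)
    Z = zero-block (strings j (suc m) w) q g (proj₁ (strings-zero (suc m) j w H')) λ p l' →
      ≤-trans (≤-reflexive (value p (≤-trans l' (≤-reflexive len≡)))) (≤-trans (count-chain (suc m) j w H' p (≤-trans l' (≤-reflexive len≡)))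
        (≤-reflexive (sym (trans (cong (parts g) (sym (+-identityʳ q))) (trans (value 0 z≤n) (cong (λ k → count k w) (+-identityʳ j)))))))
    shift : ∀ p → p < suc m → partAt lam (block q (strings j (suc m) w) g (q + p)) ≡ count (suc j + p) w
    shift p l' = trans (proj₁ Z p (≤-trans l' (≤-reflexive (sym len≡)))) (trans (cong (parts g) (sym (+-suc q p)))
      (trans (value (suc p) l') (cong (λ k → count k w) (+-suc j p))))
  ... | inj₂ le = shift , trans (cong (parts (block (suc q) bs g₁)) (+-suc q m)) (trans (proj₂ IH) min≡)
    where
    j<r : suc j' < r
    j<r = ≤-trans (m<m+n j z<s) l
    w₁ = E₀ j w
    u = raise (suc j) m w₁
    bs = strings (suc j) m w₁
    t = count j w
    B = count (suc j) w
    g₁ = srtIf (ε₀ j w ≡ᵇ head₀ bs) q g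
    max≡ : count j w₁ ≡ B
    max≡ = trans (proj₂ (extremal-E j' j<r x)) (m≤n⇒m⊔n≡n le)
    min≡ : count (suc j) w₁ ≡ t
    min≡ = +-cancelˡ-≡ B _ _ (trans (cong (_+ count (suc j) w₁) (sym max≡)) (trans (count-E-sum j w) (+-comm t B)))
    at-q : partAt lam (g q) ≡ B
    at-q = trans (cong (parts g) (sym (+-identityʳ q))) (trans (h 0 z≤n)
      (trans (cong (λ k → count k u) (+-identityʳ j)) (trans (count-raise-below m (suc j) j w₁ ≤-refl) max≡)))
    at-q+1 : partAt lam (g (suc q)) ≡ count (suc j) u
    at-q+1 = trans (cong (parts g) (+-comm 1 q)) (trans (h 1 (s≤s z≤n)) (cong (λ k → count k u) (+-comm j 1)))
    first-count : ∀ m → count (suc j) (raise (suc j) m w₁) ≡ count (suc j) w₁ + head₀ (strings (suc j) m w₁)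
    first-count zero = sym (+-identityʳ _)
    first-count (suc m) = trans (count-raise-below m (2 + j) (suc j) _ ≤-refl) (count-E-lo (suc j) 0 w₁)
    -- A circle at this place means that the two parts compared are equal, so the sort is invisible
    -- after passing to parts.
    tie : ε₀ j w ≡ head₀ bs → count (suc j) u ≡ B
    tie e = trans (first-count m) (trans (cong₂ _+_ min≡ (sym e)) (trans (sym (count-E-lo j 0 w)) max≡))
    unchanged : ∀ k → partAt lam (g₁ k) ≡ partAt lam (g k)
    unchanged k with ε₀ j w ≡ᵇ head₀ bs in eq
    ... | false = refl
    ... | true with cls q k in eq'
    ...   | neither = refl
    ...   | lo rewrite lo⇒≡ q k eq' = trans (part-⊔ (g q) (g (suc q)))
            (trans (cong₂ _⊓_ at-q (trans at-q+1 (tie (≡ᵇ-true⇒≡ eq)))) (trans (⊓-idem B) (sym at-q)))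
    ...   | hi rewrite hi⇒≡ q k eq' = trans (part-⊓ (g q) (g (suc q)))
            (trans (cong₂ _⊔_ at-q (trans at-q+1 (tie (≡ᵇ-true⇒≡ eq)))) (trans (⊔-idem B) (sym (trans at-q+1 (tie (≡ᵇ-true⇒≡ eq))))))
    l' : suc j + m ≤ r
    l' = ≤-trans (≤-reflexive (sym (+-suc j m))) l
    IH = block-sorts m (suc j) w₁ (suc q) g₁ (s≤s z≤n) l' (proj₁ (extremal-E j' j<r x))
      (subst (λ n → Highest (2 + j) n w₁) (+-suc j m) (highest-E {w = w} H))
      λ p p≤m → trans (unchanged (suc q + p)) (trans (cong (parts g) (sym (+-suc q p)))
        (trans (h (suc p) (s≤s p≤m)) (cong (λ k → count k u) (+-suc j p))))
    shift : ∀ p → p < suc m → partAt lam (block (suc q) bs g₁ (q + p)) ≡ count (suc j + p) w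
    shift zero _ = trans (cong (parts (block (suc q) bs g₁)) (+-identityʳ q))
      (trans (cong (partAt lam) (block-below (suc q) bs g₁ q ≤-refl)) (trans (unchanged q) (trans at-q (cong (λ k → count k w) (sym (+-identityʳ (suc j)))))))
    shift (suc p) (s≤s p<m) = trans (cong (parts (block (suc q) bs g₁)) (+-suc q p)) (trans (proj₁ IH p p<m)
      (trans (count-E-neither j (2 + j + p) 0 w (cls-≥ j _ (s≤s (s≤s (m≤m+n j p))))) (cong (λ k → count k w) (sym (+-suc (suc j) p)))))

  -- The places below m hold the row of the letters above j, and place m+d belongs to the letter
  -- j-d, which later blocks have already settled. Starting with m = 0, all letters appear in
  -- decreasing order, the order that w₀ reverses.
  keySort-sorts : ∀ j m w g → j + m ≤ r → ExtremalWord w → Highest (suc j) (j + m) w →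
    (∀ p → p < j + m → partAt lam (g p) ≡ count (suc p) (raiseAll j m w)) →
    (∀ p → p < m → partAt lam (keySort j m w g p) ≡ count (suc j + p) w) ×
    (∀ d i → d + i ≡ j → 1 ≤ i → partAt lam (keySort j m w g (m + d)) ≡ count i w)
  keySort-sorts zero m w g _ _ _ h = h , λ d i e 1≤i → contradiction (≤-trans 1≤i (≤-trans (m≤n+m i d) (≤-reflexive e))) λ ()
  keySort-sorts (suc j) m w g l x H h =
    (λ p p<m → proj₁ blk p p<m) , rest
    where
    u = raise (suc j) m w
    bs = strings (suc j) m w
    l' = ≤-trans (≤-reflexive (+-suc j m)) l
    IH = keySort-sorts j (suc m) u g l' (extremal-raise m (suc j) w (s≤s z≤n) l x) (raise-highest-next m j w H)
      λ p p< → h p (≤-trans p< (≤-reflexive (+-suc j m)))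
    g' = keySort j (suc m) u g
    blk = block-sorts m (suc j) w 0 g' (s≤s z≤n) l x H λ p p≤m → proj₁ IH p (s≤s p≤m)
    rest : ∀ d i → d + i ≡ suc j → 1 ≤ i → partAt lam (block 0 bs g' (m + d)) ≡ count i w
    rest zero i refl _ = trans (cong (parts (block 0 bs g')) (+-identityʳ m)) (proj₂ blk)
    rest (suc d) i e 1≤i = trans
      (cong (partAt lam) (block-above 0 bs g' (m + suc d) (≤-trans (s≤s (≤-reflexive (length-strings m (suc j) w))) (m<m+n m z<s))))
      (trans (cong (parts g') (+-suc m d)) (trans (proj₂ IH d i (suc-injective e) 1≤i)
        (count-raise-below m (suc j) i w (≤-trans (s≤s (m≤n+m i d)) (≤-reflexive e)))))

  extremal-tableau : ∀ (w : Perm r) T → HasWeight lam w T → InB lam T → ExtremalWord (readWord T)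
  extremal-tableau w T wt b = T , b , refl , λ c → trans (sum-cong-≗ (λ a → cong (_∸ c) (wt a)))
    (sym (sum-permute (λ a → lookup lam a ∸ c) (P.flip w)))

  κ-extremal : ∀ (w : Perm r) T → InB lam T → HasWeight lam w T → ∀ a → lookup lam (κ T ⟨$⟩ˡ a) ≡ lookup lam (w ⟨$⟩ˡ a)
  κ-extremal w T b wt a = begin
    lookup lam (κ T ⟨$⟩ˡ a)
      ≡⟨ part-lookup lam (κ T ⟨$⟩ˡ a) ⟨
    partAt lam (toℕ (κ T ⟨$⟩ˡ a))
      ≡⟨ cong (partAt lam) (trans (sym (pos-toℕ (κ T) a)) (pos-κ 1≤r T (FP.toℕ<n a))) ⟩
    partAt lam (keySort r 0 (readWord T) (λ k → k) (r ∸ suc (toℕ a)))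
      ≡⟨ proj₂ sorted (r ∸ suc (toℕ a)) (suc (toℕ a)) (m∸n+n≡m (FP.toℕ<n a)) (s≤s z≤n) ⟩
    count (suc (toℕ a)) (readWord T)
      ≡⟨ wt a ⟩
    lookup lam (w ⟨$⟩ˡ a) ∎
    where
    open ≡-Reasoning
    sorted = keySort-sorts r 0 (readWord T) (λ k → k) (≤-reflexive (+-identityʳ r)) (extremal-tableau w T wt b)
      (highest-vacuous r (readWord T)) λ p p<r+0 → let p<r = ≤-trans p<r+0 (≤-reflexive (+-identityʳ r)) in
        trans (part-fromℕ< lam p<r) (sym (trans (cong (count (suc p)) (raiseAll≡vhw lam T b))
          (trans (cong (λ k → count (suc k) (readWord (vhw lam))) (sym (FP.toℕ-fromℕ< p<r))) (count-vhw lam (fromℕ< p<r)))))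

theorem5p5 : (r : ℕ) → 2 ≤ r → (lam : Vec ℕ r) → IsPartition lam →
    Σ (Perm r → Tab r → Set) (λ B° →
    (∀ w v → B° w v → InB lam v)
    × (∀ w w' → SameCoset lam w w' → ∀ v → B° w v ⇔ B° w' v)
    × (∀ w w' → (∀ v → B° w v ⇔ B° w' v) → SameCoset lam w w')
    × (∀ w w' → ¬ SameCoset lam w w' → ∀ v → ¬ (B° w v × B° w' v))
    × (∀ w v → InB lam v → (Dem lam w v ⇔ (∃[ y ] (y ≤B w × B° y v))))
    × (∀ w → Shortest lam w → ∀ v → B° w v ⇔ (InB lam v × (w₀ · ω v ≈ w))))
    × (∀ w → ¬ Shortest lam w → ∀ v → InB lam v → ¬ (w₀ · ω v ≈ w))
theorem5p5 r 2≤r lam partition =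
  (B° , (λ w v → proj₁) , invariant , separated , disjoint , demazure , shortest) ,
  -- A key is Bruhat-minimal in its coset, so an element equal to one has minimal length there.
  λ w not-shortest v b e → not-shortest λ w' c →
    ≤-trans (≤-reflexive (sym (len-cong (κ v) w e)))
      (≤B⇒len≤ (κ-minimal v b w' (coset-trans (κ v) w w' (≈⇒coset (κ v) w e) c)))
  where
  open Cosets lam partition
  1≤r : 1 ≤ r
  1≤r = ≤-trans (s≤s z≤n) 2≤r
  open Extremal 1≤r lam partition using (κ-extremal)

  B° : Perm r → Tab r → Set
  B° w v = InB lam v × SameCoset lam (κ v) w

  κ-minimal : ∀ v → InB lam v → ∀ w → SameCoset lam (κ v) w → κ v ≤B w
  κ-minimal v b w c = block-increasing-minimal (κ v) (adjacent⇒block (κ v) (κ-adjacent 1≤r lam v b))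
    (len w) w ≤-refl (coset⇒orbit (κ v) w c)

  invariant : ∀ w w' → SameCoset lam w w' → ∀ v → B° w v ⇔ B° w' v
  invariant w w' c v = mk⇔
    (λ (b , c') → b , coset-trans (κ v) w w' c' c)
    (λ (b , c') → b , coset-trans (κ v) w' w c' (coset-sym w w' c))

  -- The point is that the set for `w` is not empty: a tableau of weight wλ has its key in the coset
  -- of `w`, and a common member forces the cosets to agree.
  separated : ∀ w w' → (∀ v → B° w v ⇔ B° w' v) → SameCoset lam w w'
  separated w w' same with weight-exists lam partition w
  ... | v , b , weight = coset-trans w (κ v) w' (coset-sym (κ v) w c)
        (proj₂ (Equivalence.to (same v) (b , c)))
    where
    c : SameCoset lam (κ v) w
    c = orbit⇒coset (κ v) w (κ-extremal w v b weight)

  disjoint : ∀ w w' → ¬ SameCoset lam w w' → ∀ v → ¬ (B° w v × B° w' v)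
  disjoint w w' different v ((_ , c) , (_ , c')) = different (coset-trans w (κ v) w' (coset-sym (κ v) w c) c')

  demazure : ∀ w v → InB lam v → (Dem lam w v ⇔ (∃[ y ] (y ≤B w × B° y v)))
  demazure w v b = mk⇔
    (λ d → κ v , demazure⇒≤ 1≤r lam (vhw-highest lam v b) d , b , ≈⇒coset (κ v) (κ v) (λ _ → refl))
    (λ (y , y≤w , _ , c) → ≤⇒demazure 1≤r lam (len w) w ≤-refl v b (≤B-trans (κ-minimal v b y c) y≤w))

  shortest : ∀ w → Shortest lam w → ∀ v → B° w v ⇔ (InB lam v × (w₀ · ω v ≈ w))
  shortest w s v = mk⇔
    (λ (b , c) → b , ≤B-len⇒≈ (κ-minimal v b w c) (s (κ v) (coset-sym (κ v) w c)))
    (λ (b , e) → b , ≈⇒coset (κ v) w e)
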